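{- For every fixed $\varepsilon>0$ and every fixed integer $m\ge 2$, we have $\mathfrak{s}(\mathbb{Z}_m^n)\le D_{\varepsilon,m}\cdot (C_\varepsilon m^{\varepsilon})^n$ for all positive integers $n$. Here, $C_\varepsilon$ is a constant only depending on $\varepsilon$, and $D_{\varepsilon,m}$ is a constant only depending on $\varepsilon$ and $m$.
   Context: For positive integers $m,n$, the Erdős–Ginzburg–Ziv constant $\mathfrak{s}(\mathbb{Z}_m^n)$ is the smallest integer $s$ such that every sequence of $s$ elements of $\mathbb{Z}_m^n$ contains a subsequence of length $m$ whose sum is zero. Equivalently, it is the smallest $s$ such that among any $s$ points of the integer lattice $\mathbb{Z}^n$ one can find $m$ points whose centroid is again a lattice point. -}

module Defs where

open import Data.Nat using (ℕ; _+_; _≤_)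
open import Data.Nat.Divisibility using (_∣_)
open import Data.Fin using (Fin; toℕ; zero; suc)
open import Data.Fin.Subset using (Subset; inside; outside; ∣_∣)
open import Data.Vec using (_∷_; [])
open import Data.Product using (Σ; _×_)
open import Relation.Binary.PropositionalEquality using (_≡_)

ZmN : ℕ → ℕ → Set
ZmN m n = Fin n → Fin m

sumOver : ∀ {s} → Subset s → (Fin s → ℕ) → ℕ
sumOver []             f = 0
sumOver (inside  ∷ S)  f = f zero + sumOver S (λ i → f (suc i))
sumOver (outside ∷ S)  f = sumOver S (λ i → f (suc i))

ZeroSum : ∀ {m n s} → (Fin s → ZmN m n) → Subset s → Set
ZeroSum {m} {n} x S = (j : Fin n) → m ∣ sumOver S (λ i → toℕ (x i j))

HasEGZProperty : ℕ → ℕ → ℕ → Set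
HasEGZProperty m n s =
  (x : Fin s → ZmN m n) → Σ (Subset s) (λ S → (∣ S ∣ ≡ m) × ZeroSum x S)

IsEGZConstant : ℕ → ℕ → ℕ → Set
IsEGZConstant m n s = HasEGZProperty m n s × ((t : ℕ) → HasEGZProperty m n t → s ≤ t)

{-# OPTIONS --safe #-}
-- It suffices to treat ε = 1/q and m = p prime, since zero-sum blocks modulo a can be divided by a and combined
-- modulo b. Suppose that a long sequence in V = 𝔽_p^n has no p terms with sum zero.
--
-- Start from the zero-sum tuples (x, …, x) and try to remove coincidences. From many disjoint zero-sum p-tuples with
-- the same coincidences x_j = x_j', the slice rank method (p colours: at most p 4^n, and c_k^n when only a k-th part of
-- the colours is mixed) gives recombinations Σ_j x_j^{i(j)} = 0 with non-constant i. Either some partial colour sum is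
-- constant on a c^{-n} fraction of the tuples, and the colours split into classes with independent indices, or a random
-- set of c^n indices has a recombination with K different indices. In both cases K terms, including x_{j₁}, may be
-- exchanged for any K terms with the same sum. An exchange that moves x_{j₁} separates the coincident pair j₁, j₂. So
-- all coincidences can be removed, unless for a dense set F of K-tuples of terms the sum determines the first term.
--
-- Then F has a fibre with N times fewer sums, N being the length of the sequence. By dependent random choice and
-- Plünnecke's inequality a dense subsequence has L-fold sums in a set N^{1/2} times smaller than the K-fold sums of
-- the whole sequence (L much smaller than K). As N ≥ p^{n/q}, after 2q + 1 rounds less than one sum is left.
module Submission where

open import Defs
open import Data.Nat hiding (_≟_)
open import Data.Nat.Properties hiding (_≟_)
open import Data.Nat.DivMod using (_/_; _%_; /-mono-≤; m*n/n≡m; m/n*n≤m; m≡m%n+[m/n]*n; m%n<n; m%n%n≡m%n; m*n%n≡0; n%n≡0; m<n⇒m%n≡m; %-distribˡ-+)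
import Data.Nat.Divisibility as ∣ᴺ
open import Data.Nat.ListAction using (product)
open import Data.Nat.Primality using (Prime; euclidsLemma; prime⇒nonZero; prime⇒nonTrivial; productOfPrimes≥1)
open import Data.Nat.Primality.Factorisation using (factorise; PrimeFactorisation)
open import Data.Nat.Tactic.RingSolver using (solve-∀)
open import Data.Integer using (ℤ; ∣_∣; 0ℤ; 1ℤ) renaming (+_ to pos; _+_ to _+ᶻ_; _*_ to _*ᶻ_; -_ to -ᶻ_; _-_ to _-ᶻ_; _^_ to _^ᶻ_)
import Data.Integer as ℤ
import Data.Integer.Properties as ℤ
import Data.Integer.DivMod as ℤ
import Data.Integer.Divisibility.Signed as ∣ᶻ
open import Data.Integer.Tactic.RingSolver using () renaming (solve-∀ to solveᶻ-∀)
open import Data.Bool using (Bool; true; false; T; _∧_; _∨_; not; if_then_else_)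
import Data.Bool as Bool
open import Data.Fin using (Fin; zero; suc; toℕ)
import Data.Fin as Fin
import Data.Fin.Properties as Fin
open import Data.Fin.Subset using (Subset; inside; outside) renaming (∣_∣ to ∣_∣ˢ)
open import Data.Vec using (Vec; []; _∷_)
import Data.Vec as Vec
import Data.Vec.Properties as Vec
open import Data.Vec.Functional using (insertAt)
open import Data.Vec.Functional.Properties using (insertAt-lookup; insertAt-punchIn)
open import Data.List using (List; []; _∷_; _++_)
import Data.List as List
import Data.List.Properties as List
open import Data.List.Membership.Propositional using () renaming (_∈_ to _∈ᴸ_)
import Data.List.Membership.Propositional.Properties as ∈ᴸ
open import Data.List.Relation.Unary.All using (All; []; _∷_)
import Data.List.Relation.Unary.All as All
import Data.List.Relation.Unary.All.Properties as All
open import Data.List.Relation.Unary.Any using (here; there)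
open import Data.Product using (Σ; ∃; ∃-syntax; _×_; _,_; proj₁; proj₂)
open import Data.Sum using (_⊎_; inj₁; inj₂)
open import Data.Empty using (⊥; ⊥-elim)
open import Data.Unit using (tt)
open import Function using (_∘_; id)
open import Level using (0ℓ)
open import Algebra.Bundles using (AbelianGroup)
import Algebra.Properties.AbelianGroup as AbelianGroupProperties
open import Algebra.Structures using (IsAbelianGroup)
open import Relation.Nullary using (¬_; Dec; yes; no; does)
open import Relation.Nullary.Decidable using (¬¬-excluded-middle; ¬?; _×-dec_; _⊎-dec_; T?; map′; decidable-stable)
open import Relation.Binary.Definitions using (DecidableEquality)
open import Relation.Binary.PropositionalEquality

-- The base C must not depend on the prime p, which shapes the whole proof. A monomial of degree n(p
-- - 1) has degree at most Kn in at least one of any p/K colours, so the slice rank method needs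
-- only 2^((K + 1)n) monomials for each colour, and K, unlike p, may enter the base. K depends on q
-- alone: there are 2q + 1 rounds, and the length of the sums in one round fixes the length in the
-- round before it. In exponents of v = p^n, fixing the first term gains a factor of at least
-- v^(1/q) per round, and passing to long sums costs at most v^(1/2q), so a gain of v^(1/2q)
-- remains. The cost can be kept that small because the number e of available scales is chosen after
-- the number L of summands to which Plünnecke's inequality is applied. Minimal sets and the choice
-- between splitting and sampling are not decided by computation. Most statements therefore conclude
-- ⊥ and take their result as a continuation; the finiteness of the original problem turns the final
-- ⊥ into a witness. Roots and quotients are replaced by powers and products.

variable
  𝕏 𝕐 : Set

-- Reasoning towards ⊥, Boolean sets and sums over lists

lem : (P : Set) → (Dec P → ⊥) → ⊥
lem P = ¬¬-excluded-middle

-- The double-negation shift holds over a finite index set by induction, so finitely many undecided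
-- cases can be decided together inside a proof of ⊥.
¬¬-choice : ∀ {m} {P : Fin m → Set} → (∀ i → (P i → ⊥) → ⊥) → ((∀ i → P i) → ⊥) → ⊥
¬¬-choice {zero}  f k = k (λ ())
¬¬-choice {suc m} f k =
  f zero (λ p0 → ¬¬-choice (f ∘ suc) (λ ps → k (λ { zero → p0 ; (suc i) → ps i })))

𝟙 : Bool → ℕ
𝟙 true  = 1
𝟙 false = 0

χ : {P : Set} → Dec P → ℕ
χ d = 𝟙 (does d)

infix 4 _∈_ _∉_
_∈_ : 𝕏 → (𝕏 → Bool) → Set
x ∈ F = T (F x)

_∉_ : 𝕏 → (𝕏 → Bool) → Set
x ∉ F = ¬ (x ∈ F)

∈? : (F : 𝕏 → Bool) (x : 𝕏) → Dec (x ∈ F)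
∈? F x = T? (F x)

set : {P : 𝕏 → Set} → (∀ x → Dec (P x)) → 𝕏 → Bool
set P? x = does (P? x)

out : {P : Set} (d : Dec P) → T (does d) → P
out (yes p) _ = p

into : {P : Set} (d : Dec P) → P → T (does d)
into (yes _) _ = tt
into (no ¬p) p = ¬p p

𝟙-mono : ∀ {a b} → (T a → T b) → 𝟙 a ≤ 𝟙 b
𝟙-mono {false}        f = z≤n
𝟙-mono {true} {true}  f = ≤-refl
𝟙-mono {true} {false} f = ⊥-elim (f tt)

𝟙≤1 : ∀ a → 𝟙 a ≤ 1
𝟙≤1 true  = ≤-refl
𝟙≤1 false = z≤n

𝟙-yes : ∀ {a} → T a → 𝟙 a ≡ 1
𝟙-yes {true} _ = refl

𝟙-no : ∀ {a} → ¬ T a → 𝟙 a ≡ 0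
𝟙-no {true}  n = ⊥-elim (n tt)
𝟙-no {false} n = refl

𝟙-inv : ∀ {a} → 1 ≤ 𝟙 a → T a
𝟙-inv {true} _ = tt

sumL : (𝕏 → ℕ) → List 𝕏 → ℕ
sumL f []       = 0
sumL f (x ∷ xs) = f x + sumL f xs

sumL-cong : {f g : 𝕏 → ℕ} → (∀ x → f x ≡ g x) → ∀ xs → sumL f xs ≡ sumL g xs
sumL-cong e []       = refl
sumL-cong e (x ∷ xs) = cong₂ _+_ (e x) (sumL-cong e xs)

sumL-mono : {f g : 𝕏 → ℕ} → (∀ x → f x ≤ g x) → ∀ xs → sumL f xs ≤ sumL g xs
sumL-mono e []       = z≤n
sumL-mono e (x ∷ xs) = +-mono-≤ (e x) (sumL-mono e xs)

sumL-0 : ∀ (xs : List 𝕏) → sumL (λ _ → 0) xs ≡ 0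
sumL-0 []       = refl
sumL-0 (x ∷ xs) = sumL-0 xs

+-interchange : ∀ a b c d → (a + b) + (c + d) ≡ (a + c) + (b + d)
+-interchange = solve-∀

sumL-+ : (f g : 𝕏 → ℕ) → ∀ xs → sumL (λ x → f x + g x) xs ≡ sumL f xs + sumL g xs
sumL-+ f g []       = refl
sumL-+ f g (x ∷ xs) =
  trans (cong (f x + g x +_) (sumL-+ f g xs)) (+-interchange (f x) (g x) _ _)

sumL-*ˡ : (c : ℕ) (f : 𝕏 → ℕ) → ∀ xs → sumL (λ x → c * f x) xs ≡ c * sumL f xs
sumL-*ˡ c f []       = sym (*-zeroʳ c)
sumL-*ˡ c f (x ∷ xs) =
  trans (cong (c * f x +_) (sumL-*ˡ c f xs)) (sym (*-distribˡ-+ c (f x) _))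

sumL-swap : (f : 𝕏 → 𝕐 → ℕ) → ∀ xs ys →
  sumL (λ x → sumL (f x) ys) xs ≡ sumL (λ y → sumL (λ x → f x y) xs) ys
sumL-swap f []       ys = sym (sumL-0 ys)
sumL-swap f (x ∷ xs) ys =
  trans (cong (sumL (f x) ys +_) (sumL-swap f xs ys))
        (sym (sumL-+ (f x) (λ y → sumL (λ x → f x y) xs) ys))

sumL-map : (f : 𝕐 → ℕ) (g : 𝕏 → 𝕐) → ∀ xs → sumL f (List.map g xs) ≡ sumL (f ∘ g) xs
sumL-map f g []       = refl
sumL-map f g (x ∷ xs) = cong (f (g x) +_) (sumL-map f g xs)

sumL-++ : (f : 𝕏 → ℕ) → ∀ xs ys → sumL f (xs ++ ys) ≡ sumL f xs + sumL f ys
sumL-++ f []       ys = refl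
sumL-++ f (x ∷ xs) ys = trans (cong (f x +_) (sumL-++ f xs ys)) (sym (+-assoc (f x) _ _))

sumL-< : {f g : 𝕏 → ℕ} → ∀ xs → sumL f xs < sumL g xs → ∃[ x ] f x < g x
sumL-< []       ()
sumL-< {f = f} {g} (x ∷ xs) lt with f x <? g x
... | yes p = x , p
... | no ¬p = sumL-< xs (+-cancelˡ-< (f x) _ _
                (<-≤-trans lt (+-monoˡ-≤ (sumL g xs) (≮⇒≥ ¬p))))

-- Finite types, sums and cardinalities

-- `once` expresses that the list omits nothing and repeats nothing, in the form in which it is
-- applied: a point mass has total 1.
record Enum (𝕏 : Set) : Set where
  field
    elems : List 𝕏
    _≟_   : DecidableEquality 𝕏
    once  : ∀ a → sumL (λ x → χ (x ≟ a)) elems ≡ 1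

open Enum {{...}} public using (_≟_)

opaque
  ∑ : {{Enum 𝕏}} → (𝕏 → ℕ) → ℕ
  ∑ {{E}} f = sumL f (Enum.elems E)

  # : {{Enum 𝕏}} → (𝕏 → Bool) → ℕ
  # F = ∑ (λ x → 𝟙 (F x))

  #-def : {{E : Enum 𝕏}} (F : 𝕏 → Bool) → # F ≡ ∑ (λ x → 𝟙 (F x))
  #-def F = refl

size : (𝕏 : Set) → {{Enum 𝕏}} → ℕ
size 𝕏 = ∑ {𝕏} (λ _ → 1)

module _ {{E : Enum 𝕏}} where
 opaque
  unfolding ∑

  ∑-cong : {f g : 𝕏 → ℕ} → (∀ x → f x ≡ g x) → ∑ f ≡ ∑ g
  ∑-cong e = sumL-cong e (Enum.elems E)

  ∑-mono : {f g : 𝕏 → ℕ} → (∀ x → f x ≤ g x) → ∑ f ≤ ∑ g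
  ∑-mono e = sumL-mono e (Enum.elems E)

  ∑-+ : (f g : 𝕏 → ℕ) → ∑ (λ x → f x + g x) ≡ ∑ f + ∑ g
  ∑-+ f g = sumL-+ f g (Enum.elems E)

  ∑-*ˡ : (c : ℕ) (f : 𝕏 → ℕ) → ∑ (λ x → c * f x) ≡ c * ∑ f
  ∑-*ˡ c f = sumL-*ˡ c f (Enum.elems E)

  ∑-*ʳ : (f : 𝕏 → ℕ) (c : ℕ) → ∑ (λ x → f x * c) ≡ ∑ f * c
  ∑-*ʳ f c = trans (∑-cong (λ x → *-comm (f x) c)) (trans (∑-*ˡ c f) (*-comm c _))

  ∑-const : (c : ℕ) → ∑ {𝕏} (λ _ → c) ≡ c * size 𝕏
  ∑-const c = trans (∑-cong (λ _ → sym (*-identityʳ c))) (∑-*ˡ c (λ _ → 1))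

  ∑-< : {f g : 𝕏 → ℕ} → ∑ f < ∑ g → ∃[ x ] f x < g x
  ∑-< = sumL-< (Enum.elems E)

  ∑-0 : ∑ {𝕏} (λ _ → 0) ≡ 0
  ∑-0 = sumL-0 (Enum.elems E)

  ∑-δ : (a : 𝕏) (g : 𝕏 → ℕ) → ∑ (λ x → χ (x ≟ a) * g x) ≡ g a
  ∑-δ a g = trans (∑-cong eq) (trans (∑-*ʳ (λ x → χ (x ≟ a)) (g a))
              (trans (cong (_* g a) (Enum.once E a)) (*-identityˡ (g a))))
    where
    eq : ∀ x → χ (x ≟ a) * g x ≡ χ (x ≟ a) * g a
    eq x with x ≟ a
    ... | yes refl = refl
    ... | no _     = refl

  ∑-once : (a : 𝕏) → ∑ (λ x → χ (x ≟ a)) ≡ 1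
  ∑-once a = Enum.once E a

  ∑-≥ : (f : 𝕏 → ℕ) (a : 𝕏) → f a ≤ ∑ f
  ∑-≥ f a = subst (_≤ ∑ f) (∑-δ a f) (∑-mono le)
    where
    le : ∀ x → χ (x ≟ a) * f x ≤ f x
    le x = subst (χ (x ≟ a) * f x ≤_) (*-identityˡ (f x)) (*-monoˡ-≤ (f x) {χ (x ≟ a)} {1} (𝟙≤1 _))

  #-mono : {F G : 𝕏 → Bool} → (∀ x → x ∈ F → x ∈ G) → # F ≤ # G
  #-mono h = ∑-mono (λ x → 𝟙-mono (h x))

  #-≤size : (F : 𝕏 → Bool) → # F ≤ size 𝕏
  #-≤size F = ∑-mono (λ x → 𝟙≤1 (F x))

  #-pos : {F : 𝕏 → Bool} {a : 𝕏} → a ∈ F → 1 ≤ # F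
  #-pos {F} {a} h = ≤-trans (≤-reflexive (sym (𝟙-yes h))) (∑-≥ (𝟙 ∘ F) a)

  #-∃ : {F : 𝕏 → Bool} → 1 ≤ # F → ∃[ x ] x ∈ F
  #-∃ {F} h with ∑-< {f = λ _ → 0} {𝟙 ∘ F} (subst (_< # F) (sym ∑-0) h)
  ... | x , p = x , 𝟙-inv p

  #-unique : {F : 𝕏 → Bool} → (∀ x y → x ∈ F → y ∈ F → x ≡ y) → # F ≤ 1
  #-unique {F} u with 1 ≤? # F
  ... | no ¬p = <⇒≤ (≰⇒> ¬p)
  ... | yes p with #-∃ {F} p
  ...   | a , ha = ≤-trans (∑-mono le) (≤-reflexive (Enum.once E a))
    where
    le : ∀ x → 𝟙 (F x) ≤ χ (x ≟ a)
    le x = 𝟙-mono (λ hx → into (x ≟ a) (u x a hx ha))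

  any? : {P : 𝕏 → Set} → (∀ x → Dec (P x)) → Dec (∃ P)
  any? P? with 1 ≤? # (set P?)
  ... | yes p = yes (let (x , h) = #-∃ p in x , out (P? x) h)
  ... | no ¬p = no (λ { (x , h) → ¬p (#-pos {set P?} {x} (into (P? x) h)) })

  all? : {P : 𝕏 → Set} → (∀ x → Dec (P x)) → Dec (∀ x → P x)
  all? P? with any? (λ x → ¬? (P? x))
  ... | yes (x , h) = no (λ f → h (f x))
  ... | no ¬e       = yes (λ x → decidable-stable (P? x) (λ h → ¬e (x , h)))

  #-∪ : (F G : 𝕏 → Bool) → # (λ x → F x ∨ G x) ≤ # F + # G
  #-∪ F G = ≤-trans (∑-mono (λ x → le (F x) (G x))) (≤-reflexive (∑-+ _ _))
    where
    le : ∀ a b → 𝟙 (a ∨ b) ≤ 𝟙 a + 𝟙 b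
    le true  b = s≤s z≤n
    le false b = ≤-refl

  #-split : (F G : 𝕏 → Bool) → # F ≡ # (λ x → F x ∧ G x) + # (λ x → F x ∧ not (G x))
  #-split F G = trans (∑-cong (λ x → eq (F x) (G x))) (∑-+ _ _)
    where
    eq : ∀ a b → 𝟙 a ≡ 𝟙 (a ∧ b) + 𝟙 (a ∧ not b)
    eq true  true  = refl
    eq true  false = refl
    eq false b     = refl

∧-in : ∀ {a b} → T a → T b → T (a ∧ b)
∧-in {true} _ h = h

∧-l : ∀ {a b} → T (a ∧ b) → T a
∧-l {true} _ = tt

∧-r : ∀ {a b} → T (a ∧ b) → T b
∧-r {true} h = h

not-in : ∀ {a} → ¬ T a → T (not a)
not-in {true}  h = ⊥-elim (h tt)
not-in {false} h = tt

not-out : ∀ {a} → T (not a) → ¬ T a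
not-out {true} () _
not-out {false} _ ()

∨-in-l : ∀ {a b} → T a → T (a ∨ b)
∨-in-l {true} _ = tt

∨-in-r : ∀ {a b} → T b → T (a ∨ b)
∨-in-r {true}  _ = tt
∨-in-r {false} h = h

∨-out : ∀ {a b} → T (a ∨ b) → T a ⊎ T b
∨-out {true}  h = inj₁ h
∨-out {false} h = inj₂ h

module _ {{E : Enum 𝕏}} {{E' : Enum 𝕐}} where
 opaque
  unfolding ∑

  ∑-swap : (f : 𝕏 → 𝕐 → ℕ) → ∑ (λ x → ∑ (f x)) ≡ ∑ (λ y → ∑ (λ x → f x y))
  ∑-swap f = sumL-swap f (Enum.elems E) (Enum.elems E')

  ∑-inj : (φ : 𝕏 → 𝕐) → (∀ x x' → φ x ≡ φ x' → x ≡ x') → (g : 𝕐 → ℕ) → ∑ (g ∘ φ) ≤ ∑ g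
  ∑-inj φ inj g = begin
    ∑ (g ∘ φ)                                      ≡⟨ ∑-cong (λ x → sym (∑-δ (φ x) g)) ⟩
    ∑ (λ x → ∑ (λ y → χ (y ≟ φ x) * g y))          ≡⟨ ∑-swap _ ⟩
    ∑ (λ y → ∑ (λ x → χ (y ≟ φ x) * g y))          ≡⟨ ∑-cong (λ y → ∑-*ʳ (λ x → χ (y ≟ φ x)) (g y)) ⟩
    ∑ (λ y → # (λ x → does (y ≟ φ x)) * g y)       ≤⟨ ∑-mono (λ y → *-monoˡ-≤ (g y) (#-unique (u y))) ⟩
    ∑ (λ y → 1 * g y)                              ≡⟨ ∑-cong (λ y → *-identityˡ (g y)) ⟩
    ∑ g ∎
    where
    open ≤-Reasoning
    u : ∀ y x x' → T (does (y ≟ φ x)) → T (does (y ≟ φ x')) → x ≡ x'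
    u y x x' h h' = inj x x' (trans (sym (out (y ≟ φ x) h)) (out (y ≟ φ x') h'))

  #-inj : {F : 𝕏 → Bool} {G : 𝕐 → Bool} (φ : 𝕏 → 𝕐) → (∀ x x' → φ x ≡ φ x' → x ≡ x') →
          (∀ x → x ∈ F → φ x ∈ G) → # F ≤ # G
  #-inj {F} {G} φ inj h = ≤-trans (#-mono {F = F} {G ∘ φ} h) (∑-inj φ inj (𝟙 ∘ G))

∑-bij : {{E : Enum 𝕏}} (φ ψ : 𝕏 → 𝕏) → (∀ x → ψ (φ x) ≡ x) → (∀ x → φ (ψ x) ≡ x) →
        (g : 𝕏 → ℕ) → ∑ (g ∘ φ) ≡ ∑ g
∑-bij φ ψ ψφ φψ g = ≤-antisym
  (∑-inj φ (λ x x' e → trans (sym (ψφ x)) (trans (cong ψ e) (ψφ x'))) g)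
  (≤-trans (≤-reflexive (∑-cong (λ x → cong g (sym (φψ x)))))
           (∑-inj ψ (λ x x' e → trans (sym (φψ x)) (trans (cong φ e) (φψ x'))) (g ∘ φ)))

finL : ∀ m → List (Fin m)
finL zero    = []
finL (suc m) = zero ∷ List.map suc (finL m)

fin-once : ∀ m (a : Fin m) → sumL (λ x → χ (x Fin.≟ a)) (finL m) ≡ 1
fin-once (suc m) zero    =
  cong suc (trans (sumL-map _ suc (finL m)) (sumL-0 (finL m)))
fin-once (suc m) (suc a) =
  trans (sumL-map _ suc (finL m)) (trans (sumL-cong eq (finL m)) (fin-once m a))
  where
  eq : ∀ x → χ (suc x Fin.≟ suc a) ≡ χ (x Fin.≟ a)
  eq x with x Fin.≟ a
  ... | yes _ = refl
  ... | no _  = refl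

instance
  enumFin : ∀ {m} → Enum (Fin m)
  enumFin {m} = record { elems = finL m ; _≟_ = Fin._≟_ ; once = fin-once m }

opaque
  unfolding ∑

  ∑-suc : ∀ {m} (f : Fin (suc m) → ℕ) → ∑ f ≡ f zero + ∑ (f ∘ suc)
  ∑-suc {m} f = cong (f zero +_) (sumL-map f suc (finL m))

  #-suc : ∀ {m} (F : Fin (suc m) → Bool) → # F ≡ 𝟙 (F zero) + # (F ∘ suc)
  #-suc F = ∑-suc (𝟙 ∘ F)

  size-Fin0 : size (Fin 0) ≡ 0
  size-Fin0 = refl

size-Fin : ∀ m → size (Fin m) ≡ m
size-Fin zero    = size-Fin0
size-Fin (suc m) = trans (∑-suc {m} (λ _ → 1)) (cong suc (size-Fin m))

vecL : List 𝕏 → ∀ k → List (Vec 𝕏 k)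
vecL xs zero    = [] ∷ []
vecL xs (suc k) = List.concatMap (λ x → List.map (x ∷_) (vecL xs k)) xs

sumL-concatMap : (f : 𝕐 → ℕ) (g : 𝕏 → List 𝕐) → ∀ xs →
  sumL f (List.concatMap g xs) ≡ sumL (λ x → sumL f (g x)) xs
sumL-concatMap f g []       = refl
sumL-concatMap f g (x ∷ xs) =
  trans (sumL-++ f (g x) _) (cong (sumL f (g x) +_) (sumL-concatMap f g xs))

sumL-vec : (xs : List 𝕏) (k : ℕ) (f : Vec 𝕏 (suc k) → ℕ) →
  sumL f (vecL xs (suc k)) ≡ sumL (λ x → sumL (λ w → f (x ∷ w)) (vecL xs k)) xs
sumL-vec xs k f =
  trans (sumL-concatMap f (λ x → List.map (x ∷_) (vecL xs k)) xs)
        (sumL-cong (λ x → sumL-map f (x ∷_) (vecL xs k)) xs)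

module _ {{E : Enum 𝕏}} where

  vec-once : ∀ k (a : Vec 𝕏 k) → sumL (λ w → χ (Vec.≡-dec _≟_ w a)) (vecL (Enum.elems E) k) ≡ 1
  vec-once zero    []      = refl
  vec-once (suc k) (b ∷ a) = begin
    sumL (λ w → χ (Vec.≡-dec _≟_ w (b ∷ a))) (vecL es (suc k))
      ≡⟨ sumL-vec es k (λ w → χ (Vec.≡-dec _≟_ w (b ∷ a))) ⟩
    sumL (λ x → sumL (λ w → χ (Vec.≡-dec _≟_ (x ∷ w) (b ∷ a))) (vecL es k)) es
      ≡⟨ sumL-cong (λ x → trans (sumL-cong (eq x) (vecL es k)) (sumL-*ˡ (χ (x ≟ b)) _ (vecL es k))) es ⟩
    sumL (λ x → χ (x ≟ b) * sumL (λ w → χ (Vec.≡-dec _≟_ w a)) (vecL es k)) es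
      ≡⟨ sumL-cong (λ x → trans (cong (χ (x ≟ b) *_) (vec-once k a)) (*-identityʳ _)) es ⟩
    sumL (λ x → χ (x ≟ b)) es ≡⟨ Enum.once E b ⟩
    1 ∎
    where
    open ≡-Reasoning
    es = Enum.elems E
    eq : ∀ x w → χ (Vec.≡-dec _≟_ (x ∷ w) (b ∷ a)) ≡ χ (x ≟ b) * χ (Vec.≡-dec _≟_ w a)
    eq x w with x ≟ b | Vec.≡-dec _≟_ w a
    ... | yes _ | yes _ = refl
    ... | yes _ | no _  = refl
    ... | no _  | yes _ = refl
    ... | no _  | no _  = refl

  instance
    enumVec : ∀ {k} → Enum (Vec 𝕏 k)
    enumVec {k} = record { elems = vecL (Enum.elems E) k ; _≟_ = Vec.≡-dec _≟_ ; once = vec-once k }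

  opaque
    unfolding ∑

    ∑-[] : (f : Vec 𝕏 0 → ℕ) → ∑ f ≡ f []
    ∑-[] f = +-identityʳ _

    ∑-∷ : ∀ {k} (f : Vec 𝕏 (suc k) → ℕ) → ∑ f ≡ ∑ (λ x → ∑ (λ w → f (x ∷ w)))
    ∑-∷ {k} f = sumL-vec (Enum.elems E) k f

    #-∷ : ∀ {k} (F : Vec 𝕏 (suc k) → Bool) → # F ≡ ∑ (λ x → # (λ w → F (x ∷ w)))
    #-∷ F = ∑-∷ (𝟙 ∘ F)

  size-Vec : ∀ k → size (Vec 𝕏 k) ≡ size 𝕏 ^ k
  size-Vec zero    = ∑-[] (λ _ → 1)
  size-Vec (suc k) = begin
    size (Vec 𝕏 (suc k))                ≡⟨ ∑-∷ {k} (λ _ → 1) ⟩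
    ∑ {𝕏} (λ _ → size (Vec 𝕏 k))        ≡⟨ ∑-const _ ⟩
    size (Vec 𝕏 k) * size 𝕏             ≡⟨ *-comm _ (size 𝕏) ⟩
    size 𝕏 * size (Vec 𝕏 k)             ≡⟨ cong (size 𝕏 *_) (size-Vec k) ⟩
    size 𝕏 * size 𝕏 ^ k ∎
    where open ≡-Reasoning

  ∑-vec++ : ∀ j {k} (f : Vec 𝕏 (j + k) → ℕ) →
    ∑ f ≡ ∑ (λ (u : Vec 𝕏 j) → ∑ (λ (w : Vec 𝕏 k) → f (u Vec.++ w)))
  ∑-vec++ zero    {k} f = sym (∑-[] _)
  ∑-vec++ (suc j) {k} f = begin
    ∑ f                                                   ≡⟨ ∑-∷ f ⟩
    ∑ (λ x → ∑ (λ v → f (x ∷ v)))                         ≡⟨ ∑-cong (λ x → ∑-vec++ j (λ v → f (x ∷ v))) ⟩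
    ∑ (λ x → ∑ (λ (u : Vec 𝕏 j) → ∑ (λ (w : Vec 𝕏 k) → f (x ∷ (u Vec.++ w)))))
      ≡⟨ sym (∑-∷ (λ (u : Vec 𝕏 (suc j)) → ∑ (λ (w : Vec 𝕏 k) → f (u Vec.++ w)))) ⟩
    ∑ (λ (u : Vec 𝕏 (suc j)) → ∑ (λ (w : Vec 𝕏 k) → f (u Vec.++ w))) ∎
    where open ≡-Reasoning

pick : ∀ {m} (F : Fin m → Bool) {k} → k ≤ # F →
  Σ (Fin k → Fin m) λ ι → (∀ s t → ι s ≡ ι t → s ≡ t) × (∀ t → ι t ∈ F)
pick F {zero} _ = (λ ()) , (λ ()) , (λ ())
pick {zero}  F {suc k} h = ⊥-elim (<⇒≱ (≤-<-trans (#-≤size F) (≤-reflexive (cong suc size-Fin0))) (≤-trans (s≤s z≤n) h))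
pick {suc m} F {suc k} h = go (F zero) refl
  where
  h' : suc k ≤ 𝟙 (F zero) + # (F ∘ suc)
  h' = subst (suc k ≤_) (#-suc F) h
  go : ∀ b → F zero ≡ b →
    Σ (Fin (suc k) → Fin (suc m)) λ ι → (∀ s t → ι s ≡ ι t → s ≡ t) × (∀ t → ι t ∈ F)
  go true e with pick (F ∘ suc) {k} (s≤s⁻¹ (subst (λ b → suc k ≤ 𝟙 b + # (F ∘ suc)) e h'))
  ... | ι , inj , mem = ι' , inj' , mem'
    where
    ι' : Fin (suc k) → Fin (suc m)
    ι' zero    = zero
    ι' (suc t) = suc (ι t)
    inj' : ∀ s t → ι' s ≡ ι' t → s ≡ t
    inj' zero    zero    _ = refl
    inj' (suc s) (suc t) q = cong suc (inj s t (Fin.suc-injective q))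
    mem' : ∀ t → ι' t ∈ F
    mem' zero    = subst T (sym e) tt
    mem' (suc t) = mem t
  go false e with pick (F ∘ suc) {suc k} (subst (λ b → suc k ≤ 𝟙 b + # (F ∘ suc)) e h')
  ... | ι , inj , mem = suc ∘ ι , (λ s t q → inj s t (Fin.suc-injective q)) , mem

fibres : {{E : Enum 𝕏}} {{E' : Enum 𝕐}} (f : 𝕏 → 𝕐) → ∑ (λ y → # (λ x → does (f x ≟ y))) ≡ size 𝕏
fibres {𝕐 = 𝕐} {{E' = E'}} f = trans (∑-cong (λ y → #-def _)) (trans (∑-swap _)
  (∑-cong (λ x → trans (∑-cong (λ y → sy (f x) y)) (∑-once (f x)))))
  where
  sy : ∀ (a y : 𝕐) → χ (a ≟ y) ≡ χ (y ≟ a)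
  sy a y with a ≟ y | y ≟ a
  ... | yes _ | yes _ = refl
  ... | no _  | no _  = refl
  ... | yes p | no q  = ⊥-elim (q (sym p))
  ... | no p  | yes q = ⊥-elim (p (sym q))

pigeon : ∀ {{E' : Enum 𝕐}} {m} (f : Fin m → 𝕐) (c : ℕ) → c * size 𝕐 < m →
  ∃[ y ] Σ (Fin (suc c) → Fin m) λ ι → (∀ s t → ι s ≡ ι t → s ≡ t) × (∀ t → f (ι t) ≡ y)
pigeon {𝕐} {m} f c lt with ∑-< {𝕐} {f = λ _ → c} {λ y → # (λ x → does (f x ≟ y))}
    (subst₂ _<_ (sym (∑-const c)) (sym (trans (fibres f) (size-Fin m))) lt)
... | y , h with pick (λ x → does (f x ≟ y)) h
...   | ι , inj , mem = y , ι , inj , λ t → out (f (ι t) ≟ y) (mem t)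

-- The slice rank method modulo p

opaque
  sumZ : ∀ {m} → (Fin m → ℤ) → ℤ
  sumZ {zero}  f = 0ℤ
  sumZ {suc m} f = f zero +ᶻ sumZ (f ∘ suc)

  sumZ-zero : {f : Fin 0 → ℤ} → sumZ f ≡ 0ℤ
  sumZ-zero = refl

  sumZ-suc : ∀ {m} (f : Fin (suc m) → ℤ) → sumZ f ≡ f zero +ᶻ sumZ (f ∘ suc)
  sumZ-suc f = refl

  sumZ-cong : ∀ {m} {f g : Fin m → ℤ} → (∀ i → f i ≡ g i) → sumZ f ≡ sumZ g
  sumZ-cong {zero}  e = refl
  sumZ-cong {suc m} e = cong₂ _+ᶻ_ (e zero) (sumZ-cong (e ∘ suc))

  interchangeᶻ : ∀ a b c d → (a +ᶻ b) +ᶻ (c +ᶻ d) ≡ (a +ᶻ c) +ᶻ (b +ᶻ d)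
  interchangeᶻ = solveᶻ-∀

  sumZ-+ : ∀ {m} (f g : Fin m → ℤ) → sumZ (λ i → f i +ᶻ g i) ≡ sumZ f +ᶻ sumZ g
  sumZ-+ {zero}  f g = refl
  sumZ-+ {suc m} f g = trans (cong ((f zero +ᶻ g zero) +ᶻ_) (sumZ-+ (f ∘ suc) (g ∘ suc)))
                             (interchangeᶻ (f zero) (g zero) _ _)

  sumZ-*ˡ : ∀ {m} c (f : Fin m → ℤ) → sumZ (λ i → c *ᶻ f i) ≡ c *ᶻ sumZ f
  sumZ-*ˡ {zero}  c f = sym (ℤ.*-zeroʳ c)
  sumZ-*ˡ {suc m} c f = trans (cong (c *ᶻ f zero +ᶻ_) (sumZ-*ˡ c (f ∘ suc)))
                              (sym (ℤ.*-distribˡ-+ c (f zero) _))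

  sumZ-0 : ∀ {m} → sumZ {m} (λ _ → 0ℤ) ≡ 0ℤ
  sumZ-0 {zero}  = refl
  sumZ-0 {suc m} = trans (ℤ.+-identityˡ _) (sumZ-0 {m})

  sumZ-swap : ∀ {m n} (f : Fin m → Fin n → ℤ) →
    sumZ (λ i → sumZ (f i)) ≡ sumZ (λ j → sumZ (λ i → f i j))
  sumZ-swap {zero}  {n} f = sym (sumZ-0 {n})
  sumZ-swap {suc m} f = trans (cong (sumZ (f zero) +ᶻ_) (sumZ-swap (f ∘ suc)))
    (sym (sumZ-+ (f zero) (λ j → sumZ (λ i → f (suc i) j))))

  swapᶻ : ∀ a b c → a +ᶻ (b +ᶻ c) ≡ b +ᶻ (a +ᶻ c)
  swapᶻ = solveᶻ-∀

  sumZ-remove : ∀ {m} k (f : Fin (suc m) → ℤ) → sumZ f ≡ f k +ᶻ sumZ (f ∘ Fin.punchIn k)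
  sumZ-remove zero f = refl
  sumZ-remove {suc m} (suc k) f =
    trans (cong (f zero +ᶻ_) (sumZ-remove k (f ∘ suc))) (swapᶻ (f zero) (f (suc k)) _)

sumZ-single : ∀ {m} k (f : Fin m → ℤ) → (∀ i → ¬ i ≡ k → f i ≡ 0ℤ) → sumZ f ≡ f k
sumZ-single {suc m} k f h = trans (sumZ-remove k f)
  (trans (cong (f k +ᶻ_) (trans (sumZ-cong (λ i → h _ (Fin.punchInᵢ≢i k i))) (sumZ-0 {m})))
         (ℤ.+-identityʳ (f k)))

argmin : ∀ {l} (ρ : Fin l → ℕ) {Q : Fin l → Set} → (∀ i → Dec (Q i)) → ∃ Q →
  ∃[ i ] Q i × (∀ i' → Q i' → ρ i ≤ ρ i')
argmin ρ {Q} Q? (i , q) = go (ρ i) i q ≤-refl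
  where
  go : ∀ b i → Q i → ρ i ≤ b → ∃[ i ] Q i × (∀ i' → Q i' → ρ i ≤ ρ i')
  go b i q le with any? (λ i' → Q? i' ×-dec (ρ i' <? ρ i))
  ... | no ¬e = i , q , λ i' q' → ≮⇒≥ (λ lt → ¬e (i' , q' , lt))
  go zero    i q le | yes (i' , q' , lt) = ⊥-elim (n≮0 (<-≤-trans lt le))
  go (suc b) i q le | yes (i' , q' , lt) = go b i' q' (s≤s⁻¹ (<-≤-trans lt le))

-- Kernel vectors modulo p

module Modulo (p : ℕ) (pp : Prime p) where

  instance
    p≢0 : NonZero p
    p≢0 = prime⇒nonZero pp

  1<p : 1 < p
  1<p = nonTrivial⇒n>1 p {{prime⇒nonTrivial pp}}

  P∣ : ℤ → Set
  P∣ z = (pos p) ∣ᶻ.∣ z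

  P∣? : ∀ z → Dec (P∣ z)
  P∣? z = (pos p) ∣ᶻ.∣? z

  P∣0 : P∣ 0ℤ
  P∣0 = ∣ᶻ.divides 0ℤ refl

  P∣-+ : ∀ {a b} → P∣ a → P∣ b → P∣ (a +ᶻ b)
  P∣-+ = ∣ᶻ.∣m∣n⇒∣m+n

  P∣-*ˡ : ∀ a {b} → P∣ b → P∣ (a *ᶻ b)
  P∣-*ˡ a = ∣ᶻ.∣n⇒∣m*n a

  P∣-*ʳ : ∀ {a} b → P∣ a → P∣ (a *ᶻ b)
  P∣-*ʳ b = ∣ᶻ.∣m⇒∣m*n b

  ¬P∣small : ∀ b → 1 ≤ b → b < p → ¬ P∣ (pos b)
  ¬P∣small b 1≤b b<p h = <⇒≱ b<p (∣ᴺ.∣⇒≤ {{>-nonZero 1≤b}} (∣ᶻ.∣⇒∣ᵤ h))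

  ¬P∣1 : ¬ P∣ 1ℤ
  ¬P∣1 = ¬P∣small 1 ≤-refl 1<p

  P∣-euclid : ∀ a b → ¬ P∣ a → ¬ P∣ b → ¬ P∣ (a *ᶻ b)
  P∣-euclid a b na nb h
    with euclidsLemma ∣ a ∣ ∣ b ∣ pp (subst (p ∣ᴺ.∣_) (ℤ.abs-* a b) (∣ᶻ.∣⇒∣ᵤ h))
  ... | inj₁ x = na (∣ᶻ.∣ᵤ⇒∣ x)
  ... | inj₂ y = nb (∣ᶻ.∣ᵤ⇒∣ y)

  opaque
   unfolding sumZ
   P∣-sumZ : ∀ {m} {f : Fin m → ℤ} → (∀ i → P∣ (f i)) → P∣ (sumZ f)
   P∣-sumZ {zero}  h = P∣0
   P∣-sumZ {suc m} h = P∣-+ (h zero) (P∣-sumZ (h ∘ suc))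

  Kills : ∀ {m} → (Fin m → ℤ) → (Fin m → ℤ) → Set
  Kills h r = P∣ (sumZ (λ i → r i *ᶻ h i))

  -- Gaussian elimination by cross-multiplication, so that no inverse modulo p is taken: `red`
  -- cancels column k against the pivot row r. A solution h' of the smaller system is scaled by the
  -- pivot `r k`, and the coordinate at k is then forced to be -s.
  solve-linear : ∀ c {m} (rows : List (Fin m → ℤ)) → List.length rows ≡ c → c < m →
    ∃[ h ] (∃[ i ] ¬ P∣ (h i)) × All (Kills h) rows
  solve-linear _ {suc m} [] len lt = (λ _ → 1ℤ) , (zero , ¬P∣1) , []
  solve-linear (suc c) {suc m} (r ∷ rows) len lt with any? (λ i → ¬? (P∣? (r i)))
  ... | no ¬e with solve-linear c rows (suc-injective len) (<-trans (n<1+n _) lt)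
  ...   | h , nz , kills =
      h , nz , P∣-sumZ (λ i → P∣-*ʳ (h i) (decidable-stable (P∣? (r i)) (λ n → ¬e (i , n)))) ∷ kills
  solve-linear (suc c) {suc m} (r ∷ rows) len lt | yes (k , rk≢0)
    with solve-linear c (List.map red rows) (trans (List.length-map red rows) (suc-injective len)) (s≤s⁻¹ lt)
    where
    red : (Fin (suc m) → ℤ) → Fin m → ℤ
    red b i = r k *ᶻ b (Fin.punchIn k i) -ᶻ b k *ᶻ r (Fin.punchIn k i)
  ... | h' , (i₀ , nz) , kills =
      h , (Fin.punchIn k i₀ , subst (¬_ ∘ P∣) (sym (h-in i₀)) (P∣-euclid _ _ rk≢0 nz)) ,
      kill-r ∷ All.map (λ {b} → kill b) (All.map⁻ kills)
    where
    red : (Fin (suc m) → ℤ) → Fin m → ℤ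
    red b i = r k *ᶻ b (Fin.punchIn k i) -ᶻ b k *ᶻ r (Fin.punchIn k i)
    s : ℤ
    s = sumZ (λ i → r (Fin.punchIn k i) *ᶻ h' i)
    h : Fin (suc m) → ℤ
    h = insertAt (λ i → r k *ᶻ h' i) k (-ᶻ s)
    h-k : h k ≡ -ᶻ s
    h-k = insertAt-lookup _ k (-ᶻ s)
    h-in : ∀ i → h (Fin.punchIn k i) ≡ r k *ᶻ h' i
    h-in i = insertAt-punchIn (λ i → r k *ᶻ h' i) k (-ᶻ s) i
    expand : ∀ b → sumZ (λ i → b i *ᶻ h i) ≡ sumZ (λ i → red b i *ᶻ h' i)
    expand b = begin
      sumZ (λ i → b i *ᶻ h i)
        ≡⟨ sumZ-remove k (λ i → b i *ᶻ h i) ⟩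
      b k *ᶻ h k +ᶻ sumZ (λ i → b (π i) *ᶻ h (π i))
        ≡⟨ cong₂ _+ᶻ_ (cong (b k *ᶻ_) h-k) (sumZ-cong (λ i → cong (b (π i) *ᶻ_) (h-in i))) ⟩
      b k *ᶻ (-ᶻ s) +ᶻ sumZ (λ i → b (π i) *ᶻ (r k *ᶻ h' i))
        ≡⟨ cong (_+ᶻ sumZ (λ i → b (π i) *ᶻ (r k *ᶻ h' i))) (e₁ (b k) s) ⟩
      (-ᶻ b k) *ᶻ s +ᶻ sumZ (λ i → b (π i) *ᶻ (r k *ᶻ h' i))
        ≡⟨ cong (_+ᶻ sumZ (λ i → b (π i) *ᶻ (r k *ᶻ h' i))) (sym (sumZ-*ˡ (-ᶻ b k) (λ i → r (π i) *ᶻ h' i))) ⟩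
      sumZ (λ i → (-ᶻ b k) *ᶻ (r (π i) *ᶻ h' i)) +ᶻ sumZ (λ i → b (π i) *ᶻ (r k *ᶻ h' i))
        ≡⟨ sym (sumZ-+ (λ i → (-ᶻ b k) *ᶻ (r (π i) *ᶻ h' i)) (λ i → b (π i) *ᶻ (r k *ᶻ h' i))) ⟩
      sumZ (λ i → (-ᶻ b k) *ᶻ (r (π i) *ᶻ h' i) +ᶻ b (π i) *ᶻ (r k *ᶻ h' i))
        ≡⟨ sumZ-cong (λ i → e₂ (b k) (r (π i)) (h' i) (b (π i)) (r k)) ⟩
      sumZ (λ i → red b i *ᶻ h' i) ∎
      where
      open ≡-Reasoning
      π = Fin.punchIn k
      e₁ : ∀ a s → a *ᶻ (-ᶻ s) ≡ (-ᶻ a) *ᶻ s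
      e₁ = solveᶻ-∀
      e₂ : ∀ bk rp h bp rk → (-ᶻ bk) *ᶻ (rp *ᶻ h) +ᶻ bp *ᶻ (rk *ᶻ h) ≡ (rk *ᶻ bp -ᶻ bk *ᶻ rp) *ᶻ h
      e₂ = solveᶻ-∀
    kill : ∀ b → Kills h' (red b) → Kills h b
    kill b x = subst P∣ (sym (expand b)) x
    kill-r : Kills h r
    kill-r = kill r (P∣-sumZ (λ i → subst P∣ (sym (e (r k) (r (Fin.punchIn k i)) (h' i))) P∣0))
      where
      e : ∀ a b c → (a *ᶻ b -ᶻ a *ᶻ b) *ᶻ c ≡ 0ℤ
      e = solveᶻ-∀

  -- Two such vectors for opposite orders ρ have a pointwise product supported, mod p, at i alone.
  Good : ∀ {l} → List (Fin l → ℤ) → (Fin l → ℕ) → Fin l → Set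
  Good rows ρ i = ∃[ h ] All (Kills h) rows × (¬ P∣ (h i)) × (∀ i' → ¬ P∣ (h i') → ρ i ≤ ρ i')

  -- One more position than there are rows carries a kernel vector that is nonzero modulo p.
  -- Extended by zero it still kills every row, and the least position of its support is good. So at
  -- most as many positions as there are rows fail to be good.
  good-exists : ∀ {l} (rows : List (Fin l → ℤ)) (ρ : Fin l → ℕ)
    (β : Fin (suc (List.length rows)) → Fin l) → (∀ s t → β s ≡ β t → s ≡ t) →
    ∃[ t ] Good rows ρ (β t)
  good-exists {l} rows ρ β inj
    with solve-linear (List.length rows) (List.map (_∘ β) rows) (List.length-map (_∘ β) rows) ≤-refl
  ... | h' , (t₀ , nz) , kills = result
    where
    h : Fin l → ℤ
    h i = sumZ (λ t → (pos (χ (i ≟ β t))) *ᶻ h' t)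
    h-β : ∀ t → h (β t) ≡ h' t
    h-β t = trans (sumZ-single t _ off) on
      where
      off : ∀ s → ¬ s ≡ t → (pos (χ (β t ≟ β s))) *ᶻ h' s ≡ 0ℤ
      off s ne with β t Fin.≟ β s
      ... | yes e = ⊥-elim (ne (sym (inj t s e)))
      ... | no _  = refl
      on : (pos (χ (β t ≟ β t))) *ᶻ h' t ≡ h' t
      on with β t Fin.≟ β t
      ... | yes _ = ℤ.*-identityˡ _
      ... | no n  = ⊥-elim (n refl)
    ∃t : ∀ i → ¬ P∣ (h i) → ∃[ t ] i ≡ β t
    ∃t i n with any? (λ t → i Fin.≟ β t)
    ... | yes e = e
    ... | no ¬e = ⊥-elim (n (P∣-sumZ zr))
      where
      zr : ∀ t → P∣ ((pos (χ (i ≟ β t))) *ᶻ h' t)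
      zr t with i Fin.≟ β t
      ... | yes e = ⊥-elim (¬e (t , e))
      ... | no _  = P∣0
    kill : ∀ r → Kills h' (r ∘ β) → Kills h r
    kill r x = subst P∣ (sym eq) x
      where
      open ≡-Reasoning
      eq : sumZ (λ i → r i *ᶻ h i) ≡ sumZ (λ t → r (β t) *ᶻ h' t)
      eq = begin
        sumZ (λ i → r i *ᶻ h i)
          ≡⟨ sumZ-cong (λ i → sym (sumZ-*ˡ (r i) (λ t → (pos (χ (i ≟ β t))) *ᶻ h' t))) ⟩
        sumZ (λ i → sumZ (λ t → r i *ᶻ ((pos (χ (i ≟ β t))) *ᶻ h' t)))
          ≡⟨ sumZ-swap (λ i t → r i *ᶻ ((pos (χ (i ≟ β t))) *ᶻ h' t)) ⟩
        sumZ (λ t → sumZ (λ i → r i *ᶻ ((pos (χ (i ≟ β t))) *ᶻ h' t)))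
          ≡⟨ sumZ-cong (λ t → trans (sumZ-single (β t) _ (off t)) (on t)) ⟩
        sumZ (λ t → r (β t) *ᶻ h' t) ∎
        where
        off : ∀ t i → ¬ i ≡ β t → r i *ᶻ ((pos (χ (i ≟ β t))) *ᶻ h' t) ≡ 0ℤ
        off t i ne with i Fin.≟ β t
        ... | yes e = ⊥-elim (ne e)
        ... | no _  = ℤ.*-zeroʳ (r i)
        on : ∀ t → r (β t) *ᶻ ((pos (χ (β t ≟ β t))) *ᶻ h' t) ≡ r (β t) *ᶻ h' t
        on t with β t Fin.≟ β t
        ... | yes _ = cong (r (β t) *ᶻ_) (ℤ.*-identityˡ _)
        ... | no n  = ⊥-elim (n refl)
    result : ∃[ t ] Good rows ρ (β t)
    result with argmin ρ (λ i → ¬? (P∣? (h i))) (β t₀ , subst (¬_ ∘ P∣) (sym (h-β t₀)) nz)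
    ... | i , n , least with ∃t i n
    ...   | t , refl = t , h , All.map (λ {r} → kill r) (All.map⁻ kills) , n , least

-- Monomials and weighted sums over all choices of indices

monos : ∀ n → ℕ → List (Vec ℕ n)
bump : ∀ {n} → Vec ℕ (suc n) → Vec ℕ (suc n)
bump (a ∷ e) = suc a ∷ e
monos zero    d       = [] ∷ []
monos (suc n) zero    = List.map (0 ∷_) (monos n zero)
monos (suc n) (suc d) = List.map (0 ∷_) (monos n (suc d)) ++ List.map bump (monos (suc n) d)

-- The recursion of `monos` is Pascal's: either the first exponent is 0, or lowering it by one
-- lowers the degree bound. So the count is a binomial coefficient, and two equal powers of 2 add up
-- to the next one.
monos-length : ∀ n d → List.length (monos n d) ≤ 2 ^ (n + d)
monos-length zero    d = m^n>0 2 d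
monos-length (suc n) zero = begin
  List.length (List.map (0 ∷_) (monos n zero)) ≡⟨ List.length-map (0 ∷_) (monos n zero) ⟩
  List.length (monos n zero)                   ≤⟨ monos-length n zero ⟩
  2 ^ (n + 0)                                  ≤⟨ ^-monoʳ-≤ 2 (n≤1+n (n + 0)) ⟩
  2 ^ (suc n + 0)                              ∎
  where open ≤-Reasoning
monos-length (suc n) (suc d) = begin
  List.length (monos (suc n) (suc d))
    ≡⟨ List.length-++ (List.map (0 ∷_) (monos n (suc d))) ⟩
  List.length (List.map (0 ∷_) (monos n (suc d))) + List.length (List.map bump (monos (suc n) d))
    ≡⟨ cong₂ _+_ (List.length-map (0 ∷_) (monos n (suc d))) (List.length-map bump (monos (suc n) d)) ⟩
  List.length (monos n (suc d)) + List.length (monos (suc n) d)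
    ≤⟨ +-mono-≤ (monos-length n (suc d)) (monos-length (suc n) d) ⟩
  2 ^ (n + suc d) + 2 ^ (suc n + d)
    ≡⟨ cong (λ k → 2 ^ (n + suc d) + 2 ^ k) (sym (+-suc n d)) ⟩
  2 ^ (n + suc d) + 2 ^ (n + suc d)
    ≡⟨ cong (2 ^ (n + suc d) +_) (sym (+-identityʳ _)) ⟩
  2 ^ (suc n + suc d) ∎
  where open ≤-Reasoning

monos-complete : ∀ {n} d (e : Vec ℕ n) → Vec.sum e ≤ d → e ∈ᴸ monos n d
monos-complete {zero}  d [] le = here refl
monos-complete {suc n} zero    (zero ∷ e)  le = ∈ᴸ.∈-map⁺ (0 ∷_) (monos-complete zero e le)
monos-complete {suc n} (suc d) (zero ∷ e)  le = ∈ᴸ.∈-++⁺ˡ (∈ᴸ.∈-map⁺ (0 ∷_) (monos-complete (suc d) e le))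
monos-complete {suc n} (suc d) (suc a ∷ e) le =
  ∈ᴸ.∈-++⁺ʳ (List.map (0 ∷_) (monos n (suc d)))
    (∈ᴸ.∈-map⁺ bump (monos-complete d (a ∷ e) (s≤s⁻¹ le)))

γ : ∀ {n} → Vec ℤ n → Vec ℕ n → ℤ
γ []       []      = 1ℤ
γ (x ∷ xs) (a ∷ e) = (x ^ᶻ a) *ᶻ γ xs e

γ-suc : ∀ {n} (xs : Vec ℤ n) e c → γ xs (Vec.updateAt e c suc) ≡ Vec.lookup xs c *ᶻ γ xs e
γ-suc (x ∷ xs) (a ∷ e) zero    = ℤ.*-assoc x (x ^ᶻ a) (γ xs e)
γ-suc (x ∷ xs) (a ∷ e) (suc c) =
  trans (cong ((x ^ᶻ a) *ᶻ_) (γ-suc xs e c)) (ring (x ^ᶻ a) (Vec.lookup xs c) (γ xs e))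
  where
  ring : ∀ a b c → a *ᶻ (b *ᶻ c) ≡ b *ᶻ (a *ᶻ c)
  ring = solveᶻ-∀

sum-suc : ∀ {n} (e : Vec ℕ n) c → Vec.sum (Vec.updateAt e c suc) ≡ suc (Vec.sum e)
sum-suc (a ∷ e) zero    = refl
sum-suc (a ∷ e) (suc c) = trans (cong (a +_) (sum-suc e c)) (+-suc a _)

SZ : ∀ {l P} → (Vec (Fin l) P → ℤ) → ℤ
SZ {P = zero}  F = F []
SZ {P = suc P} F = sumZ (λ i → SZ (λ a → F (i ∷ a)))

SZ-cong : ∀ {l P} {F G : Vec (Fin l) P → ℤ} → (∀ a → F a ≡ G a) → SZ F ≡ SZ G
SZ-cong {P = zero}  e = e []
SZ-cong {P = suc P} e = sumZ-cong (λ i → SZ-cong (λ a → e (i ∷ a)))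

SZ-+ : ∀ {l P} (F G : Vec (Fin l) P → ℤ) → SZ (λ a → F a +ᶻ G a) ≡ SZ F +ᶻ SZ G
SZ-+ {P = zero}  F G = refl
SZ-+ {P = suc P} F G = trans (sumZ-cong (λ i → SZ-+ (F ∘ (i ∷_)) (G ∘ (i ∷_)))) (sumZ-+ _ _)

SZ-*ˡ : ∀ {l P} c (F : Vec (Fin l) P → ℤ) → SZ (λ a → c *ᶻ F a) ≡ c *ᶻ SZ F
SZ-*ˡ {P = zero}  c F = refl
SZ-*ˡ {P = suc P} c F = trans (sumZ-cong (λ i → SZ-*ˡ c (F ∘ (i ∷_)))) (sumZ-*ˡ c (λ i → SZ (F ∘ (i ∷_))))

SZ-0 : ∀ {l P} → SZ {l} {P} (λ _ → 0ℤ) ≡ 0ℤ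
SZ-0 {P = zero}      = refl
SZ-0 {l} {P = suc P} = trans (sumZ-cong {l} (λ i → SZ-0 {l} {P})) (sumZ-0 {l})

SZ-sum : ∀ {l P m} (G : Fin m → Vec (Fin l) P → ℤ) → SZ (λ a → sumZ (λ j → G j a)) ≡ sumZ (λ j → SZ (G j))
SZ-sum {l} {P} {zero} G = trans (SZ-cong {P = P} (λ a → sumZ-zero)) (trans (SZ-0 {l} {P}) (sym sumZ-zero))
SZ-sum {P = P} {m = suc m} G = trans (SZ-cong {P = P} (λ a → sumZ-suc (λ j → G j a)))
  (trans (SZ-+ (G zero) _) (trans (cong (SZ (G zero) +ᶻ_) (SZ-sum (G ∘ suc)))
    (sym (sumZ-suc (λ j → SZ (G j))))))

-- The rank-one tensor with one factor `H j` for each colour j.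
weight : ∀ {l P} → (Fin P → Fin l → ℤ) → Vec (Fin l) P → ℤ
weight H []      = 1ℤ
weight H (i ∷ a) = H zero i *ᶻ weight (H ∘ suc) a

mon : ∀ {l P n} → (Fin P → Fin l → Vec ℤ n) → Vec (Vec ℕ n) P → Vec (Fin l) P → ℤ
mon X []      []      = 1ℤ
mon X (e ∷ E) (i ∷ a) = γ (X zero i) e *ᶻ mon (X ∘ suc) E a

tdeg : ∀ {P n} → Vec (Vec ℕ n) P → ℕ
tdeg []      = 0
tdeg (e ∷ E) = Vec.sum e + tdeg E

inc : ∀ {P n} → Vec (Vec ℕ n) P → Fin P → Fin n → Vec (Vec ℕ n) P
inc E j c = Vec.updateAt E j (λ e → Vec.updateAt e c suc)

tdeg-inc : ∀ {P n} (E : Vec (Vec ℕ n) P) j c → tdeg (inc E j c) ≡ suc (tdeg E)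
tdeg-inc (e ∷ E) zero    c = cong (_+ tdeg E) (sum-suc e c)
tdeg-inc (e ∷ E) (suc j) c = trans (cong (Vec.sum e +_) (tdeg-inc E j c)) (+-suc (Vec.sum e) _)

mon-inc : ∀ {l P n} (X : Fin P → Fin l → Vec ℤ n) E a j c →
  mon X (inc E j c) a ≡ Vec.lookup (X j (Vec.lookup a j)) c *ᶻ mon X E a
mon-inc X (e ∷ E) (i ∷ a) zero    c =
  trans (cong (_*ᶻ mon (X ∘ suc) E a) (γ-suc (X zero i) e c)) (ℤ.*-assoc (Vec.lookup (X zero i) c) (γ (X zero i) e) (mon (X ∘ suc) E a))
mon-inc X (e ∷ E) (i ∷ a) (suc j) c =
  trans (cong (γ (X zero i) e *ᶻ_) (mon-inc (X ∘ suc) E a j c))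
    (ring (γ (X zero i) e) (Vec.lookup (X (suc j) (Vec.lookup a j)) c) (mon (X ∘ suc) E a))
  where
  ring : ∀ a b c → a *ᶻ (b *ᶻ c) ≡ b *ᶻ (a *ᶻ c)
  ring = solveᶻ-∀

mon-0 : ∀ {l P n} (X : Fin P → Fin l → Vec ℤ n) a → mon X (Vec.replicate P (Vec.replicate n 0)) a ≡ 1ℤ
mon-0 {P = zero}  X []      = refl
mon-0 {P = suc P} {n} X (i ∷ a) = trans (cong₂ _*ᶻ_ (γ-0 (X zero i)) (mon-0 (X ∘ suc) a)) refl
  where
  γ-0 : ∀ {n} (xs : Vec ℤ n) → γ xs (Vec.replicate n 0) ≡ 1ℤ
  γ-0 []       = refl
  γ-0 (x ∷ xs) = trans (ℤ.*-identityˡ _) (γ-0 xs)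

tdeg-0 : ∀ P n → tdeg (Vec.replicate P (Vec.replicate n 0)) ≡ 0
tdeg-0 zero    n = refl
tdeg-0 (suc P) n = cong₂ _+_ (sum-0 n) (tdeg-0 P n)
  where
  sum-0 : ∀ n → Vec.sum (Vec.replicate n 0) ≡ 0
  sum-0 zero    = refl
  sum-0 (suc n) = sum-0 n

tdeg-≥ : ∀ {P n} (S : Fin P → Bool) (E : Vec (Vec ℕ n) P) K →
  (∀ j → j ∈ S → K ≤ Vec.sum (Vec.lookup E j)) → # S * K ≤ tdeg E
tdeg-≥ {zero}  S []      K h = ≤-trans (*-monoˡ-≤ K (≤-trans (#-≤size S) (≤-reflexive (size-Fin 0)))) z≤n
tdeg-≥ {suc P} S (e ∷ E) K h = begin
  # S * K                              ≡⟨ cong (_* K) (#-suc S) ⟩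
  (𝟙 (S zero) + # (S ∘ suc)) * K       ≡⟨ *-distribʳ-+ K (𝟙 (S zero)) _ ⟩
  𝟙 (S zero) * K + # (S ∘ suc) * K     ≤⟨ +-mono-≤ (first (S zero) (h zero)) (tdeg-≥ (S ∘ suc) E K (h ∘ suc)) ⟩
  Vec.sum e + tdeg E                   ∎
  where
  open ≤-Reasoning
  first : ∀ b → (T b → K ≤ Vec.sum e) → 𝟙 b * K ≤ Vec.sum e
  first true  f = ≤-trans (≤-reflexive (*-identityˡ K)) (f tt)
  first false f = z≤n

-- The summand is a product over the colours, so the sum over all tuples factors. A single colour
-- whose vector kills its own monomial therefore makes the whole sum vanish modulo p.
SZ-weight-mon : ∀ {l P n} (H : Fin (suc P) → Fin l → ℤ) (X : Fin (suc P) → Fin l → Vec ℤ n) e E →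
  SZ (λ a → weight H a *ᶻ mon X (e ∷ E) a) ≡
  sumZ (λ i → H zero i *ᶻ γ (X zero i) e) *ᶻ SZ (λ a → weight (H ∘ suc) a *ᶻ mon (X ∘ suc) E a)
SZ-weight-mon {l} {P} H X e E = begin
  sumZ (λ i → SZ (λ a → (H zero i *ᶻ weight H' a) *ᶻ (γ (X zero i) e *ᶻ mon X' E a)))
    ≡⟨ sumZ-cong (λ i → trans (SZ-cong (λ a → ring (H zero i) (weight H' a) (γ (X zero i) e) (mon X' E a)))
                              (SZ-*ˡ (H zero i *ᶻ γ (X zero i) e) G)) ⟩
  sumZ (λ i → (H zero i *ᶻ γ (X zero i) e) *ᶻ SZ G)
    ≡⟨ sumZ-cong (λ i → ℤ.*-comm (H zero i *ᶻ γ (X zero i) e) (SZ G)) ⟩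
  sumZ (λ i → SZ G *ᶻ (H zero i *ᶻ γ (X zero i) e))
    ≡⟨ sumZ-*ˡ (SZ G) (λ i → H zero i *ᶻ γ (X zero i) e) ⟩
  SZ G *ᶻ sumZ (λ i → H zero i *ᶻ γ (X zero i) e)
    ≡⟨ ℤ.*-comm (SZ G) _ ⟩
  sumZ (λ i → H zero i *ᶻ γ (X zero i) e) *ᶻ SZ G ∎
  where
  open ≡-Reasoning
  H' = H ∘ suc
  X' = X ∘ suc
  G : Vec (Fin l) P → ℤ
  G a = weight H' a *ᶻ mon X' E a
  ring : ∀ a b c d → (a *ᶻ b) *ᶻ (c *ᶻ d) ≡ (a *ᶻ c) *ᶻ (b *ᶻ d)
  ring = solveᶻ-∀

-- The vanishing argument for solutions of linear equations

module ModuloSlice (p : ℕ) (pp : Prime p) where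
  open Modulo p pp public

  SZ-low : ∀ {l P n} (H : Fin P → Fin l → ℤ) (X : Fin P → Fin l → Vec ℤ n) E j →
    P∣ (sumZ (λ i → H j i *ᶻ γ (X j i) (Vec.lookup E j))) → P∣ (SZ (λ a → weight H a *ᶻ mon X E a))
  SZ-low H X (e ∷ E) zero    h = subst P∣ (sym (SZ-weight-mon H X e E))
    (P∣-*ʳ (SZ (λ a → weight (H ∘ suc) a *ᶻ mon (X ∘ suc) E a)) h)
  SZ-low H X (e ∷ E) (suc j) h = subst P∣ (sym (SZ-weight-mon H X e E))
    (P∣-*ˡ (sumZ (λ i → H zero i *ᶻ γ (X zero i) e)) (SZ-low (H ∘ suc) (X ∘ suc) E j h))

  SZ-single : ∀ {l P} (a : Vec (Fin l) P) (F : Vec (Fin l) P → ℤ) →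
    (∀ b → ¬ b ≡ a → P∣ (F b)) → P∣ (SZ F) → P∣ (F a)
  SZ-single []      F h d = d
  SZ-single {suc l} (i ∷ a) F h d = SZ-single a (λ b → F (i ∷ b))
    (λ b ne → h (i ∷ b) (λ e → ne (Vec.∷-injectiveʳ e)))
    (∣ᶻ.∣m+n∣n⇒∣m (subst P∣ (sumZ-remove i (λ i → SZ (λ b → F (i ∷ b)))) d)
       (P∣-sumZ (λ i' → div (λ b → F (Fin.punchIn i i' ∷ b))
         (λ b → h _ (λ e → Fin.punchInᵢ≢i i i' (Vec.∷-injectiveˡ e))))))
    where
    div : ∀ {l P} (G : Vec (Fin l) P → ℤ) → (∀ b → P∣ (G b)) → P∣ (SZ G)
    div {P = zero}  G g = g []
    div {P = suc P} G g = P∣-sumZ (λ i → div (λ b → G (i ∷ b)) (λ b → g (i ∷ b)))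

  weight-div : ∀ {l P} (H : Fin P → Fin l → ℤ) a j → P∣ (H j (Vec.lookup a j)) → P∣ (weight H a)
  weight-div H (i ∷ a) zero    h = P∣-*ʳ (weight (H ∘ suc) a) h
  weight-div H (i ∷ a) (suc j) h = P∣-*ˡ (H zero i) (weight-div (H ∘ suc) a j h)

  weight-ndiv : ∀ {l P} (H : Fin P → Fin l → ℤ) a → (∀ j → ¬ P∣ (H j (Vec.lookup a j))) → ¬ P∣ (weight H a)
  weight-ndiv H []      h = ¬P∣1
  weight-ndiv H (i ∷ a) h = P∣-euclid (H zero i) (weight (H ∘ suc) a) (h zero) (weight-ndiv (H ∘ suc) a (h ∘ suc))

  module Slice {P l n : ℕ} (X : Fin P → Fin l → Vec ℤ n) (v : Fin n → ℤ) (S : Fin P → Bool) (k : ℕ)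
               (Sk : p ≤ # S * k) (z₀ : Fin l) where

    Lin : Vec (Fin l) P → Fin n → ℤ
    Lin a c = sumZ (λ j → Vec.lookup (X j (Vec.lookup a j)) c)

    Sol : Vec (Fin l) P → Set
    Sol a = ∀ c → P∣ (Lin a c -ᶻ v c)

    -- The degree of the polynomial `prodT pairs`, which has one linear factor for each coordinate
    -- and each nonzero residue.
    D : ℕ
    D = n * pred p

    Γ : List (Vec ℕ n)
    Γ = monos n (k * n)

    rows : Fin P → List (Fin l → ℤ)
    rows j = List.map (λ e i → γ (X j i) e) Γ

    -- If all colours of S had degree above kn, the total degree would be at least
    -- `# S * suc (k * n)`, which exceeds np. A share 1/k of the p colours thus brings the degree
    -- down from n(p - 1) to kn in one colour.
    low : (E : Vec (Vec ℕ n) P) → tdeg E ≤ D → ∃[ j ] j ∈ S × Vec.sum (Vec.lookup E j) ≤ k * n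
    low E le with any? (λ j → T? (S j) ×-dec (Vec.sum (Vec.lookup E j) ≤? k * n))
    ... | yes r = r
    ... | no ¬r = ⊥-elim (<⇒≱ lt (≤-trans (tdeg-≥ S E (suc (k * n)) (λ j js → ≰⇒> (λ x → ¬r (j , js , x)))) le))
      where
      open ≤-Reasoning
      1≤S : 1 ≤ # S
      1≤S = n≢0⇒n>0 (λ e → <⇒≱ (<-trans (s≤s z≤n) 1<p) (subst (λ s → p ≤ s * k) e Sk))
      lt : D < # S * suc (k * n)
      lt = begin-strict
        n * pred p              ≤⟨ *-monoʳ-≤ n (pred[n]≤n {p}) ⟩
        n * p                   ≤⟨ *-monoʳ-≤ n Sk ⟩
        n * (# S * k)           ≡⟨ e n (# S) k ⟩
        # S * (k * n)           <⟨ m<n+m (# S * (k * n)) 1≤S ⟩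
        # S + # S * (k * n)     ≡⟨ sym (*-suc (# S) (k * n)) ⟩
        # S * suc (k * n)       ∎
        where
        e : ∀ n s k → n * (s * k) ≡ s * (k * n)
        e = solve-∀

    module _ (H : Fin P → Fin l → ℤ) (kill : ∀ j → j ∈ S → All (Kills (H j)) (rows j)) where

      Λ : (Vec (Fin l) P → ℤ) → ℤ
      Λ f = SZ (λ a → weight H a *ᶻ f a)

      -- f behaves like a polynomial of degree d towards the functional Λ, which annihilates its
      -- products with all monomials of complementary degree. A linear factor only raises d by one,
      -- so the product of D factors never has to be expanded.
      Small : ℕ → (Vec (Fin l) P → ℤ) → Set
      Small d f = (E : Vec (Vec ℕ n) P) → tdeg E + d ≤ D → P∣ (Λ (λ a → mon X E a *ᶻ f a))

      small-1 : Small 0 (λ _ → 1ℤ)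
      small-1 E le with low E (subst (_≤ D) (+-identityʳ _) le)
      ... | j , js , ej = subst P∣ (SZ-cong (λ a → cong (weight H a *ᶻ_) (sym (ℤ.*-identityʳ (mon X E a)))))
                            (SZ-low H X E j killed)
        where
        killed : P∣ (sumZ (λ i → H j i *ᶻ γ (X j i) (Vec.lookup E j)))
        killed = subst P∣ (sumZ-cong (λ i → ℤ.*-comm (γ (X j i) (Vec.lookup E j)) (H j i)))
          (All.lookup (kill j js) (∈ᴸ.∈-map⁺ (λ e i → γ (X j i) e) (monos-complete (k * n) (Vec.lookup E j) ej)))

      small-step : ∀ {d f} c w → Small d f → Small (suc d) (λ a → (Lin a c -ᶻ w) *ᶻ f a)
      small-step {d} {f} c w sm E le = subst P∣ (sym eq)
        (P∣-+ (P∣-sumZ (λ j → sm (inc E j c) (le₁ j))) (P∣-*ˡ (-ᶻ w) (sm E le₂)))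
        where
        open ≡-Reasoning
        le₁ : ∀ j → tdeg (inc E j c) + d ≤ D
        le₁ j = subst (_≤ D) (trans (+-suc (tdeg E) d) (cong (_+ d) (sym (tdeg-inc E j c)))) le
        le₂ : tdeg E + d ≤ D
        le₂ = ≤-trans (+-monoʳ-≤ (tdeg E) (n≤1+n d)) le
        x : Vec (Fin l) P → Fin P → ℤ
        x a j = Vec.lookup (X j (Vec.lookup a j)) c
        term : Vec (Fin l) P → Fin P → ℤ
        term a j = weight H a *ᶻ (mon X (inc E j c) a *ᶻ f a)
        r₁ : ∀ W M L w F → W *ᶻ (M *ᶻ ((L -ᶻ w) *ᶻ F)) ≡ (W *ᶻ (M *ᶻ F)) *ᶻ L +ᶻ (-ᶻ w) *ᶻ (W *ᶻ (M *ᶻ F))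
        r₁ = solveᶻ-∀
        r₂ : ∀ W M F y → (W *ᶻ (M *ᶻ F)) *ᶻ y ≡ W *ᶻ ((y *ᶻ M) *ᶻ F)
        r₂ = solveᶻ-∀
        pt : ∀ a → weight H a *ᶻ (mon X E a *ᶻ ((Lin a c -ᶻ w) *ᶻ f a)) ≡
                   sumZ (term a) +ᶻ (-ᶻ w) *ᶻ (weight H a *ᶻ (mon X E a *ᶻ f a))
        pt a = trans (r₁ (weight H a) (mon X E a) (Lin a c) w (f a))
          (cong (_+ᶻ (-ᶻ w) *ᶻ (weight H a *ᶻ (mon X E a *ᶻ f a)))
            (trans (sym (sumZ-*ˡ (weight H a *ᶻ (mon X E a *ᶻ f a)) (x a)))
              (sumZ-cong (λ j → trans (r₂ (weight H a) (mon X E a) (f a) (x a j))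
                (cong (λ y → weight H a *ᶻ (y *ᶻ f a)) (sym (mon-inc X E a j c)))))))
        eq : Λ (λ a → mon X E a *ᶻ ((Lin a c -ᶻ w) *ᶻ f a)) ≡
             sumZ (λ j → Λ (λ a → mon X (inc E j c) a *ᶻ f a)) +ᶻ (-ᶻ w) *ᶻ Λ (λ a → mon X E a *ᶻ f a)
        eq = trans (SZ-cong pt) (trans (SZ-+ (λ a → sumZ (term a)) (λ a → (-ᶻ w) *ᶻ (weight H a *ᶻ (mon X E a *ᶻ f a))))
               (cong₂ _+ᶻ_ (SZ-sum (λ j a → term a j)) (SZ-*ˡ (-ᶻ w) (λ a → weight H a *ᶻ (mon X E a *ᶻ f a)))))

      prodT : List (Fin n × ℤ) → Vec (Fin l) P → ℤ
      prodT []             a = 1ℤ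
      prodT ((c , w) ∷ ps) a = (Lin a c -ᶻ w) *ᶻ prodT ps a

      small-prodT : ∀ ps → Small (List.length ps) (prodT ps)
      small-prodT []             = small-1
      small-prodT ((c , w) ∷ ps) = small-step c w (small-prodT ps)

      prodT-div : ∀ ps a {c w} → (c , w) ∈ᴸ ps → P∣ (Lin a c -ᶻ w) → P∣ (prodT ps a)
      prodT-div (_ ∷ ps) a (here refl) h = P∣-*ʳ (prodT ps a) h
      prodT-div ((c , w) ∷ ps) a (there m) h = P∣-*ˡ (Lin a c -ᶻ w) (prodT-div ps a m h)

      prodT-ndiv : ∀ ps a → (∀ {c w} → (c , w) ∈ᴸ ps → ¬ P∣ (Lin a c -ᶻ w)) → ¬ P∣ (prodT ps a)
      prodT-ndiv []             a h = ¬P∣1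
      prodT-ndiv ((c , w) ∷ ps) a h = P∣-euclid (Lin a c -ᶻ w) (prodT ps a) (h (here refl)) (prodT-ndiv ps a (h ∘ there))

      -- The product of all L_c − v_c − b with 1 ≤ b < p vanishes mod p exactly off the solutions
      -- (this replaces 1 − (L_c − v_c)^(p−1), so Fermat's little theorem is not needed).
      residues : List ℕ
      residues = List.applyUpTo suc (pred p)

      pairs : List (Fin n × ℤ)
      pairs = List.cartesianProductWith (λ c b → c , v c +ᶻ pos b) (List.allFin n) residues

      length-pairs : List.length pairs ≡ D
      length-pairs = trans (length-cp (List.allFin n)) (cong (_* pred p) (List.length-tabulate {n = n} id))
        where
        length-cp : ∀ cs → List.length (List.cartesianProductWith (λ c b → c , v c +ᶻ pos b) cs residues) ≡
                           List.length cs * pred p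
        length-cp []       = refl
        length-cp (c ∷ cs) = trans (List.length-++ (List.map (λ b → c , v c +ᶻ pos b) residues))
          (cong₂ _+_ (trans (List.length-map _ residues) (List.length-applyUpTo suc (pred p))) (length-cp cs))

      Λ-prodT : P∣ (Λ (prodT pairs))
      Λ-prodT = subst P∣ (SZ-cong eq)
        (small-prodT pairs E₀ (≤-reflexive (trans (cong (_+ List.length pairs) (tdeg-0 P n)) length-pairs)))
        where
        E₀ = Vec.replicate P (Vec.replicate n 0)
        eq : ∀ a → weight H a *ᶻ (mon X E₀ a *ᶻ prodT pairs a) ≡ weight H a *ᶻ prodT pairs a
        eq a = cong (weight H a *ᶻ_) (trans (cong (_*ᶻ prodT pairs a) (mon-0 X a)) (ℤ.*-identityˡ (prodT pairs a)))

      prodT-sol : ∀ a → Sol a → ¬ P∣ (prodT pairs a)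
      prodT-sol a sol = prodT-ndiv pairs a nd
        where
        r : ∀ L v b → (L -ᶻ v) -ᶻ (L -ᶻ (v +ᶻ b)) ≡ b
        r = solveᶻ-∀
        nd : ∀ {c w} → (c , w) ∈ᴸ pairs → ¬ P∣ (Lin a c -ᶻ w)
        nd m d with ∈ᴸ.∈-cartesianProductWith⁻ (λ c b → c , v c +ᶻ pos b) (List.allFin n) residues m
        ... | c , b , _ , mb , refl with ∈ᴸ.∈-applyUpTo⁻ suc mb
        ...   | b' , lt , refl = ¬P∣small (suc b') (s≤s z≤n) (subst (suc (suc b') ≤_) (suc-pred p) (s≤s lt))
                 (subst P∣ (r (Lin a c) (v c) (pos (suc b'))) (∣ᶻ.∣m∣n⇒∣m-n (sol c) d))

      prodT-nonsol : ∀ a c → ¬ P∣ (Lin a c -ᶻ v c) → P∣ (prodT pairs a)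
      prodT-nonsol a c nd = prodT-div pairs a mem div
        where
        z = Lin a c -ᶻ v c
        b = z ℤ.%ℕ p
        zb : z ≡ pos b +ᶻ (z ℤ./ℕ p) *ᶻ pos p
        zb = ℤ.a≡a%ℕn+[a/ℕn]*n z p
        b≢0 : b ≢ 0
        b≢0 e = nd (∣ᶻ.divides (z ℤ./ℕ p) (trans zb (trans (cong (λ b → pos b +ᶻ (z ℤ./ℕ p) *ᶻ pos p) e) (ℤ.+-identityˡ ((z ℤ./ℕ p) *ᶻ pos p)))))
        mem : (c , v c +ᶻ pos b) ∈ᴸ pairs
        mem = ∈ᴸ.∈-cartesianProductWith⁺ (λ c b → c , v c +ᶻ pos b) (∈ᴸ.∈-allFin c) mb
          where
          mb : b ∈ᴸ residues
          mb with b | b≢0 | ℤ.n%ℕd<d z p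
          ... | zero  | ne | _ = ⊥-elim (ne refl)
          ... | suc b | _  | lt = ∈ᴸ.∈-applyUpTo⁺ suc (s≤s⁻¹ (subst (suc (suc b) ≤_) (sym (suc-pred p)) lt))
        r : ∀ L v b → (L -ᶻ (v +ᶻ b)) ≡ (L -ᶻ v) -ᶻ b
        r = solveᶻ-∀
        r' : ∀ b q → (b +ᶻ q) -ᶻ b ≡ q
        r' = solveᶻ-∀
        div : P∣ (Lin a c -ᶻ (v c +ᶻ pos b))
        div = ∣ᶻ.divides (z ℤ./ℕ p)
          (trans (r (Lin a c) (v c) (pos b))
            (trans (cong (_-ᶻ pos b) zb) (r' (pos b) ((z ℤ./ℕ p) *ᶻ pos p))))

    -- By `good-exists` each colour rejects at most 2^(n + kn) indices. If every index were rejected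
    -- by some colour, one of the P colours would reject more than that.
    good-index : (ρ : Fin P → Fin l → ℕ) → P * 2 ^ (n + k * n) < l →
      ((∃[ i ] ∀ j → Good (rows j) (ρ j) i) → ⊥) → ⊥
    good-index ρ big none = ¬¬-choice bad λ J → contra J
      where
      len : ∀ j → List.length (rows j) ≤ 2 ^ (n + k * n)
      len j = ≤-trans (≤-reflexive (List.length-map _ Γ)) (monos-length n (k * n))
      bad : ∀ i → ((∃[ j ] ¬ Good (rows j) (ρ j) i) → ⊥) → ⊥
      bad i f = ¬¬-choice (λ j g → f (j , g)) (λ gs → none (i , gs))
      contra : (∀ i → ∃[ j ] ¬ Good (rows j) (ρ j) i) → ⊥
      contra J with pigeon (proj₁ ∘ J) (2 ^ (n + k * n))
                      (subst (_< l) (trans (*-comm P _) (cong (2 ^ (n + k * n) *_) (sym (size-Fin P)))) big)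
      ... | j , ι , inj , fib = done (good-exists (rows j) (ρ j) β β-inj)
        where
        β : Fin (suc (List.length (rows j))) → Fin l
        β t = ι (Fin.inject≤ t (s≤s (len j)))
        β-inj : ∀ s t → β s ≡ β t → s ≡ t
        β-inj s t e = Fin.inject≤-injective (s≤s (len j)) (s≤s (len j)) s t (inj _ _ e)
        nogood : ∀ i → proj₁ (J i) ≡ j → ¬ Good (rows j) (ρ j) i
        nogood i refl = proj₂ (J i)
        done : (∃[ t ] Good (rows j) (ρ j) (β t)) → ⊥
        done (t , g) = nogood (β t) (fib (Fin.inject≤ t (s≤s (len j)))) g

    -- The weighted sum of `prodT` is divisible by p, while exactly one of its terms, that at `a*`,
    -- is not. The polynomial removes the non-solutions. Solutions are constant on S, and two kernel
    -- vectors whose supports lie on opposite sides of i₀ remove every constant but i₀.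
    slice-rank : P * 2 ^ (n + k * n) < l → ∀ ja jb → ja ∈ S → jb ∈ S → ja ≢ jb →
      (∀ a i → (∀ j → j ∈ S → Vec.lookup a j ≡ i) → Sol a) →
      (∀ a → Sol a → ∀ j j' → j ∈ S → j' ∈ S → Vec.lookup a j ≡ Vec.lookup a j') → ⊥
    slice-rank big ja jb sa sb a≢b diag only = good-index ρ big λ { (i₀ , good) → main i₀ good }
      where
      -- The order is reversed for ja alone: i₀ is the last index of the support for ja and the
      -- first one for jb.
      ρ : Fin P → Fin l → ℕ
      ρ j i with j Fin.≟ ja
      ... | yes _ = l ∸ toℕ i
      ... | no _  = toℕ i
      ρ-ja : ∀ i i' → ρ ja i ≤ ρ ja i' → toℕ i' ≤ toℕ i
      ρ-ja i i' le with ja Fin.≟ ja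
      ... | yes _ = ≮⇒≥ (λ lt → <⇒≱ (∸-monoʳ-< lt (<⇒≤ (Fin.toℕ<n i'))) le)
      ... | no n  = ⊥-elim (n refl)
      ρ-jb : ∀ i i' → ρ jb i ≤ ρ jb i' → toℕ i ≤ toℕ i'
      ρ-jb i i' le with jb Fin.≟ ja
      ... | yes e = ⊥-elim (a≢b (sym e))
      ... | no _  = le
      module _ (i₀ : Fin l) (good : ∀ j → Good (rows j) (ρ j) i₀) where
        -- Colours outside S carry a point mass at the default index z₀, which freezes them.
        H : Fin P → Fin l → ℤ
        H j i with S j
        ... | true  = proj₁ (good j) i
        ... | false = pos (χ (i ≟ z₀))
        H-S : ∀ j → j ∈ S → H j ≡ proj₁ (good j)
        H-S j js with S j
        ... | true = refl
        a* : Vec (Fin l) P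
        a* = Vec.tabulate (λ j → if S j then i₀ else z₀)
        a*-S : ∀ j → j ∈ S → Vec.lookup a* j ≡ i₀
        a*-S j js = trans (Vec.lookup∘tabulate _ j) eq
          where
          eq : (if S j then i₀ else z₀) ≡ i₀
          eq with S j
          ... | true = refl
        a*-n : ∀ j → j ∉ S → Vec.lookup a* j ≡ z₀
        a*-n j js = trans (Vec.lookup∘tabulate _ j) eq
          where
          eq : (if S j then i₀ else z₀) ≡ z₀
          eq with S j
          ... | true  = ⊥-elim (js tt)
          ... | false = refl
        kill : ∀ j → j ∈ S → All (Kills (H j)) (rows j)
        kill j js = subst (λ h → All (Kills h) (rows j)) (sym (H-S j js)) (proj₁ (proj₂ (good j)))
        T' = prodT H kill (pairs H kill)
        H-off : ∀ j i → j ∉ S → ¬ i ≡ z₀ → P∣ (H j i)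
        H-off j i js ne with S j
        ... | true = ⊥-elim (js tt)
        ... | false with i Fin.≟ z₀
        ...   | yes e = ⊥-elim (ne e)
        ...   | no _  = P∣0
        H-on : ∀ j → ¬ P∣ (H j (Vec.lookup a* j))
        H-on j with T? (S j)
        ... | yes js = subst (λ z → ¬ P∣ z) (sym (trans (cong (H j) (a*-S j js)) (cong (λ h → h i₀) (H-S j js))))
                         (proj₁ (proj₂ (proj₂ (good j))))
        ... | no js  = subst (λ i → ¬ P∣ (H j i)) (sym (a*-n j js)) off
          where
          off : ¬ P∣ (H j z₀)
          off with S j
          ... | true = ⊥-elim (js tt)
          ... | false with z₀ Fin.≟ z₀
          ...   | yes _ = ¬P∣1
          ...   | no n  = ⊥-elim (n refl)
        vanish : ∀ b → ¬ b ≡ a* → P∣ (weight H b *ᶻ T' b)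
        vanish b ne with all? (λ c → P∣? (Lin b c -ᶻ v c))
        ... | no ¬sol with any? (λ c → ¬? (P∣? (Lin b c -ᶻ v c)))
        ...   | yes (c , nd) = P∣-*ˡ (weight H b) (prodT-nonsol H kill b c nd)
        ...   | no ¬e = ⊥-elim (¬sol (λ c → decidable-stable (P∣? _) (λ n → ¬e (c , n))))
        vanish b ne | yes sol with any? (λ j → ¬? (T? (S j)) ×-dec ¬? (Vec.lookup b j Fin.≟ z₀))
        ... | yes (j , js , nz) = P∣-*ʳ (T' b) (weight-div H b j (H-off j _ js nz))
        ... | no ¬off = P∣-*ʳ (T' b) wdiv
          where
          i = Vec.lookup b ja
          b-S : ∀ j → j ∈ S → Vec.lookup b j ≡ i
          b-S j js = only b sol j ja js sa
          i≢i₀ : ¬ i ≡ i₀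
          i≢i₀ e = ne (trans (sym (Vec.tabulate∘lookup b)) (trans (Vec.tabulate-cong pt) (Vec.tabulate∘lookup a*)))
            where
            pt : ∀ j → Vec.lookup b j ≡ Vec.lookup a* j
            pt j with T? (S j)
            ... | yes js = trans (b-S j js) (trans e (sym (a*-S j js)))
            ... | no js  = trans (decidable-stable (_ Fin.≟ _) (λ n → ¬off (j , js , n))) (sym (a*-n j js))
          wdiv : P∣ (weight H b)
          wdiv with P∣? (proj₁ (good ja) i) | P∣? (proj₁ (good jb) i)
          ... | yes d | _ = weight-div H b ja (subst (λ h → P∣ (h i)) (sym (H-S ja sa)) d)
          ... | no _ | yes d = weight-div H b jb (subst P∣ (sym (trans (cong (H jb) (b-S jb sb)) (cong (λ h → h i) (H-S jb sb)))) d)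
          ... | no na | no nb = ⊥-elim (i≢i₀ (Fin.toℕ-injective (≤-antisym
                 (ρ-ja i₀ i (proj₂ (proj₂ (proj₂ (good ja))) i na))
                 (ρ-jb i₀ i (proj₂ (proj₂ (proj₂ (good jb))) i nb)))))
        main : ⊥
        main = P∣-euclid (weight H a*) (T' a*) (weight-ndiv H a* H-on) (prodT-sol H kill a* (diag a* i₀ a*-S))
                 (SZ-single a* (λ a → weight H a *ᶻ T' a) vanish (Λ-prodT H kill))

-- Averages, powers and least elements

opaque
  ∑-≤∃ : {{E : Enum 𝕏}} {f g : 𝕏 → ℕ} → 1 ≤ size 𝕏 → ∑ f ≤ ∑ g → ∃[ x ] f x ≤ g x
  ∑-≤∃ {f = f} {g} ne le with ∑-< {f = f} {λ x → g x + 1} lt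
    where
    lt : ∑ f < ∑ (λ x → g x + 1)
    lt = ≤-trans (≤-trans (s≤s le) (≤-reflexive (+-comm 1 (∑ g))))
           (≤-trans (+-monoʳ-≤ (∑ g) ne) (≤-reflexive (sym (∑-+ g (λ _ → 1)))))
  ... | x , p = x , s≤s⁻¹ (≤-trans p (≤-reflexive (+-comm (g x) 1)))

^-cancel-≤ : ∀ k {a b} → a ^ suc k ≤ b ^ suc k → a ≤ b
^-cancel-≤ k {a} {b} h with a ≤? b
... | yes p = p
... | no ¬p = ⊥-elim (<⇒≱ (^-monoˡ-< (suc k) (≰⇒> ¬p)) h)

^-root : ∀ q {a b} → 1 ≤ q → a ^ q ≤ b ^ q → a ≤ b
^-root (suc q) _ h = ^-cancel-≤ q h

*-pos : ∀ {a b} → 1 ≤ a → 1 ≤ b → 1 ≤ a * b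
*-pos = *-mono-≤

^-pos : ∀ {a} k → 1 ≤ a → 1 ≤ a ^ k
^-pos {a} k h = m^n>0 a {{>-nonZero h}} k

*-cancelˡ : ∀ c {a b} → 1 ≤ c → c * a ≤ c * b → a ≤ b
*-cancelˡ c {a} {b} h = *-cancelˡ-≤ {a} {b} c {{>-nonZero h}}

-- Without a decision procedure for P, a least witness exists only under a double negation, here in
-- the form of a continuation.
least : (P : ℕ → Set) → ∀ n → P n → ((m : ℕ) → P m → (∀ k → P k → m ≤ k) → ⊥) → ⊥
least P n pn cont = go n n pn ≤-refl
  where
  go : ∀ b n → P n → n ≤ b → ⊥
  rec : ∀ b m → P m → m < b → ⊥
  go b n pn le = lem (∃[ m ] P m × m < n) λ where
    (no ¬e) → cont n pn (λ k pk → ≮⇒≥ (λ lt → ¬e (k , pk , lt)))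
    (yes (m , pm , lt)) → rec b m pm (<-≤-trans lt le)
  rec (suc b) m pm lt = go b m pm (s≤s⁻¹ lt)

*-^ : ∀ k a b → (a * b) ^ k ≡ a ^ k * b ^ k
*-^ zero    a b = refl
*-^ (suc k) a b = trans (cong ((a * b) *_) (*-^ k a b)) (e a b (a ^ k) (b ^ k))
  where
  e : ∀ p q r s → (p * q) * (r * s) ≡ (p * r) * (q * s)
  e = solve-∀

elem∈ : {{E : Enum 𝕏}} (a : 𝕏) → a ∈ᴸ Enum.elems E
elem∈ {{E}} a = go (Enum.elems E) (≤-reflexive (sym (Enum.once E a)))
  where
  go : ∀ xs → 1 ≤ sumL (λ x → χ (x ≟ a)) xs → a ∈ᴸ xs
  go (x ∷ xs) h with x ≟ a
  ... | yes e = here (sym e)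
  ... | no _  = there (go xs h)

-- Finite abelian groups, images and sumsets

module Additive (V : Set) {{enumV : Enum V}} (_⊹_ : V → V → V) (𝟘 : V) (⊖_ : V → V)
                (isAG : IsAbelianGroup _≡_ _⊹_ 𝟘 ⊖_) where

  open IsAbelianGroup isAG using (assoc; comm; identityˡ; identityʳ; inverseˡ; inverseʳ)

  abelianGroup : AbelianGroup 0ℓ 0ℓ
  abelianGroup = record { isAbelianGroup = isAG }

  module AG = AbelianGroupProperties abelianGroup

  _⊝_ : V → V → V
  a ⊝ b = a ⊹ (⊖ b)

  infixl 6 _⊝_

  ⊹⊝ : ∀ v a → (v ⊹ a) ⊝ a ≡ v
  ⊹⊝ v a = trans (assoc v a (⊖ a)) (trans (cong (v ⊹_) (inverseʳ a)) (identityʳ v))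

  ⊝⊹ : ∀ v a → (v ⊝ a) ⊹ a ≡ v
  ⊝⊹ v a = trans (assoc v (⊖ a) a) (trans (cong (v ⊹_) (inverseˡ a)) (identityʳ v))

  ⊹-swap : ∀ a b c → a ⊹ (b ⊹ c) ≡ b ⊹ (a ⊹ c)
  ⊹-swap a b c = trans (sym (assoc a b c)) (trans (cong (_⊹ c) (comm a b)) (assoc b a c))

  ⊹-interchange : ∀ a b c d → (a ⊹ b) ⊹ (c ⊹ d) ≡ (a ⊹ c) ⊹ (b ⊹ d)
  ⊹-interchange a b c d = trans (assoc a b (c ⊹ d)) (trans (cong (a ⊹_) (⊹-swap b c d)) (sym (assoc a c (b ⊹ d))))

  ⊹-rot : ∀ a b c → (a ⊹ b) ⊹ c ≡ (a ⊹ c) ⊹ b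
  ⊹-rot a b c = trans (assoc a b c) (trans (cong (a ⊹_) (comm b c)) (sym (assoc a c b)))

  ⊖-⊝ : ∀ a b → ⊖ (a ⊝ b) ≡ b ⊝ a
  ⊖-⊝ = AG.⁻¹-anti-homo‿-

  ⊝-⊝ : ∀ a d → a ⊝ (a ⊝ d) ≡ d
  ⊝-⊝ a d = trans (cong (a ⊹_) (⊖-⊝ a d)) (trans (comm a (d ⊝ a)) (⊝⊹ d a))

  ⊹⊝⊝ : ∀ v a b → (v ⊹ a) ⊝ (a ⊝ b) ≡ v ⊹ b
  ⊹⊝⊝ v a b = trans (assoc v a (⊖ (a ⊝ b))) (cong (v ⊹_) (⊝-⊝ a b))

  ⊝⊝⊝ : ∀ a v b → (a ⊝ v) ⊝ (a ⊝ b) ≡ b ⊝ v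
  ⊝⊝⊝ a v b = trans (cong (_⊝ (a ⊝ b)) (comm a (⊖ v))) (trans (⊹⊝⊝ (⊖ v) a b) (comm (⊖ v) b))

  ⊹-cancelʳ : ∀ {a b} c → a ⊹ c ≡ b ⊹ c → a ≡ b
  ⊹-cancelʳ {a} {b} c e = trans (sym (⊹⊝ a c)) (trans (cong (_⊝ c) e) (⊹⊝ b c))

  #-shift : (F : V → Bool) (a : V) → # (λ v → F (v ⊹ a)) ≡ # F
  #-shift F a = trans (#-def _) (trans (∑-bij (_⊹ a) (_⊝ a) (λ v → ⊹⊝ v a) (λ v → ⊝⊹ v a) (𝟙 ∘ F)) (sym (#-def F)))

  #-reflect : (F : V → Bool) (a : V) → # (λ v → F (a ⊝ v)) ≡ # F
  #-reflect F a = trans (#-def _) (trans (∑-bij (a ⊝_) (a ⊝_) (⊝-⊝ a) (⊝-⊝ a) (𝟙 ∘ F)) (sym (#-def F)))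

  σ : ∀ {M k} → (Fin M → V) → Vec (Fin M) k → V
  σ y []      = 𝟘
  σ y (i ∷ w) = y i ⊹ σ y w

  σ-++ : ∀ {M j k} (y : Fin M → V) (u : Vec (Fin M) j) (w : Vec (Fin M) k) → σ y (u Vec.++ w) ≡ σ y u ⊹ σ y w
  σ-++ y []      w = sym (identityˡ _)
  σ-++ y (i ∷ u) w = trans (cong (y i ⊹_) (σ-++ y u w)) (sym (assoc (y i) (σ y u) (σ y w)))

  image : {{E : Enum 𝕏}} → (𝕏 → V) → (𝕏 → Bool) → V → Bool
  image s F v = does (any? (λ x → ∈? F x ×-dec (s x ≟ v)))

  image-in : {{E : Enum 𝕏}} (s : 𝕏 → V) {F : 𝕏 → Bool} {x : 𝕏} → x ∈ F → s x ∈ image s F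
  image-in s {F} {x} h = into (any? (λ x' → ∈? F x' ×-dec (s x' ≟ s x))) (x , h , refl)

  image-out : {{E : Enum 𝕏}} (s : 𝕏 → V) {F : 𝕏 → Bool} {v : V} → v ∈ image s F → ∃[ x ] x ∈ F × s x ≡ v
  image-out s {F} {v} = out (any? (λ x → ∈? F x ×-dec (s x ≟ v)))

  image-pos : {{E : Enum 𝕏}} (s : 𝕏 → V) {F : 𝕏 → Bool} → 1 ≤ # F → 1 ≤ # (image s F)
  image-pos s h = let (x , xF) = #-∃ h in #-pos (image-in s xF)

  -- Plünnecke's inequality, after Petridis

  _⊞_ : (V → Bool) → (V → Bool) → V → Bool
  (A ⊞ B) v = does (any? (λ a → ∈? A a ×-dec ∈? B (v ⊝ a)))

  ⊞-in : ∀ {A B a b} → a ∈ A → b ∈ B → (a ⊹ b) ∈ (A ⊞ B)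
  ⊞-in {A} {B} {a} {b} ha hb = into (any? (λ a' → ∈? A a' ×-dec ∈? B ((a ⊹ b) ⊝ a')))
    (a , ha , subst (_∈ B) (sym (trans (cong (_⊝ a) (comm a b)) (⊹⊝ b a))) hb)

  ⊞-out : ∀ {A B v} → v ∈ (A ⊞ B) → ∃[ a ] ∃[ b ] a ∈ A × b ∈ B × v ≡ a ⊹ b
  ⊞-out {A} {B} {v} h with out (any? (λ a → ∈? A a ×-dec ∈? B (v ⊝ a))) h
  ... | a , ha , hb = a , v ⊝ a , ha , hb , sym (trans (comm a (v ⊝ a)) (⊝⊹ v a))

  ⊞-monoˡ : ∀ {A A' B} → (∀ v → v ∈ A → v ∈ A') → # (A ⊞ B) ≤ # (A' ⊞ B)
  ⊞-monoˡ {A} {A'} {B} h = #-mono {F = A ⊞ B} {A' ⊞ B} λ v m → let (a , b , ha , hb , e) = ⊞-out {A} {B} m in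
    subst (_∈ (A' ⊞ B)) (sym e) (⊞-in {A'} {B} (h a ha) hb)

  -- The sumset X + C with C as a list, so that an induction can add the elements of C one at a
  -- time.
  sumList : List V → (V → Bool) → V → Bool
  sumList []      X v = false
  sumList (c ∷ C) X v = X (v ⊝ c) ∨ sumList C X v

  sumList-in : ∀ {C X c x} → c ∈ᴸ C → x ∈ X → (x ⊹ c) ∈ sumList C X
  sumList-in {c ∷ C} {X} {x = x} (here refl) h = ∨-in-l (subst (_∈ X) (sym (⊹⊝ x c)) h)
  sumList-in {c ∷ C} {X} {c'} {x} (there m) h = ∨-in-r {X ((x ⊹ c') ⊝ c)} (sumList-in {C} m h)

  sumList-out : ∀ {C X v} → v ∈ sumList C X → ∃[ c ] ∃[ x ] c ∈ᴸ C × x ∈ X × v ≡ x ⊹ c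
  sumList-out {c ∷ C} {X} {v} h with ∨-out {X (v ⊝ c)} h
  ... | inj₁ hx = c , v ⊝ c , here refl , hx , sym (⊝⊹ v c)
  ... | inj₂ h' = let (c' , x , m , hx , e) = sumList-out {C} h' in c' , x , there m , hx , e

  module Petridis (X B : V → Bool)
    (minimal : ∀ Z → (∀ v → v ∈ Z → v ∈ X) → # (X ⊞ B) * # Z ≤ # (Z ⊞ B) * # X) where

    XB = X ⊞ B

    -- Let Z consist of the t in X for which t + B + c is already covered by X + B + C. Then c
    -- contributes at most |X + B| - |Z + B| new elements to X + B + C and at least |X| - |Z| to X +
    -- C. Minimality of X compares the two subtracted terms.
    petridis : ∀ C → # (sumList C XB) * # X ≤ # XB * # (sumList C X)
    petridis [] = subst (λ z → z * # X ≤ # XB * z) (sym zr) z≤n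
      where
      zr : # {V} (λ _ → false) ≡ 0
      zr = trans (#-def {V} (λ _ → false)) ∑-0
    petridis (c ∷ C) = main
      where
      open ≤-Reasoning
      old new : (V → Bool) → V → Bool
      old S v = sumList C S v
      new S v = S (v ⊝ c) ∧ not (sumList C S v)
      Z : V → Bool
      Z t = does (all? (λ b → ¬? (∈? B b) ⊎-dec ∈? (sumList C XB) ((t ⊹ b) ⊹ c))) ∧ X t
      Z⊂X : ∀ v → v ∈ Z → v ∈ X
      Z⊂X v = ∧-r {does (all? (λ b → ¬? (∈? B b) ⊎-dec ∈? (sumList C XB) ((v ⊹ b) ⊹ c)))}
      shift : (S : V → Bool) → # (λ v → S (v ⊝ c)) ≡ # S
      shift S = #-shift S (⊖ c)
      a₁ : # (sumList (c ∷ C) XB) ≤ # (old XB) + # (new XB)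
      a₁ = ≤-trans (#-mono {F = sumList (c ∷ C) XB} {λ v → old XB v ∨ new XB v} pt) (#-∪ (old XB) (new XB))
        where
        pt : ∀ v → v ∈ sumList (c ∷ C) XB → T (old XB v ∨ new XB v)
        pt v h with sumList C XB v | XB (v ⊝ c) | h
        ... | true  | _    | _ = tt
        ... | false | true | _ = tt
      a₂ : # (new XB) + # (Z ⊞ B) ≤ # XB
      a₂ = begin
        # (new XB) + # (Z ⊞ B)
          ≡⟨ cong (# (new XB) +_) (sym (shift (Z ⊞ B))) ⟩
        # (new XB) + # (λ v → (Z ⊞ B) (v ⊝ c))
          ≤⟨ +-mono-≤ (#-mono {F = new XB} {λ v → XB (v ⊝ c) ∧ not ((Z ⊞ B) (v ⊝ c))} p₁)
                      (#-mono {F = λ v → (Z ⊞ B) (v ⊝ c)} {λ v → XB (v ⊝ c) ∧ (Z ⊞ B) (v ⊝ c)} p₂) ⟩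
        # (λ v → XB (v ⊝ c) ∧ not ((Z ⊞ B) (v ⊝ c))) + # (λ v → XB (v ⊝ c) ∧ (Z ⊞ B) (v ⊝ c))
          ≡⟨ +-comm (# (λ v → XB (v ⊝ c) ∧ not ((Z ⊞ B) (v ⊝ c)))) _ ⟩
        # (λ v → XB (v ⊝ c) ∧ (Z ⊞ B) (v ⊝ c)) + # (λ v → XB (v ⊝ c) ∧ not ((Z ⊞ B) (v ⊝ c)))
          ≡⟨ sym (#-split (λ v → XB (v ⊝ c)) (λ v → (Z ⊞ B) (v ⊝ c))) ⟩
        # (λ v → XB (v ⊝ c))
          ≡⟨ shift XB ⟩
        # XB ∎
        where
        p₁ : ∀ v → v ∈ new XB → T (XB (v ⊝ c) ∧ not ((Z ⊞ B) (v ⊝ c)))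
        p₁ v h = ∧-in (∧-l {XB (v ⊝ c)} h) (not-in λ m → not-out (∧-r {XB (v ⊝ c)} h) (covered m))
          where
          covered : (v ⊝ c) ∈ (Z ⊞ B) → v ∈ sumList C XB
          covered m with ⊞-out {Z} {B} m
          ... | t , b , ht , hb , e with out (all? (λ b → ¬? (∈? B b) ⊎-dec ∈? (sumList C XB) ((t ⊹ b) ⊹ c))) (∧-l ht) b
          ...   | inj₁ n = ⊥-elim (n hb)
          ...   | inj₂ q = subst (_∈ sumList C XB) (trans (cong (_⊹ c) (sym e)) (⊝⊹ v c)) q
        p₂ : ∀ v → (v ⊝ c) ∈ (Z ⊞ B) → T (XB (v ⊝ c) ∧ (Z ⊞ B) (v ⊝ c))
        p₂ v m = ∧-in up m
          where
          up : (v ⊝ c) ∈ XB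
          up with ⊞-out {Z} {B} m
          ... | t , b , ht , hb , e = subst (_∈ XB) (sym e) (⊞-in {X} {B} (Z⊂X t ht) hb)
      a₃ : # X ≤ # (new X) + # Z
      a₃ = begin
        # X                    ≡⟨ sym (shift X) ⟩
        # (λ v → X (v ⊝ c))    ≤⟨ #-mono {F = λ v → X (v ⊝ c)} {λ v → new X v ∨ Z (v ⊝ c)} pt ⟩
        # (λ v → new X v ∨ Z (v ⊝ c))      ≤⟨ #-∪ (new X) (λ v → Z (v ⊝ c)) ⟩
        # (new X) + # (λ v → Z (v ⊝ c))    ≡⟨ cong (# (new X) +_) (shift Z) ⟩
        # (new X) + # Z ∎
        where
        pt : ∀ v → (v ⊝ c) ∈ X → T (new X v ∨ Z (v ⊝ c))
        pt v h with T? (sumList C X v)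
        ... | no n = ∨-in-l (∧-in h (not-in n))
        ... | yes m = ∨-in-r {new X v} (∧-in (into (all? _) good) h)
          where
          good : ∀ b → ¬ (b ∈ B) ⊎ ((((v ⊝ c) ⊹ b) ⊹ c) ∈ sumList C XB)
          good b with T? (B b)
          ... | no n = inj₁ n
          ... | yes hb with sumList-out {C} {X} m
          ...   | c' , x , mc , hx , e = inj₂ (subst (_∈ sumList C XB) eq
                    (sumList-in {C} {XB} mc (⊞-in {X} {B} hx hb)))
            where
            eq : (x ⊹ b) ⊹ c' ≡ ((v ⊝ c) ⊹ b) ⊹ c
            eq = trans (⊹-rot x b c') (trans (cong (_⊹ b) (trans (sym e) (sym (⊝⊹ v c)))) (⊹-rot (v ⊝ c) c b))
      a₄ : # (old X) + # (new X) ≤ # (sumList (c ∷ C) X)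
      a₄ = begin
        # (old X) + # (new X)
          ≤⟨ +-mono-≤ (#-mono {F = old X} {λ v → sumList (c ∷ C) X v ∧ old X v} p₁)
                      (#-mono {F = new X} {λ v → sumList (c ∷ C) X v ∧ not (old X v)} p₂) ⟩
        # (λ v → sumList (c ∷ C) X v ∧ old X v) + # (λ v → sumList (c ∷ C) X v ∧ not (old X v))
          ≡⟨ sym (#-split (sumList (c ∷ C) X) (old X)) ⟩
        # (sumList (c ∷ C) X) ∎
        where
        p₁ : ∀ v → v ∈ old X → T (sumList (c ∷ C) X v ∧ old X v)
        p₁ v h = ∧-in (∨-in-r {X (v ⊝ c)} h) h
        p₂ : ∀ v → v ∈ new X → T (sumList (c ∷ C) X v ∧ not (old X v))
        p₂ v h = ∧-in (∨-in-l (∧-l {X (v ⊝ c)} h)) (∧-r {X (v ⊝ c)} h)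
      new-le : # (new XB) * # X ≤ # XB * # (new X)
      new-le = +-cancelʳ-≤ (# (Z ⊞ B) * # X) (# (new XB) * # X) (# XB * # (new X)) (begin
        # (new XB) * # X + # (Z ⊞ B) * # X     ≡⟨ sym (*-distribʳ-+ (# X) (# (new XB)) _) ⟩
        (# (new XB) + # (Z ⊞ B)) * # X         ≤⟨ *-monoˡ-≤ (# X) a₂ ⟩
        # XB * # X                             ≤⟨ *-monoʳ-≤ (# XB) a₃ ⟩
        # XB * (# (new X) + # Z)               ≡⟨ *-distribˡ-+ (# XB) (# (new X)) _ ⟩
        # XB * # (new X) + # XB * # Z           ≤⟨ +-monoʳ-≤ (# XB * # (new X)) (minimal Z Z⊂X) ⟩
        # XB * # (new X) + # (Z ⊞ B) * # X     ∎)
      main : # (sumList (c ∷ C) XB) * # X ≤ # XB * # (sumList (c ∷ C) X)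
      main = begin
        # (sumList (c ∷ C) XB) * # X                ≤⟨ *-monoˡ-≤ (# X) a₁ ⟩
        (# (old XB) + # (new XB)) * # X              ≡⟨ *-distribʳ-+ (# X) (# (old XB)) _ ⟩
        # (old XB) * # X + # (new XB) * # X          ≤⟨ +-mono-≤ (petridis C) new-le ⟩
        # XB * # (old X) + # XB * # (new X)          ≡⟨ sym (*-distribˡ-+ (# XB) (# (old X)) _) ⟩
        # XB * (# (old X) + # (new X))              ≤⟨ *-monoʳ-≤ (# XB) a₄ ⟩
        # XB * # (sumList (c ∷ C) X)                ∎

  listOf : (V → Bool) → List V
  listOf B = List.filter (∈? B) (Enum.elems enumV)

  sums : (V → Bool) → ℕ → List V
  sums B zero    = 𝟘 ∷ []
  sums B (suc L) = List.cartesianProductWith _⊹_ (listOf B) (sums B L)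

  -- For a subset X of A with the smallest ratio |X + B| / |X|, each further summand B enlarges X +
  -- LB by at most this ratio, according to `petridis`. A translate of W lies in X + LB.
  plünnecke : ∀ A B → 1 ≤ # A → ∀ L W → (∀ v → v ∈ W → v ∈ᴸ sums B L) →
    # W * # A ^ L ≤ # (A ⊞ B) ^ L * # A
  plünnecke A B ne L W W⊂ = decidable-stable (_ ≤? _) λ cont → go cont
   where
   go : (# W * # A ^ L ≤ # (A ⊞ B) ^ L * # A → ⊥) → ⊥
   go cont = minimise (# A) A (λ _ h → h) ne ≤-refl ≤-refl
    where
    finish : ∀ X → (∀ v → v ∈ X → v ∈ A) → 1 ≤ # X → # (X ⊞ B) * # A ≤ # (A ⊞ B) * # X →
             (∀ Z → (∀ v → v ∈ Z → v ∈ X) → # (X ⊞ B) * # Z ≤ # (Z ⊞ B) * # X) → ⊥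
    finish X X⊂A neX ratio minimal = cont (*-cancelˡ (x ^ L) (^-pos L neX) (begin
      x ^ L * (# W * a ^ L)        ≡⟨ e₁ (x ^ L) (# W) (a ^ L) ⟩
      (# W * x ^ L) * a ^ L        ≤⟨ *-monoˡ-≤ (a ^ L) (≤-trans (*-monoˡ-≤ (x ^ L) W≤) (iter L)) ⟩
      (y ^ L * x) * a ^ L          ≡⟨ e₂ (y ^ L) x (a ^ L) ⟩
      (y ^ L * a ^ L) * x          ≡⟨ cong (_* x) (sym (*-^ L y a)) ⟩
      (y * a) ^ L * x              ≤⟨ *-mono-≤ (^-monoˡ-≤ L ratio) (#-mono {F = X} {A} X⊂A) ⟩
      (d * x) ^ L * a              ≡⟨ cong (_* a) (*-^ L d x) ⟩
      (d ^ L * x ^ L) * a          ≡⟨ e₃ (d ^ L) (x ^ L) a ⟩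
      x ^ L * (d ^ L * a)          ∎))
      where
      open ≤-Reasoning
      open Petridis X B minimal
      x = # X
      a = # A
      y = # (X ⊞ B)
      d = # (A ⊞ B)
      e₁ : ∀ p q r → p * (q * r) ≡ (q * p) * r
      e₁ = solve-∀
      e₂ : ∀ p q r → (p * q) * r ≡ (p * r) * q
      e₂ = solve-∀
      e₃ : ∀ p q r → (p * q) * r ≡ q * (p * r)
      e₃ = solve-∀
      e₄ : ∀ p q r → p * (q * r) ≡ (p * q) * r
      e₄ = solve-∀
      x₀ = proj₁ (#-∃ {F = X} neX)
      W≤ : # W ≤ # (sumList (sums B L) X)
      W≤ = ≤-trans
        (#-mono {F = W} {λ v → sumList (sums B L) X (v ⊹ x₀)}
          (λ v h → subst (_∈ sumList (sums B L) X) (comm x₀ v)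
            (sumList-in {sums B L} {X} (W⊂ v h) (proj₂ (#-∃ {F = X} neX)))))
        (≤-reflexive (#-shift (sumList (sums B L) X) x₀))
      iter : ∀ L → # (sumList (sums B L) X) * x ^ L ≤ y ^ L * x
      iter zero = subst₂ _≤_ (sym (*-identityʳ _)) (sym (*-identityˡ x)) (≤-trans
        (#-mono {F = sumList (𝟘 ∷ []) X} {λ v → X (v ⊝ 𝟘)} pt) (≤-reflexive (#-shift X (⊖ 𝟘))))
        where
        pt : ∀ v → v ∈ sumList (𝟘 ∷ []) X → (v ⊝ 𝟘) ∈ X
        pt v h with ∨-out {X (v ⊝ 𝟘)} h
        ... | inj₁ q = q
      iter (suc L) = begin
        # (sumList (sums B (suc L)) X) * (x * x ^ L)
          ≤⟨ *-monoˡ-≤ (x * x ^ L) (#-mono {F = sumList (sums B (suc L)) X} {sumList (sums B L) (X ⊞ B)} pt) ⟩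
        # (sumList (sums B L) (X ⊞ B)) * (x * x ^ L)
          ≡⟨ e₄ (# (sumList (sums B L) (X ⊞ B))) x (x ^ L) ⟩
        # (sumList (sums B L) (X ⊞ B)) * x * x ^ L
          ≤⟨ *-monoˡ-≤ (x ^ L) (petridis (sums B L)) ⟩
        y * # (sumList (sums B L) X) * x ^ L
          ≡⟨ *-assoc y _ (x ^ L) ⟩
        y * (# (sumList (sums B L) X) * x ^ L)
          ≤⟨ *-monoʳ-≤ y (iter L) ⟩
        y * (y ^ L * x)
          ≡⟨ e₄ y (y ^ L) x ⟩
        y ^ suc L * x ∎
        where
        pt : ∀ v → v ∈ sumList (sums B (suc L)) X → v ∈ sumList (sums B L) (X ⊞ B)
        pt v h with sumList-out {sums B (suc L)} {X} h
        ... | c , t , mc , ht , e with ∈ᴸ.∈-cartesianProductWith⁻ _⊹_ (listOf B) (sums B L) mc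
        ...   | b , c' , mb , mc' , refl = subst (_∈ sumList (sums B L) (X ⊞ B))
                  (trans (assoc t b c') (sym e))
                  (sumList-in {sums B L} {X ⊞ B} mc' (⊞-in {X} {B} ht (proj₂ (∈ᴸ.∈-filter⁻ (∈? B) {xs = Enum.elems enumV} mb))))
    -- A subset of X with a smaller ratio must be a proper subset, so a descent on the cardinality
    -- ends. Its last set is minimal among its own subsets, as `Petridis` requires.
    minimise : ∀ n X → (∀ v → v ∈ X → v ∈ A) → 1 ≤ # X → # X ≤ n → # (X ⊞ B) * # A ≤ # (A ⊞ B) * # X → ⊥
    descend : ∀ n X → (∀ v → v ∈ X → v ∈ A) → # (X ⊞ B) * # A ≤ # (A ⊞ B) * # X → 1 ≤ # X →
              ∀ Z → (∀ v → v ∈ Z → v ∈ X) → # (Z ⊞ B) * # X < # (X ⊞ B) * # Z → # X ≤ n → ⊥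
    minimise n X X⊂A neX le ratio =
      lem (∃[ Z ] (∀ v → v ∈ Z → v ∈ X) × # (Z ⊞ B) * # X < # (X ⊞ B) * # Z) λ where
        (no ¬e) → finish X X⊂A neX ratio (λ Z Z⊂X → ≮⇒≥ (λ lt → ¬e (Z , Z⊂X , lt)))
        (yes (Z , Z⊂X , lt)) → descend n X X⊂A ratio neX Z Z⊂X lt le
    descend n X X⊂A ratio neX Z Z⊂X lt le = step n (<-≤-trans Z<X le)
        where
        open ≤-Reasoning
        neZ : 1 ≤ # Z
        neZ = n≢0⇒n>0 (λ e → n≮0 (subst (# (Z ⊞ B) * # X <_) (trans (cong (# (X ⊞ B) *_) e) (*-zeroʳ (# (X ⊞ B)))) lt))
        Z<X : # Z < # X
        Z<X with # Z <? # X
        ... | yes p = p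
        ... | no ¬p = ⊥-elim (<⇒≱ lt (*-mono-≤ (⊞-monoˡ {X} {Z} {B} X⊂Z) (#-mono {F = Z} {X} Z⊂X)))
          where
          rest : # (λ v → X v ∧ not (Z v)) ≡ 0
          rest = n≤0⇒n≡0 (+-cancelˡ-≤ (# Z) _ _ (begin
            # Z + # (λ v → X v ∧ not (Z v))
              ≤⟨ +-monoˡ-≤ _ (#-mono {F = Z} {λ v → X v ∧ Z v} (λ v h → ∧-in (Z⊂X v h) h)) ⟩
            # (λ v → X v ∧ Z v) + # (λ v → X v ∧ not (Z v))  ≡⟨ sym (#-split X Z) ⟩
            # X                                              ≤⟨ ≮⇒≥ ¬p ⟩
            # Z                                              ≡⟨ sym (+-identityʳ _) ⟩
            # Z + 0 ∎))
          X⊂Z : ∀ v → v ∈ X → v ∈ Z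
          X⊂Z v h with T? (Z v)
          ... | yes q = q
          ... | no n = ⊥-elim (n≮0 (subst (1 ≤_) rest (#-pos {F = λ v → X v ∧ not (Z v)} {v} (∧-in h (not-in n)))))
        step : ∀ n → # Z < n → ⊥
        step (suc n) q = minimise n Z (λ v h → X⊂A v (Z⊂X v h)) neZ (s≤s⁻¹ q)
          (*-cancelˡ (# X) neX (begin
            # X * (# (Z ⊞ B) * # A)     ≡⟨ e₁ (# X) (# (Z ⊞ B)) (# A) ⟩
            (# (Z ⊞ B) * # X) * # A     ≤⟨ *-monoˡ-≤ (# A) (<⇒≤ lt) ⟩
            (# (X ⊞ B) * # Z) * # A     ≡⟨ e₂ (# (X ⊞ B)) (# Z) (# A) ⟩
            (# (X ⊞ B) * # A) * # Z     ≤⟨ *-monoˡ-≤ (# Z) ratio ⟩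
            (# (A ⊞ B) * # X) * # Z     ≡⟨ e₃ (# (A ⊞ B)) (# X) (# Z) ⟩
            # X * (# (A ⊞ B) * # Z)     ∎))
          where
          e₁ : ∀ p q r → p * (q * r) ≡ (q * p) * r
          e₁ = solve-∀
          e₂ : ∀ p q r → (p * q) * r ≡ (p * r) * q
          e₂ = solve-∀
          e₃ : ∀ p q r → (p * q) * r ≡ q * (p * r)
          e₃ = solve-∀

-- Powers, densities and lengths for the structure theorem

𝟙-∧ : ∀ a b → 𝟙 (a ∧ b) ≡ 𝟙 a * 𝟙 b
𝟙-∧ true  b = sym (+-identityʳ (𝟙 b))
𝟙-∧ false b = refl

^-flip : ∀ a m n → (a ^ m) ^ n ≡ (a ^ n) ^ m
^-flip a m n = trans (^-*-assoc a m n) (trans (cong (a ^_) (*-comm m n)) (sym (^-*-assoc a n m)))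

-- Plünnecke's bound x ≤ (d/q)^L q combined with the path counts d ≤ y⁴/φ³ and y ≤ v^(1/e) φ, cleared of
-- division and of roots.
power-bound : ∀ L e {x q d φ y v} → 1 ≤ φ → φ ≤ q → q ≤ y → x * q ^ L ≤ d ^ L * q →
  d * (φ * (φ * φ)) ≤ (y * y) * (y * y) → y ^ e ≤ v * φ ^ e → x ^ e ≤ v ^ (4 * L) * y ^ e
power-bound L e {x} {q} {d} {φ} {y} {v} 1≤φ φ≤q q≤y h₁ h₂ h₃ =
  *-cancelˡ ((φ ^ e) ^ (4 * L)) (^-pos (4 * L) (^-pos e 1≤φ)) (begin
    (φ ^ e) ^ (4 * L) * x ^ e          ≡⟨ cong (_* x ^ e) (^-flip φ e (4 * L)) ⟩
    (φ ^ (4 * L)) ^ e * x ^ e          ≡⟨ sym (*-^ e (φ ^ (4 * L)) x) ⟩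
    (φ ^ (4 * L) * x) ^ e              ≤⟨ ^-monoˡ-≤ e base ⟩
    (y ^ (4 * L) * y) ^ e              ≡⟨ *-^ e (y ^ (4 * L)) y ⟩
    (y ^ (4 * L)) ^ e * y ^ e          ≡⟨ cong (_* y ^ e) (^-flip y (4 * L) e) ⟩
    (y ^ e) ^ (4 * L) * y ^ e          ≤⟨ *-monoˡ-≤ (y ^ e) (^-monoˡ-≤ (4 * L) h₃) ⟩
    (v * φ ^ e) ^ (4 * L) * y ^ e      ≡⟨ cong (_* y ^ e) (*-^ (4 * L) v (φ ^ e)) ⟩
    (v ^ (4 * L) * (φ ^ e) ^ (4 * L)) * y ^ e  ≡⟨ e₁ (v ^ (4 * L)) ((φ ^ e) ^ (4 * L)) (y ^ e) ⟩
    (φ ^ e) ^ (4 * L) * (v ^ (4 * L) * y ^ e) ∎)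
  where
  open ≤-Reasoning
  e₁ : ∀ a b c → (a * b) * c ≡ b * (a * c)
  e₁ = solve-∀
  e₂ : ∀ a b x → (a * b) * x ≡ (x * a) * b
  e₂ = solve-∀
  e₃ : ∀ a q b → (a * q) * b ≡ (a * b) * q
  e₃ = solve-∀
  φ⁴ : ∀ z → z ^ (4 * L) ≡ z ^ L * (z * (z * z)) ^ L
  φ⁴ z = trans (sym (^-*-assoc z 4 L)) (trans (cong (_^ L) (e₄ z)) (*-^ L z (z * (z * z))))
    where
    e₄ : ∀ z → z * (z * (z * (z * 1))) ≡ z * (z * (z * z))
    e₄ = solve-∀
  y⁴ : ((y * y) * (y * y)) ^ L ≡ y ^ (4 * L)
  y⁴ = trans (cong (_^ L) (e₄ y)) (^-*-assoc y 4 L)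
    where
    e₄ : ∀ z → (z * z) * (z * z) ≡ z * (z * (z * (z * 1)))
    e₄ = solve-∀
  φ³ = φ * (φ * φ)
  base : φ ^ (4 * L) * x ≤ y ^ (4 * L) * y
  base = begin
    φ ^ (4 * L) * x                 ≡⟨ cong (_* x) (φ⁴ φ) ⟩
    (φ ^ L * φ³ ^ L) * x            ≡⟨ e₂ (φ ^ L) (φ³ ^ L) x ⟩
    (x * φ ^ L) * φ³ ^ L            ≤⟨ *-monoˡ-≤ (φ³ ^ L) (≤-trans (*-monoʳ-≤ x (^-monoˡ-≤ L φ≤q)) h₁) ⟩
    (d ^ L * q) * φ³ ^ L            ≡⟨ e₃ (d ^ L) q (φ³ ^ L) ⟩
    (d ^ L * φ³ ^ L) * q            ≡⟨ cong (_* q) (sym (*-^ L d φ³)) ⟩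
    (d * φ³) ^ L * q                ≤⟨ *-mono-≤ (^-monoˡ-≤ L h₂) q≤y ⟩
    ((y * y) * (y * y)) ^ L * y     ≡⟨ cong (_* y) y⁴ ⟩
    y ^ (4 * L) * y                 ∎

opaque
  -- In `Choice` a pair is poor if its common neighbourhood has density below 1 / `cube R`. With 64
  -- R³ the poor pairs make up at most a sixteenth of the pairs in the chosen neighbourhood.
  cube : ℕ → ℕ
  cube R = 64 * (R * (R * R))

  cube-def : ∀ R → cube R ≡ 64 * (R * (R * R))
  cube-def R = refl

4R≤cube : ∀ {R} → 1 ≤ R → 4 * R ≤ cube R
4R≤cube {R} h = begin
  4 * R               ≤⟨ *-monoˡ-≤ R (m≤m+n 4 60) ⟩
  64 * R              ≡⟨ cong (64 *_) (sym (*-identityʳ R)) ⟩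
  64 * (R * 1)        ≤⟨ *-monoʳ-≤ 64 (*-monoʳ-≤ R (*-pos h h)) ⟩
  64 * (R * (R * R))  ≡⟨ sym (cube-def R) ⟩
  cube R              ∎
  where open ≤-Reasoning

cube-pos : ∀ {R} → 1 ≤ R → 1 ≤ cube R
cube-pos h = ≤-trans (≤-trans h (m≤n*m _ 4)) (4R≤cube h)

-- Each halving of the length turns density 1/R into 1 / `cube R`; the last factor 4 comes from the
-- passage to `W'` in `Choice`.
tower : ℕ → ℕ → ℕ
tower zero    R = 4 * R
tower (suc i) R = tower i (cube R)

4R≤tower : ∀ i {R} → 1 ≤ R → 4 * R ≤ tower i R
4R≤tower zero    h = ≤-refl
4R≤tower (suc i) {R} h = ≤-trans (≤-trans (4R≤cube h) (m≤n*m (cube R) 4)) (4R≤tower i (cube-pos h))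

-- The lengths 2^i, as successors, with len (suc i) = len i + len i by definition.
lenp len : ℕ → ℕ
lenp zero    = 0
lenp (suc i) = lenp i + suc (lenp i)
len i = suc (lenp i)

-- Popular differences and dependent random choice

module Growth (V : Set) {{enumV : Enum V}} (_⊹_ : V → V → V) (𝟘 : V) (⊖_ : V → V)
              (isAG : IsAbelianGroup _≡_ _⊹_ 𝟘 ⊖_) where

  open Additive V _⊹_ 𝟘 ⊖_ isAG

  -- Double counting of the pairs (d, e) for which d and d - e both lie in A: the pair is determined
  -- by these two elements.
  reps : ∀ (A E : V → Bool) φ → (∀ e → e ∈ E → φ ≤ # (λ d → A d ∧ A (d ⊝ e))) → # E * φ ≤ # A * # A
  reps A E φ h = begin
    # E * φ                                        ≡⟨ trans (cong (_* φ) (#-def E)) (sym (∑-*ʳ (𝟙 ∘ E) φ)) ⟩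
    ∑ (λ e → 𝟙 (E e) * φ)                          ≤⟨ ∑-mono pt ⟩
    ∑ (λ e → # (λ d → A d ∧ A (d ⊝ e)))            ≡⟨ ∑-cong (λ e → #-def _) ⟩
    ∑ (λ e → ∑ (λ d → 𝟙 (A d ∧ A (d ⊝ e))))        ≡⟨ ∑-swap (λ e d → 𝟙 (A d ∧ A (d ⊝ e))) ⟩
    ∑ (λ d → ∑ (λ e → 𝟙 (A d ∧ A (d ⊝ e))))        ≡⟨ ∑-cong inner ⟩
    ∑ (λ d → 𝟙 (A d) * # A)                        ≡⟨ trans (∑-*ʳ (𝟙 ∘ A) (# A)) (cong (_* # A) (sym (#-def A))) ⟩
    # A * # A                                      ∎
    where
    open ≤-Reasoning
    pt : ∀ e → 𝟙 (E e) * φ ≤ # (λ d → A d ∧ A (d ⊝ e))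
    pt e with E e | h e
    ... | true  | f = ≤-trans (≤-reflexive (*-identityˡ φ)) (f tt)
    ... | false | _ = z≤n
    inner : ∀ d → ∑ (λ e → 𝟙 (A d ∧ A (d ⊝ e))) ≡ 𝟙 (A d) * # A
    inner d = trans (∑-cong (λ e → 𝟙-∧ (A d) (A (d ⊝ e)))) (trans (∑-*ˡ (𝟙 (A d)) (λ e → 𝟙 (A (d ⊝ e))))
      (cong (𝟙 (A d) *_) (trans (sym (#-def (λ e → A (d ⊝ e)))) (#-reflect A d))))

  negate : (V → Bool) → V → Bool
  negate Q v = Q (𝟘 ⊝ v)

  -- Dependent random choice: in the neighbourhood of a random right vertex almost all pairs have many common
  -- neighbours, so their differences have many representations as differences in S.
  module Choice {Ω : Set} {{enumΩ : Enum Ω}} (s : Ω → V) (G : Ω → Ω → Bool) (S : V → Bool) (R φ : ℕ)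
    (1≤R : 1 ≤ R) (1≤T : 1 ≤ size Ω)
    (dense : size Ω * size Ω ≤ R * ∑ (λ ω₀ → # (λ ω → G ω ω₀)))
    (edge : ∀ ω ω₀ → T (G ω ω₀) → (s ω ⊹ s ω₀) ∈ S)
    (many : ∀ (M : Ω → Bool) → size Ω ≤ cube R * # M → φ ≤ # (image s M)) where

    N = size Ω
    R₁ = cube R

    cn : Ω → Ω → ℕ
    cn ω ω' = # (λ ω₀ → G ω ω₀ ∧ G ω' ω₀)

    poor? : ∀ ω ω' → Dec (R₁ * cn ω ω' < N)
    poor? ω ω' = R₁ * cn ω ω' <? N

    poor : Ω → Ω → Bool
    poor ω ω' = does (poor? ω ω')

    ind : Ω → Ω → Ω → ℕ
    ind ω₀ ω ω' = 𝟙 (G ω ω₀ ∧ (G ω' ω₀ ∧ poor ω ω'))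

    poors : Ω → ℕ
    poors ω₀ = ∑ (λ ω → ∑ (ind ω₀ ω))

    few-poor : R₁ * ∑ poors ≤ N * N * N
    few-poor = begin
      R₁ * ∑ poors
        ≡⟨ cong (R₁ *_) (trans (∑-swap (λ ω₀ ω → ∑ (ind ω₀ ω))) (∑-cong (λ ω → ∑-swap (λ ω₀ ω' → ind ω₀ ω ω')))) ⟩
      R₁ * ∑ (λ ω → ∑ (λ ω' → ∑ (λ ω₀ → ind ω₀ ω ω')))
        ≡⟨ sym (trans (∑-cong (λ ω → ∑-*ˡ R₁ (λ ω' → ∑ (λ ω₀ → ind ω₀ ω ω')))) (∑-*ˡ R₁ (λ ω → ∑ (λ ω' → ∑ (λ ω₀ → ind ω₀ ω ω'))))) ⟩
      ∑ (λ ω → ∑ (λ ω' → R₁ * ∑ (λ ω₀ → ind ω₀ ω ω')))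
        ≤⟨ ∑-mono (λ ω → ∑-mono (λ ω' → pt ω ω')) ⟩
      ∑ {Ω} (λ ω → ∑ {Ω} (λ ω' → N))
        ≡⟨ trans (∑-cong {Ω} (λ ω → ∑-const {Ω} N)) (∑-const {Ω} (N * N)) ⟩
      N * N * N ∎
      where
      open ≤-Reasoning
      pt : ∀ ω ω' → R₁ * ∑ (λ ω₀ → ind ω₀ ω ω') ≤ N
      pt ω ω' with T? (poor ω ω')
      ... | yes p = ≤-trans (*-monoʳ-≤ R₁ (≤-trans (∑-mono (λ ω₀ → 𝟙-mono (le ω₀))) (≤-reflexive (sym (#-def _)))))
                      (<⇒≤ (out (poor? ω ω') p))
        where
        le : ∀ ω₀ → T (G ω ω₀ ∧ (G ω' ω₀ ∧ poor ω ω')) → T (G ω ω₀ ∧ G ω' ω₀)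
        le ω₀ h = ∧-in (∧-l {G ω ω₀} h) (∧-l {G ω' ω₀} (∧-r {G ω ω₀} h))
      ... | no n = ≤-trans (≤-reflexive (trans (cong (R₁ *_) (trans (∑-cong zr) ∑-0)) (*-zeroʳ R₁))) z≤n
        where
        zr : ∀ ω₀ → ind ω₀ ω ω' ≡ 0
        zr ω₀ = 𝟙-no (λ h → n (∧-r {G ω' ω₀} (∧-r {G ω ω₀} h)))

    opaque
      -- One average over ω₀ serves two demands: the left sides add up to at most 2N³, hence to at
      -- most 2RN times the number of edges. Keeping only the first summand on the left yields the
      -- size of the neighbourhood, keeping only the second one bounds its poor pairs.
      pivot : ∃[ ω₀ ] N * N + R₁ * poors ω₀ ≤ 2 * (R * N) * # (λ ω → G ω ω₀)
      pivot = ∑-≤∃ 1≤T (begin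
        ∑ (λ ω₀ → N * N + R₁ * poors ω₀)          ≡⟨ ∑-+ (λ _ → N * N) (λ ω₀ → R₁ * poors ω₀) ⟩
        ∑ {Ω} (λ _ → N * N) + ∑ (λ ω₀ → R₁ * poors ω₀)  ≡⟨ cong₂ _+_ (∑-const {Ω} (N * N)) (∑-*ˡ R₁ poors) ⟩
        N * N * N + R₁ * ∑ poors                  ≤⟨ +-monoʳ-≤ (N * N * N) few-poor ⟩
        N * N * N + N * N * N                     ≡⟨ e₁ N ⟩
        2 * N * (N * N)                           ≤⟨ *-monoʳ-≤ (2 * N) dense ⟩
        2 * N * (R * ∑ (λ ω₀ → # (λ ω → G ω ω₀))) ≡⟨ e₂ N R _ ⟩
        2 * (R * N) * ∑ (λ ω₀ → # (λ ω → G ω ω₀)) ≡⟨ sym (∑-*ˡ (2 * (R * N)) _) ⟩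
        ∑ (λ ω₀ → 2 * (R * N) * # (λ ω → G ω ω₀)) ∎)
        where
        open ≤-Reasoning
        e₁ : ∀ n → n * n * n + n * n * n ≡ 2 * n * (n * n)
        e₁ = solve-∀
        e₂ : ∀ n r s → 2 * n * (r * s) ≡ 2 * (r * n) * s
        e₂ = solve-∀

    ω₀ : Ω
    ω₀ = proj₁ pivot

    W : Ω → Bool
    W ω = G ω ω₀

    w = # W

    N≤W : N ≤ 2 * R * w
    N≤W = *-cancelˡ N 1≤T (begin
      N * N                          ≤⟨ m≤m+n (N * N) _ ⟩
      N * N + R₁ * poors ω₀          ≤⟨ proj₂ pivot ⟩
      2 * (R * N) * w                ≡⟨ e N R w ⟩
      N * (2 * R * w)                ∎)
      where
      open ≤-Reasoning
      e : ∀ n r w → 2 * (r * n) * w ≡ n * (2 * r * w)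
      e = solve-∀

    1≤w : 1 ≤ w
    1≤w = n≢0⇒n>0 (λ e → <⇒≱ 1≤T (≤-trans N≤W (≤-reflexive (trans (cong (2 * R *_) e) (*-zeroʳ (2 * R))))))

    poors≤ : 16 * poors ω₀ ≤ w * w
    poors≤ = *-cancelˡ (4 * (R * R)) (*-pos {4} (s≤s z≤n) (*-pos 1≤R 1≤R)) (begin
      4 * (R * R) * (16 * poors ω₀)          ≤⟨ *-monoʳ-≤ (4 * (R * R)) (≤-trans (≤-reflexive (sym (*-identityˡ _))) (*-monoˡ-≤ (16 * poors ω₀) 1≤R)) ⟩
      4 * (R * R) * (R * (16 * poors ω₀))    ≡⟨ trans (e₁ R (poors ω₀)) (cong (_* poors ω₀) (sym (cube-def R))) ⟩
      R₁ * poors ω₀                          ≤⟨ m≤n+m _ (N * N) ⟩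
      N * N + R₁ * poors ω₀                  ≤⟨ proj₂ pivot ⟩
      2 * (R * N) * w                        ≤⟨ *-monoˡ-≤ w (*-monoʳ-≤ 2 (*-monoʳ-≤ R N≤W)) ⟩
      2 * (R * (2 * R * w)) * w              ≡⟨ e₂ R w ⟩
      4 * (R * R) * (w * w)                  ∎)
      where
      open ≤-Reasoning
      e₀ : ∀ a b r x → a * (r * r) * (r * (b * x)) ≡ a * b * (r * (r * r)) * x
      e₀ = solve-∀
      e₁ : ∀ r x → 4 * (r * r) * (r * (16 * x)) ≡ 64 * (r * (r * r)) * x
      e₁ = e₀ 4 16
      e₂ : ∀ r w → 2 * (r * (2 * r * w)) * w ≡ 4 * (r * r) * (w * w)
      e₂ = solve-∀

    pc : Ω → ℕ
    pc ω = # (λ ω' → W ω' ∧ poor ω ω')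

    ok : Ω → Bool
    ok ω = does (4 * pc ω ≤? w)

    -- As the poor pairs number at most w²/16, at most a quarter of W has more than w/4 poor
    -- partners. Two vertices of W' have at least w/2 vertices of W in common that are poor with
    -- neither.
    W' : Ω → Bool
    W' ω = W ω ∧ ok ω

    w≤2w' : w ≤ 2 * # W'
    w≤2w' = +-cancelʳ-≤ w w (2 * # W') (begin
      w + w                          ≡⟨ cong₂ _+_ (#-split W ok) (#-split W ok) ⟩
      (# W' + b) + (# W' + b)        ≡⟨ e₁ (# W') b ⟩
      2 * # W' + 2 * b               ≤⟨ +-monoʳ-≤ (2 * # W') (*-monoˡ-≤ b (m≤m+n 2 2)) ⟩
      2 * # W' + 4 * b               ≤⟨ +-monoʳ-≤ (2 * # W') 4b≤w ⟩
      2 * # W' + w                   ∎)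
      where
      open ≤-Reasoning
      bad : Ω → Bool
      bad ω = W ω ∧ not (ok ω)
      b = # bad
      e₁ : ∀ a b → (a + b) + (a + b) ≡ 2 * a + 2 * b
      e₁ = solve-∀
      pt : ∀ ω → 𝟙 (bad ω) * w ≤ 4 * ∑ (ind ω₀ ω)
      pt ω with T? (bad ω)
      ... | no n  = ≤-trans (≤-reflexive (cong (_* w) (𝟙-no n))) z≤n
      ... | yes h = begin
        𝟙 (bad ω) * w         ≡⟨ trans (cong (_* w) (𝟙-yes h)) (*-identityˡ w) ⟩
        w                     ≤⟨ <⇒≤ (≰⇒> (λ le → not-out (∧-r {W ω} h) (into (4 * pc ω ≤? w) le))) ⟩
        4 * pc ω              ≤⟨ *-monoʳ-≤ 4 (≤-trans (#-mono {F = λ ω' → W ω' ∧ poor ω ω'} {λ ω' → W ω ∧ (W ω' ∧ poor ω ω')} (λ ω' m → ∧-in (∧-l {W ω} h) m)) (≤-reflexive (#-def _))) ⟩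
        4 * ∑ (ind ω₀ ω)      ∎
      4b≤w : 4 * b ≤ w
      4b≤w = *-cancelˡ w 1≤w (begin
        w * (4 * b)                      ≡⟨ e₂ w b ⟩
        4 * (b * w)                      ≡⟨ cong (4 *_) (trans (cong (_* w) (#-def bad)) (sym (∑-*ʳ (𝟙 ∘ bad) w))) ⟩
        4 * ∑ (λ ω → 𝟙 (bad ω) * w)      ≤⟨ *-monoʳ-≤ 4 (∑-mono pt) ⟩
        4 * ∑ (λ ω → 4 * ∑ (ind ω₀ ω))   ≡⟨ cong (4 *_) (∑-*ˡ 4 (λ ω → ∑ (ind ω₀ ω))) ⟩
        4 * (4 * poors ω₀)               ≡⟨ sym (*-assoc 4 4 (poors ω₀)) ⟩
        16 * poors ω₀                    ≤⟨ poors≤ ⟩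
        w * w                            ∎)
        where
        e₂ : ∀ w b → w * (4 * b) ≡ 4 * (b * w)
        e₂ = solve-∀

    N≤W' : N ≤ 4 * R * # W'
    N≤W' = ≤-trans N≤W (≤-trans (*-monoʳ-≤ (2 * R) w≤2w') (≤-reflexive (e R (# W'))))
      where
      e : ∀ r x → 2 * r * (2 * x) ≡ 4 * r * x
      e = solve-∀

    Q : V → Bool
    Q = image s W'

    φ≤Q : φ ≤ # Q
    φ≤Q = many W' (≤-trans N≤W' (*-monoˡ-≤ (# W') (4R≤cube 1≤R)))

    Q≤S : # Q ≤ # S
    Q≤S = ≤-trans (#-mono {F = Q} {λ v → S (v ⊹ s ω₀)} pt) (≤-reflexive (#-shift S (s ω₀)))
      where
      pt : ∀ v → v ∈ Q → (v ⊹ s ω₀) ∈ S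
      pt v h with image-out s {W'} h
      ... | ω , hω , refl = edge ω ω₀ (∧-l {W ω} hω)

    -- The popular differences of S.
    D : V → Bool
    D d = does (φ ≤? # (λ y → S y ∧ S (y ⊝ d)))

    -- Each common neighbour ω₁ represents the difference as (s ω + s ω₁) - (s ω' + s ω₁). The
    -- common neighbours are dense, so by `many` they have at least φ different sums s ω₁.
    rich-D : ∀ ω ω' → ¬ T (poor ω ω') → (s ω ⊝ s ω') ∈ D
    rich-D ω ω' n = into (φ ≤? _) (begin
      φ                                              ≤⟨ many M (≮⇒≥ (λ lt → n (into (poor? ω ω') lt))) ⟩
      # (image s M)                                  ≤⟨ #-mono {F = image s M} {λ v → S (v ⊹ s ω) ∧ S ((v ⊹ s ω) ⊝ (s ω ⊝ s ω'))} pt ⟩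
      # (λ v → S (v ⊹ s ω) ∧ S ((v ⊹ s ω) ⊝ (s ω ⊝ s ω'))) ≡⟨ #-shift (λ y → S y ∧ S (y ⊝ (s ω ⊝ s ω'))) (s ω) ⟩
      # (λ y → S y ∧ S (y ⊝ (s ω ⊝ s ω')))           ∎)
      where
      open ≤-Reasoning
      M : Ω → Bool
      M ω₀ = G ω ω₀ ∧ G ω' ω₀
      pt : ∀ v → v ∈ image s M → T (S (v ⊹ s ω) ∧ S ((v ⊹ s ω) ⊝ (s ω ⊝ s ω')))
      pt v h with image-out s {M} h
      ... | ω₁ , hω , refl = ∧-in
        (subst (_∈ S) (comm (s ω) (s ω₁)) (edge ω ω₁ (∧-l {G ω ω₁} hω)))
        (subst (_∈ S) (trans (comm (s ω') (s ω₁)) (sym (⊹⊝⊝ (s ω₁) (s ω) (s ω')))) (edge ω' ω₁ (∧-r {G ω ω₁} hω)))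
        where open IsAbelianGroup isAG using (comm)

    partners : ∀ ω₁ ω₂ → ω₁ ∈ W' → ω₂ ∈ W' →
      φ ≤ # (λ d → D d ∧ D (d ⊝ (s ω₁ ⊝ s ω₂)))
    partners ω₁ ω₂ h₁ h₂ = begin
      φ                ≤⟨ many M dense-M ⟩
      # (image s M)    ≤⟨ #-mono {F = image s M} {λ v → D (s ω₁ ⊝ v) ∧ D ((s ω₁ ⊝ v) ⊝ (s ω₁ ⊝ s ω₂))} pt ⟩
      # (λ v → D (s ω₁ ⊝ v) ∧ D ((s ω₁ ⊝ v) ⊝ (s ω₁ ⊝ s ω₂)))  ≡⟨ #-reflect (λ d → D d ∧ D (d ⊝ (s ω₁ ⊝ s ω₂))) (s ω₁) ⟩
      # (λ d → D d ∧ D (d ⊝ (s ω₁ ⊝ s ω₂))) ∎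
      where
      open ≤-Reasoning
      P₁ P₂ M : Ω → Bool
      P₁ ω = W ω ∧ poor ω₁ ω
      P₂ ω = W ω ∧ poor ω₂ ω
      M ω = W ω ∧ (not (poor ω₁ ω) ∧ not (poor ω₂ ω))
      cover : w ≤ # M + (# P₁ + # P₂)
      cover = ≤-trans (#-mono {F = W} {λ ω → M ω ∨ (P₁ ω ∨ P₂ ω)} pt)
                (≤-trans (#-∪ M (λ ω → P₁ ω ∨ P₂ ω)) (+-monoʳ-≤ (# M) (#-∪ P₁ P₂)))
        where
        pt : ∀ ω → ω ∈ W → T (M ω ∨ (P₁ ω ∨ P₂ ω))
        pt ω h with T? (poor ω₁ ω) | T? (poor ω₂ ω)
        ... | yes p | _ = ∨-in-r {M ω} (∨-in-l (∧-in h p))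
        ... | no _ | yes p = ∨-in-r {M ω} (∨-in-r {P₁ ω} (∧-in h p))
        ... | no n₁ | no n₂ = ∨-in-l (∧-in h (∧-in (not-in n₁) (not-in n₂)))
      w≤2M : w ≤ 2 * # M
      w≤2M = *-cancelˡ 2 (s≤s z≤n) (+-cancelʳ-≤ (2 * w) (2 * w) (2 * (2 * # M)) (begin
        2 * w + 2 * w                         ≡⟨ e₁ w ⟩
        4 * w                                 ≤⟨ *-monoʳ-≤ 4 cover ⟩
        4 * (# M + (# P₁ + # P₂))             ≡⟨ e₂ (# M) (# P₁) (# P₂) ⟩
        2 * (2 * # M) + (4 * # P₁ + 4 * # P₂) ≤⟨ +-monoʳ-≤ (2 * (2 * # M)) (+-mono-≤ (out (4 * pc ω₁ ≤? w) (∧-r {W ω₁} h₁)) (out (4 * pc ω₂ ≤? w) (∧-r {W ω₂} h₂))) ⟩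
        2 * (2 * # M) + (w + w)               ≡⟨ e₃ (# M) w ⟩
        2 * (2 * # M) + 2 * w                 ∎))
        where
        e₁ : ∀ w → 2 * w + 2 * w ≡ 4 * w
        e₁ = solve-∀
        e₂ : ∀ a b c → 4 * (a + (b + c)) ≡ 2 * (2 * a) + (4 * b + 4 * c)
        e₂ = solve-∀
        e₃ : ∀ a w → 2 * (2 * a) + (w + w) ≡ 2 * (2 * a) + 2 * w
        e₃ = solve-∀
      dense-M : N ≤ cube R * # M
      dense-M = ≤-trans N≤W (≤-trans (*-monoʳ-≤ (2 * R) w≤2M)
        (≤-trans (≤-reflexive (e R (# M))) (*-monoˡ-≤ (# M) (4R≤cube 1≤R))))
        where
        e : ∀ r x → 2 * r * (2 * x) ≡ 4 * r * x
        e = solve-∀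
      pt : ∀ v → v ∈ image s M → T (D (s ω₁ ⊝ v) ∧ D ((s ω₁ ⊝ v) ⊝ (s ω₁ ⊝ s ω₂)))
      pt v h with image-out s {M} h
      ... | ω , hω , refl = ∧-in
        (rich-D ω₁ ω (not-out (∧-l {not (poor ω₁ ω)} (∧-r {W ω} hω))))
        (subst (_∈ D) (sym (⊝⊝⊝ (s ω₁) (s ω) (s ω₂))) (rich-D ω₂ ω (not-out (∧-r {not (poor ω₁ ω)} (∧-r {W ω} hω)))))

    -- An element of Q - Q is a difference of two popular differences in at least φ ways by
    -- `partners`, so |Q - Q| φ ≤ |D|². Likewise |D| φ ≤ |S|².
    differences : # (negate Q ⊞ Q) * (φ * (φ * φ)) ≤ (# S * # S) * (# S * # S)
    differences = begin
      # E * (φ * (φ * φ))                ≡⟨ sym (*-assoc (# E) φ (φ * φ)) ⟩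
      # E * φ * (φ * φ)                  ≤⟨ *-monoˡ-≤ (φ * φ) (reps D E φ E-rich) ⟩
      # D * # D * (φ * φ)                ≡⟨ e (# D) φ ⟩
      (# D * φ) * (# D * φ)              ≤⟨ *-mono-≤ D≤ D≤ ⟩
      (# S * # S) * (# S * # S)          ∎
      where
      open ≤-Reasoning
      open IsAbelianGroup isAG using (comm; identityˡ)
      E = negate Q ⊞ Q
      e : ∀ d f → d * d * (f * f) ≡ (d * f) * (d * f)
      e = solve-∀
      D≤ : # D * φ ≤ # S * # S
      D≤ = reps S D φ (λ d h → out (φ ≤? _) h)
      E-rich : ∀ x → x ∈ E → φ ≤ # (λ d → D d ∧ D (d ⊝ x))
      E-rich x h with ⊞-out {negate Q} {Q} h
      ... | a , b , ha , hb , refl with image-out s {W'} ha | image-out s {W'} hb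
      ...   | ω₂ , h₂ , e₂ | ω₁ , h₁ , e₁ = subst (λ x → φ ≤ # (λ d → D d ∧ D (d ⊝ x))) eq (partners ω₁ ω₂ h₁ h₂)
        where
        eq : s ω₁ ⊝ s ω₂ ≡ a ⊹ b
        eq = trans (cong₂ _⊝_ e₁ e₂) (trans (comm b (⊖ (𝟘 ⊝ a))) (cong (_⊹ b)
          (trans (⊖-⊝ 𝟘 a) (trans (cong (a ⊹_) AG.ε⁻¹≈ε) (trans (comm a 𝟘) (identityˡ a))))))

-- With g rounds to go, sums of L = `levelOf q g` terms are under control. In the round before, e =
-- 8qL + 1 makes the loss v^(4L/e) in Plünnecke's inequality at most v^(1/2q). Tuples of length 2^e
-- provide e scales, and one more term is the one that the sum determines.
levelOf expoOf : ℕ → ℕ → ℕ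
levelOf q zero    = 1
levelOf q (suc g) = suc (len (expoOf q g))
expoOf q g = suc (8 * q * levelOf q g)

-- The product of the density losses of the remaining rounds. In each of them the density `bnd` is
-- halved by passing to a fibre and then goes through `tower`.
needOf : ℕ → (ℕ → ℕ) → ℕ → ℕ
needOf q bnd zero    = 1
needOf q bnd (suc g) = tower (expoOf q g) (2 * bnd (len (expoOf q g))) * needOf q bnd g

-- Few long sums on a dense subsequence

module Structure (V : Set) {{enumV : Enum V}} (_⊹_ : V → V → V) (𝟘 : V) (⊖_ : V → V)
                 (isAG : IsAbelianGroup _≡_ _⊹_ 𝟘 ⊖_) where

  open Additive V _⊹_ 𝟘 ⊖_ isAG
  open Growth V _⊹_ 𝟘 ⊖_ isAG

  everything : 𝕏 → Bool
  everything _ = true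

  size≤everything : {{E : Enum 𝕏}} → size 𝕏 ≤ # {𝕏} everything
  size≤everything {𝕏} = ≤-reflexive (sym (#-def {𝕏} everything))

  allIn : ∀ {M} → (Fin M → Bool) → ∀ L → Vec (Fin M) L → Bool
  allIn F zero    []      = true
  allIn F (suc L) (i ∷ w) = F i ∧ allIn F L w

  multiple : ℕ → V → V
  multiple zero    t = 𝟘
  multiple (suc L) t = t ⊹ multiple L t

  1≤v : 1 ≤ size V
  1≤v = ≤-trans (#-pos {V} {F = everything} {𝟘} tt) (#-≤size {V} everything)

  tuples-pos : ∀ {M} k → 1 ≤ M → 1 ≤ size (Vec (Fin M) k)
  tuples-pos {M} k h = ≤-trans (^-pos k (≤-trans h (≤-reflexive (sym (size-Fin M))))) (≤-reflexive (sym (size-Vec k)))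

  span : ∀ {M} → (Fin M → V) → (Fin M → Bool) → ℕ → V → Bool
  span y F L = image (σ y) (allIn F L)

  module Sequence {M : ℕ} (y : Fin M → V) (1≤M : 1 ≤ M) where

    v = size V

    Tuple : ℕ → Set
    Tuple k = Vec (Fin M) k

    sums-of : ∀ {k} → (Tuple k → Bool) → V → Bool
    sums-of F = image (σ y) F

    in-sums : ∀ {Q : V → Bool} {F : Fin M → Bool} {t} → (∀ i → i ∈ F → (y i ⊹ t) ∈ Q) →
      ∀ L w → w ∈ allIn F L → (σ y w ⊹ multiple L t) ∈ᴸ sums Q L
    in-sums h zero    []      m = here (IsAbelianGroup.identityˡ isAG 𝟘)
    in-sums {Q} {F} {t} h (suc L) (i ∷ w) m = subst (_∈ᴸ sums Q (suc L)) (⊹-interchange (y i) t (σ y w) (multiple L t))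
      (∈ᴸ.∈-cartesianProductWith⁺ _⊹_ (∈ᴸ.∈-filter⁺ (∈? Q) (elem∈ (y i ⊹ t)) (h i (∧-l {F i} m)))
        (in-sums {Q} {F} h L w (∧-r {F i} m)))

    -- The terms with index in X lie in a translate of Q, so their L-fold sums lie in a translate of
    -- LQ. Plünnecke's inequality for -Q and Q bounds these in terms of |Q - Q|.
    span-bound : ∀ e (Q S : V → Bool) (X : Fin M → Bool) t φ → 1 ≤ φ → φ ≤ # Q → # Q ≤ # S →
      # (negate Q ⊞ Q) * (φ * (φ * φ)) ≤ (# S * # S) * (# S * # S) → # S ^ e ≤ v * φ ^ e →
      (∀ i → i ∈ X → (y i ⊹ t) ∈ Q) → ∀ L → # (span y X L) ^ e ≤ v ^ (4 * L) * # S ^ e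
    span-bound e Q S X t φ 1≤φ φ≤Q Q≤S differences le shifted L =
      ≤-trans (^-monoˡ-≤ e span≤) (power-bound L e 1≤φ φ≤Q Q≤S plün differences le)
      where
      W : V → Bool
      W = image (λ w → σ y w ⊹ multiple L t) (allIn X L)
      span≤ : # (span y X L) ≤ # W
      span≤ = ≤-trans (#-mono {F = span y X L} {λ v → W (v ⊹ multiple L t)} pt) (≤-reflexive (#-shift W (multiple L t)))
        where
        pt : ∀ v → v ∈ span y X L → (v ⊹ multiple L t) ∈ W
        pt v h with image-out (σ y) {allIn X L} h
        ... | w , hw , refl = image-in (λ w → σ y w ⊹ multiple L t) {allIn X L} hw
      W⊂ : ∀ v → v ∈ W → v ∈ᴸ sums Q L
      W⊂ v h with image-out (λ w → σ y w ⊹ multiple L t) {allIn X L} h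
      ... | w , hw , refl = in-sums {Q} {X} {t} shifted L w hw
      neg : # (negate Q) ≡ # Q
      neg = #-reflect Q 𝟘
      plün : # W * # Q ^ L ≤ # (negate Q ⊞ Q) ^ L * # Q
      plün = subst (λ z → # W * z ^ L ≤ # (negate Q ⊞ Q) ^ L * z) neg
               (plünnecke (negate Q) Q (≤-trans (≤-trans 1≤φ φ≤Q) (≤-reflexive (sym neg))) L W W⊂)

    -- φ is taken as the least number of sums over dense sets of tuples of half the length, so it
    -- bounds from below the sums of every dense set that arises in `Choice`. If F has at most
    -- v^(1/e) φ sums, `Choice` applies; otherwise the minimising F' has fewer sums than F by a
    -- factor of more than v^(1/e).
    step : ∀ e i R (F : Tuple (len (suc i)) → Bool) → 1 ≤ R → size (Tuple (len (suc i))) ≤ R * # F →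
      (∀ X → M ≤ 4 * R * # X → (∀ L → # (span y X L) ^ e ≤ v ^ (4 * L) * # (sums-of F) ^ e) → ⊥) →
      (∀ (F' : Tuple (len i) → Bool) → size (Tuple (len i)) ≤ cube R * # F' →
         v * # (sums-of F') ^ e < # (sums-of F) ^ e → ⊥) → ⊥
    step e i R F 1≤R dense found next =
      least P _ (everything , ≤-trans size≤everything (m≤n*m′ (cube-pos 1≤R)) , refl) λ where
        φ (F' , dF' , refl) min → decide F' dF' min (# S ^ e ≤? v * # (sums-of F') ^ e)
      where
      Ω = Tuple (len i)
      S = sums-of F
      m≤n*m′ : ∀ {n m} → 1 ≤ n → m ≤ n * m
      m≤n*m′ {n} {m} h = ≤-trans (≤-reflexive (sym (*-identityˡ m))) (*-monoˡ-≤ m h)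
      P : ℕ → Set
      P m = Σ (Ω → Bool) λ F' → size Ω ≤ cube R * # F' × # (sums-of F') ≡ m
      G : Ω → Ω → Bool
      G ω ω₀ = F (ω Vec.++ ω₀)
      dense' : size Ω * size Ω ≤ R * ∑ (λ ω₀ → # (λ ω → G ω ω₀))
      dense' = begin
        size Ω * size Ω                                  ≡⟨ cong₂ _*_ (size-Vec (len i)) (size-Vec (len i)) ⟩
        size (Fin M) ^ len i * size (Fin M) ^ len i      ≡⟨ sym (^-distribˡ-+-* (size (Fin M)) (len i) (len i)) ⟩
        size (Fin M) ^ len (suc i)                       ≡⟨ sym (size-Vec (len (suc i))) ⟩
        size (Tuple (len (suc i)))                       ≤⟨ dense ⟩
        R * # F                                          ≡⟨ cong (R *_) split ⟩
        R * ∑ (λ ω₀ → # (λ ω → G ω ω₀))                  ∎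
        where
        open ≤-Reasoning
        split : # F ≡ ∑ (λ ω₀ → # (λ ω → G ω ω₀))
        split = trans (#-def F) (trans (∑-vec++ (len i) (𝟙 ∘ F)) (trans (∑-swap (λ ω ω₀ → 𝟙 (G ω ω₀)))
          (∑-cong (λ ω₀ → sym (#-def (λ ω → G ω ω₀))))))
      edge : ∀ ω ω₀ → T (G ω ω₀) → (σ y ω ⊹ σ y ω₀) ∈ S
      edge ω ω₀ h = subst (_∈ S) (σ-++ y ω ω₀) (image-in (σ y) {F} h)
      decide : ∀ F' → size Ω ≤ cube R * # F' → (∀ k → P k → # (sums-of F') ≤ k) →
               Dec (# S ^ e ≤ v * # (sums-of F') ^ e) → ⊥
      decide F' dF' min (no n) = next F' dF' (≰⇒> n)
      decide F' dF' min (yes le) = found X big bound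
        where
        φ = # (sums-of F')
        many : ∀ (A : Ω → Bool) → size Ω ≤ cube R * # A → φ ≤ # (image (σ y) A)
        many A h = min _ (A , h , refl)
        1≤T = tuples-pos {M} (len i) 1≤M
        open Choice (σ y) G S R φ 1≤R 1≤T dense' edge many using (W'; Q; N≤W'; φ≤Q; Q≤S; differences)
        1≤φ : 1 ≤ φ
        1≤φ = image-pos (σ y) {F'} (n≢0⇒n>0 (λ z → <⇒≱ 1≤T (≤-trans dF' (≤-reflexive (trans (cong (cube R *_) z) (*-zeroʳ (cube R)))))))
        -- All coordinates but the first are fixed, in such a way that many first terms i remain;
        -- their y i then lie in Q after the shift by σ y ω'.
        tail : ∃[ ω' ] M ≤ 4 * R * # (λ i → W' (i ∷ ω'))
        tail = ∑-≤∃ {g = λ ω' → 4 * R * # (λ i → W' (i ∷ ω'))} (tuples-pos {M} (lenp i) 1≤M) (begin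
          ∑ {Tuple (lenp i)} (λ _ → M)             ≡⟨ ∑-const {Tuple (lenp i)} M ⟩
          M * size (Tuple (lenp i))                ≡⟨ cong₂ _*_ (sym (size-Fin M)) (size-Vec (lenp i)) ⟩
          size (Fin M) ^ len i                     ≡⟨ sym (size-Vec (len i)) ⟩
          size Ω                                   ≤⟨ N≤W' ⟩
          4 * R * # W'                             ≡⟨ cong (4 * R *_) (trans (#-def W') (trans (∑-∷ (𝟙 ∘ W')) (∑-swap (λ i ω' → 𝟙 (W' (i ∷ ω')))))) ⟩
          4 * R * ∑ (λ ω' → ∑ (λ i → 𝟙 (W' (i ∷ ω'))))  ≡⟨ cong (4 * R *_) (∑-cong (λ ω' → sym (#-def (λ i → W' (i ∷ ω'))))) ⟩
          4 * R * ∑ (λ ω' → # (λ i → W' (i ∷ ω')))      ≡⟨ sym (∑-*ˡ (4 * R) (λ ω' → # (λ i → W' (i ∷ ω')))) ⟩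
          ∑ (λ ω' → 4 * R * # (λ i → W' (i ∷ ω')))      ∎)
          where open ≤-Reasoning
        ω' = proj₁ tail
        X : Fin M → Bool
        X i = W' (i ∷ ω')
        big : M ≤ 4 * R * # X
        big = proj₂ tail
        bound : ∀ L → # (span y X L) ^ e ≤ v ^ (4 * L) * # S ^ e
        bound = span-bound e Q S X (σ y ω') φ 1≤φ φ≤Q Q≤S differences le (λ i m → image-in (σ y) {W'} m)

    Found : ℕ → ℕ → ℕ → Set
    Found e B R = ∀ X → M ≤ R * # X → (∀ L → # (span y X L) ^ e ≤ v ^ (4 * L) * B) → ⊥

    -- After a failures fewer than v^(1 - a/e) sums are left. At length 1 there have been e failures
    -- and less than one sum would be left, so one of the scales succeeds.
    descend : ∀ e B i a R (F : Tuple (len i) → Bool) → i + a ≡ e → 1 ≤ R → size (Tuple (len i)) ≤ R * # F →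
      # (sums-of F) ^ e * v ^ a < v ^ e → # (sums-of F) ^ e ≤ B → Found e B (tower i R) → ⊥
    descend e B zero    a R F refl 1≤R dense lt leB found =
      <⇒≱ lt (≤-trans (≤-reflexive (sym (*-identityˡ (v ^ e)))) (*-monoˡ-≤ (v ^ e) (^-pos e (image-pos (σ y) {F} 1≤F))))
      where
      1≤F : 1 ≤ # F
      1≤F = n≢0⇒n>0 (λ z → <⇒≱ (tuples-pos {M} 1 1≤M) (≤-trans dense (≤-reflexive (trans (cong (R *_) z) (*-zeroʳ R)))))
    descend e B (suc i) a R F eq 1≤R dense lt leB found = step e i R F 1≤R dense
      (λ X big bound → found X (≤-trans big (*-monoˡ-≤ (# X) (4R≤tower (suc i) 1≤R)))
        (λ L → ≤-trans (bound L) (*-monoʳ-≤ (v ^ (4 * L)) leB)))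
      (λ F' dF' small → descend e B i (suc a) (cube R) F' (trans (+-suc i a) eq) (cube-pos 1≤R) dF'
        (lt' F' small) (≤-trans (≤-trans (≤-trans (≤-reflexive (sym (*-identityˡ _))) (*-monoˡ-≤ (# (sums-of F') ^ e) 1≤v)) (<⇒≤ small)) leB) found)
      where
      lt' : ∀ F' → v * # (sums-of F') ^ e < # (sums-of F) ^ e → # (sums-of F') ^ e * v ^ suc a < v ^ e
      lt' F' small = begin-strict
        f' * (v * v ^ a)    ≡⟨ e₁ f' v (v ^ a) ⟩
        v * f' * v ^ a      ≤⟨ *-monoˡ-≤ (v ^ a) (<⇒≤ small) ⟩
        # (sums-of F) ^ e * v ^ a  <⟨ lt ⟩
        v ^ e ∎
        where
        open ≤-Reasoning
        f' = # (sums-of F') ^ e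
        e₁ : ∀ f v w → f * (v * w) ≡ v * f * w
        e₁ = solve-∀

    -- A Balog–Szemerédi–Gowers theorem for long sums in the spirit of Borenstein and Croot. Between two consecutive
    -- scales 2^i the minimal number of sums over dense sets of tuples grows by at most v^(1/e); apply Choice there.
    structured : ∀ e' R (F : Tuple (len (suc e')) → Bool) → 1 ≤ R → size (Tuple (len (suc e'))) ≤ R * # F →
      Found (suc e') (# (sums-of F) ^ suc e') (tower (suc e') R) → ⊥
    structured e' R F 1≤R dense found = step e e' R F 1≤R dense
      (λ X big bound → found X (≤-trans big (*-monoˡ-≤ (# X) (4R≤tower (suc e') 1≤R))) bound)
      (λ F' dF' small → descend e (# (sums-of F) ^ e) e' 1 (cube R) F' (+-comm e' 1) (cube-pos 1≤R) dF'
        (<-≤-trans (≤-<-trans (≤-reflexive (trans (cong (# (sums-of F') ^ e *_) (*-identityʳ v)) (*-comm _ v))) small)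
          (^-monoˡ-≤ e (#-≤size (sums-of F))))
        (≤-trans (≤-trans (≤-reflexive (sym (*-identityˡ _))) (*-monoˡ-≤ (# (sums-of F') ^ e) 1≤v)) (<⇒≤ small)) found)
      where e = suc e'

    Determined : ∀ {k} → (Tuple (suc k) → Bool) → Set
    Determined F = ∀ w w' → w ∈ F → w' ∈ F → σ y w ≡ σ y w' → Vec.head w ≡ Vec.head w'

    fibre : ∀ {k} → (Tuple (suc k) → Bool) → Fin M → Tuple k → Bool
    fibre F i w = F (i ∷ w)

    -- Since the first term is determined, the sums of the fibres, translated by their first terms,
    -- are disjoint subsets of the sums of F. An average fibre thus has M times fewer sums. A single
    -- average, over a quantity combining both demands, also keeps the fibre dense.
    link : ∀ {k} R (F : Tuple (suc k) → Bool) → size (Tuple (suc k)) ≤ R * # F → Determined F →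
      ∃[ i ] size (Tuple k) ≤ 2 * R * # (fibre F i) × M * # (sums-of (fibre F i)) ≤ 2 * R * # (sums-of F)
    link {k} R F dense det = i₀ , dense₀ , few₀
      where
      open ≤-Reasoning
      h = # (sums-of F)
      t = size (Tuple k)
      1≤t = tuples-pos {M} k 1≤M
      f g : Fin M → ℕ
      f i = # (fibre F i)
      g i = # (sums-of (fibre F i))
      size-suc : size (Tuple (suc k)) ≡ M * t
      size-suc = trans (size-Vec (suc k)) (cong₂ _*_ (size-Fin M) (sym (size-Vec k)))
      1≤F : 1 ≤ # F
      1≤F = n≢0⇒n>0 (λ z → <⇒≱ (tuples-pos {M} (suc k) 1≤M) (≤-trans dense (≤-reflexive (trans (cong (R *_) z) (*-zeroʳ R)))))
      1≤h : 1 ≤ h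
      1≤h = image-pos (σ y) {F} 1≤F
      g≤h : ∑ g ≤ h
      g≤h = begin
        ∑ g                                                      ≡⟨ ∑-cong (λ i → trans (sym (#-shift (sums-of (fibre F i)) (⊖ y i))) (#-def _)) ⟩
        ∑ (λ i → ∑ (λ v → 𝟙 (sums-of (fibre F i) (v ⊝ y i))))    ≡⟨ ∑-swap (λ i v → 𝟙 (sums-of (fibre F i) (v ⊝ y i))) ⟩
        ∑ (λ v → ∑ (λ i → 𝟙 (sums-of (fibre F i) (v ⊝ y i))))    ≤⟨ ∑-mono pt ⟩
        ∑ (λ v → 𝟙 (sums-of F v))                                ≡⟨ sym (#-def (sums-of F)) ⟩
        h ∎
        where
        witness : ∀ v i → (v ⊝ y i) ∈ sums-of (fibre F i) → ∃[ w ] (i ∷ w) ∈ F × σ y (i ∷ w) ≡ v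
        witness v i m with image-out (σ y) {fibre F i} m
        ... | w , hw , eq = w , hw , trans (cong (y i ⊹_) eq) (trans (IsAbelianGroup.comm isAG (y i) (v ⊝ y i)) (⊝⊹ v (y i)))
        pt : ∀ v → ∑ (λ i → 𝟙 (sums-of (fibre F i) (v ⊝ y i))) ≤ 𝟙 (sums-of F v)
        pt v with T? (sums-of F v)
        ... | yes m = ≤-trans (≤-reflexive (sym (#-def _))) (≤-trans (#-unique uniq) (≤-reflexive (sym (𝟙-yes m))))
          where
          uniq : ∀ i i' → (v ⊝ y i) ∈ sums-of (fibre F i) → (v ⊝ y i') ∈ sums-of (fibre F i') → i ≡ i'
          uniq i i' m m' with witness v i m | witness v i' m'
          ... | w , hw , eq | w' , hw' , eq' = det (i ∷ w) (i' ∷ w') hw hw' (trans eq (sym eq'))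
        ... | no n = ≤-trans (≤-reflexive (trans (∑-cong zr) ∑-0)) z≤n
          where
          zr : ∀ i → 𝟙 (sums-of (fibre F i) (v ⊝ y i)) ≡ 0
          zr i = 𝟙-no (λ m → let (w , hw , eq) = witness v i m in n (subst (_∈ sums-of F) eq (image-in (σ y) {F} hw)))
      pivot : ∃[ i ] h * t + M * t * g i ≤ 2 * R * h * f i
      pivot = ∑-≤∃ {f = λ i → h * t + M * t * g i} {λ i → 2 * R * h * f i} (≤-trans 1≤M (≤-reflexive (sym (size-Fin M)))) (begin
        ∑ (λ i → h * t + M * t * g i)                ≡⟨ ∑-+ (λ _ → h * t) (λ i → M * t * g i) ⟩
        ∑ {Fin M} (λ _ → h * t) + ∑ (λ i → M * t * g i)  ≡⟨ cong₂ _+_ (trans (∑-const {Fin M} (h * t)) (cong (h * t *_) (size-Fin M))) (∑-*ˡ (M * t) g) ⟩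
        h * t * M + M * t * ∑ g                      ≤⟨ +-monoʳ-≤ (h * t * M) (*-monoʳ-≤ (M * t) g≤h) ⟩
        h * t * M + M * t * h                        ≡⟨ e₁ h t M ⟩
        2 * h * (M * t)                              ≤⟨ *-monoʳ-≤ (2 * h) (≤-trans (≤-reflexive (sym size-suc)) dense) ⟩
        2 * h * (R * # F)                            ≡⟨ e₂ h R (# F) ⟩
        2 * R * h * # F                              ≡⟨ cong (2 * R * h *_) (#-∷ F) ⟩
        2 * R * h * ∑ f                              ≡⟨ sym (∑-*ˡ (2 * R * h) f) ⟩
        ∑ (λ i → 2 * R * h * f i)                    ∎)
        where
        e₁ : ∀ h t m → h * t * m + m * t * h ≡ 2 * h * (m * t)
        e₁ = solve-∀
        e₂ : ∀ h r f → 2 * h * (r * f) ≡ 2 * r * h * f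
        e₂ = solve-∀
      i₀ = proj₁ pivot
      dense₀ : t ≤ 2 * R * f i₀
      dense₀ = *-cancelˡ h 1≤h (≤-trans (m≤m+n (h * t) _) (≤-trans (proj₂ pivot) (≤-reflexive (e R h (f i₀)))))
        where
        e : ∀ r h f → 2 * r * h * f ≡ h * (2 * r * f)
        e = solve-∀
      few₀ : M * g i₀ ≤ 2 * R * h
      few₀ = *-cancelˡ t 1≤t (begin
        t * (M * g i₀)       ≡⟨ e t M (g i₀) ⟩
        M * t * g i₀         ≤⟨ m≤n+m _ (h * t) ⟩
        h * t + M * t * g i₀ ≤⟨ proj₂ pivot ⟩
        2 * R * h * f i₀     ≤⟨ *-monoʳ-≤ (2 * R * h) (#-≤size (fibre F i₀)) ⟩
        2 * R * h * t        ≡⟨ *-comm (2 * R * h) t ⟩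
        t * (2 * R * h)      ∎)
        where
        e : ∀ t m g → t * (m * g) ≡ m * t * g
        e = solve-∀

  all-everything : ∀ {M} L (w : Vec (Fin M) L) → w ∈ allIn everything L
  all-everything zero    []      = tt
  all-everything (suc L) (i ∷ w) = all-everything L w

  σ-∘ : ∀ {M M' k} (y : Fin M → V) (ι : Fin M' → Fin M) (w : Vec (Fin M') k) → σ (y ∘ ι) w ≡ σ y (Vec.map ι w)
  σ-∘ y ι []      = refl
  σ-∘ y ι (i ∷ w) = cong (y (ι i) ⊹_) (σ-∘ y ι w)

  spread : ∀ {M} → (Fin M → V) → ℕ → ℕ
  spread y L = # (span y everything L)

  sums≤spread : ∀ {M k} (y : Fin M → V) (F : Vec (Fin M) k → Bool) → # (image (σ y) F) ≤ spread y k
  sums≤spread {k = k} y F = #-mono {F = image (σ y) F} {span y everything k} pt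
    where
    pt : ∀ v → v ∈ image (σ y) F → v ∈ span y everything k
    pt v h with image-out (σ y) {F} h
    ... | w , _ , refl = image-in (σ y) {allIn everything k} (all-everything k w)

  spread-sub : ∀ {M M'} (y : Fin M → V) (ι : Fin M' → Fin M) (F : Fin M → Bool) → (∀ t → ι t ∈ F) →
    ∀ L → spread (y ∘ ι) L ≤ # (span y F L)
  spread-sub y ι F mem L = #-mono {F = span (y ∘ ι) everything L} {span y F L} pt
    where
    in-F : ∀ L w → Vec.map ι w ∈ allIn F L
    in-F zero    []      = tt
    in-F (suc L) (i ∷ w) = ∧-in (mem i) (in-F L w)
    pt : ∀ v → v ∈ span (y ∘ ι) everything L → v ∈ span y F L
    pt v h with image-out (σ (y ∘ ι)) {allIn everything L} h
    ... | w , _ , refl = subst (_∈ span y F L) (sym (σ-∘ y ι w)) (image-in (σ y) {allIn F L} (in-F L w))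

  -- The iteration over the rounds

  module Iterate (q : ℕ) (1≤q : 1 ≤ q) (2≤v : 2 ≤ size V)
    (NoZ : ∀ {M} → (Fin M → V) → Set)
    (sub : ∀ {M M'} (y : Fin M → V) (ι : Fin M' → Fin M) → (∀ s t → ι s ≡ ι t → s ≡ t) → NoZ y → NoZ (y ∘ ι))
    (bnd : ℕ → ℕ) (bnd-pos : ∀ k → 1 ≤ bnd k)
    (determined : ∀ k {M} (y : Fin M → V) (1≤M : 1 ≤ M) → bnd k ≤ M → NoZ y →
      ((F : Vec (Fin M) (suc k) → Bool) → size (Vec (Fin M) (suc k)) ≤ bnd k * # F →
       Sequence.Determined y 1≤M F → ⊥) → ⊥) where

    v = size V

    level = levelOf q
    expo  = expoOf q
    need  = needOf q bnd

    need-pos : ∀ g → 1 ≤ need g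
    need-pos zero    = ≤-refl
    need-pos (suc g) = *-pos (≤-trans (*-pos {4} (s≤s z≤n) 2b) (4R≤tower (expo g) 2b)) (need-pos g)
      where
      2b : 1 ≤ 2 * bnd (len (expo g))
      2b = *-pos {2} (s≤s z≤n) (bnd-pos (len (expo g)))

    2q = 2 * q

    -- With 2q more factors in the exponent, v^(4L) becomes v^(8qL), which is at most v^e. So an
    -- e-th root leaves a single factor v.
    root : ∀ L {x B} → x ^ suc (8 * q * L) ≤ v ^ (4 * L) * B ^ suc (8 * q * L) → x ^ 2q ≤ v * B ^ 2q
    root L {x} {B} h = ^-cancel-≤ (8 * q * L) (begin
      (x ^ 2q) ^ e                     ≡⟨ ^-flip x 2q e ⟩
      (x ^ e) ^ 2q                     ≤⟨ ^-monoˡ-≤ 2q h ⟩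
      (v ^ (4 * L) * B ^ e) ^ 2q       ≡⟨ *-^ 2q (v ^ (4 * L)) (B ^ e) ⟩
      (v ^ (4 * L)) ^ 2q * (B ^ e) ^ 2q  ≡⟨ cong₂ _*_ (trans (^-*-assoc v (4 * L) 2q) (cong (v ^_) (eq q L))) (^-flip B e 2q) ⟩
      v ^ (8 * q * L) * (B ^ 2q) ^ e   ≤⟨ *-monoˡ-≤ ((B ^ 2q) ^ e) (^-monoʳ-≤ v {{>-nonZero 1≤v}} (n≤1+n (8 * q * L))) ⟩
      v ^ e * (B ^ 2q) ^ e             ≡⟨ sym (*-^ e v (B ^ 2q)) ⟩
      (v * B ^ 2q) ^ e                 ∎)
      where
      open ≤-Reasoning
      e = suc (8 * q * L)
      eq : ∀ q L → 4 * L * (2 * q) ≡ 8 * q * L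
      eq = solve-∀

    -- The gain M / r is at least v^(1/q), hence at least v² in the power 2q. One of these two
    -- factors v pays for the factor v in the bound for x.
    drop : ∀ {x B M r h} → 1 ≤ r → x ^ 2q ≤ v * B ^ 2q → M * B ≤ r * h → r ^ q * v ≤ M ^ q → x ^ 2q * v ≤ h ^ 2q
    drop {x} {B} {M} {r} {h} 1≤r h₁ h₂ h₃ = *-cancelˡ (v * r ^ 2q) (*-pos 1≤v (^-pos 2q 1≤r)) (begin
      v * r ^ 2q * (x ^ 2q * v)            ≡⟨ e₁ v (r ^ 2q) (x ^ 2q) ⟩
      x ^ 2q * (r ^ 2q * (v * v))          ≤⟨ *-monoʳ-≤ (x ^ 2q) sq ⟩
      x ^ 2q * M ^ 2q                      ≤⟨ *-monoˡ-≤ (M ^ 2q) h₁ ⟩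
      v * B ^ 2q * M ^ 2q                  ≡⟨ trans (*-assoc v (B ^ 2q) (M ^ 2q)) (cong (v *_) (trans (*-comm (B ^ 2q) (M ^ 2q)) (sym (*-^ 2q M B)))) ⟩
      v * (M * B) ^ 2q                     ≤⟨ *-monoʳ-≤ v (^-monoˡ-≤ 2q h₂) ⟩
      v * (r * h) ^ 2q                     ≡⟨ trans (cong (v *_) (*-^ 2q r h)) (sym (*-assoc v (r ^ 2q) (h ^ 2q))) ⟩
      v * r ^ 2q * h ^ 2q                  ∎)
      where
      open ≤-Reasoning
      e₁ : ∀ v r x → v * r * (x * v) ≡ x * (r * (v * v))
      e₁ = solve-∀
      e₂ : ∀ r v → r * r * (v * v) ≡ (r * v) * (r * v)
      e₂ = solve-∀
      dbl : ∀ a → a ^ 2q ≡ a ^ q * a ^ q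
      dbl a = trans (cong (λ k → a ^ (q + k)) (+-identityʳ q)) (^-distribˡ-+-* a q q)
      sq : r ^ 2q * (v * v) ≤ M ^ 2q
      sq = begin
        r ^ 2q * (v * v)                 ≡⟨ cong (_* (v * v)) (dbl r) ⟩
        r ^ q * r ^ q * (v * v)          ≡⟨ e₂ (r ^ q) v ⟩
        (r ^ q * v) * (r ^ q * v)        ≤⟨ *-mono-≤ h₃ h₃ ⟩
        M ^ q * M ^ q                    ≡⟨ sym (dbl M) ⟩
        M ^ 2q                           ∎

    ^q-cancel : ∀ {a b} → a ^ q ≤ b ^ q → a ≤ b
    ^q-cancel = ^-root q 1≤q

    nonempty : ∀ g {M} → need g ^ q * v ≤ M ^ q → 1 ≤ M
    nonempty g big = ^q-cancel (≤-trans (≤-reflexive (^-zeroˡ q)) (≤-trans (*-pos (^-pos q (need-pos g)) 1≤v) big))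

    stop : ∀ a {M} (y : Fin M → V) → 1 ≤ M → a ≡ suc 2q → spread y 1 ^ 2q * v ^ a ≤ v ^ 2q → ⊥
    stop a {M} y 1≤M eq small = <⇒≱ 2≤v (*-cancelˡ (v ^ 2q) (^-pos 2q 1≤v) (begin
      v ^ 2q * v                       ≡⟨ *-comm (v ^ 2q) v ⟩
      v ^ suc 2q                       ≡⟨ cong (v ^_) (sym eq) ⟩
      v ^ a                            ≡⟨ sym (*-identityˡ (v ^ a)) ⟩
      1 * v ^ a                        ≤⟨ *-monoˡ-≤ (v ^ a) (^-pos 2q 1≤spread) ⟩
      spread y 1 ^ 2q * v ^ a          ≤⟨ small ⟩
      v ^ 2q                           ≡⟨ sym (*-identityʳ (v ^ 2q)) ⟩
      v ^ 2q * 1                       ∎))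
      where
      open ≤-Reasoning
      1≤spread : 1 ≤ spread y 1
      1≤spread = image-pos (σ y) (#-pos {F = allIn everything 1} {Fin.fromℕ< 1≤M ∷ []} tt)

    -- `link` yields a fibre with few sums, `struct` bounds by them the L-fold sums of a dense set
    -- F' of terms, and `drop` balances gain and loss. The sequence is thinned to F', whose density
    -- 1 / tw is covered by the factor tw in the assumed length.
    round : ∀ L N a e′ k R tw {M} (y : Fin M → V) (1≤M : 1 ≤ M) → NoZ y → 1 ≤ N → 1 ≤ R →
      2 * R ≤ tw → (tw * N) ^ q * v ≤ M ^ q → spread y (suc k) ^ 2q * v ^ a ≤ v ^ 2q →
      (∀ {x B} → x ^ suc e′ ≤ v ^ (4 * L) * B ^ suc e′ → x ^ 2q ≤ v * B ^ 2q) →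
      (∀ (F : Vec (Fin M) k → Bool) → size (Vec (Fin M) k) ≤ 2 * R * # F →
        Sequence.Found y 1≤M (suc e′) (# (image (σ y) F) ^ suc e′) tw → ⊥) →
      (∀ {M'} (y' : Fin M' → V) → NoZ y' → N ^ q * v ≤ M' ^ q → spread y' L ^ 2q * v ^ suc a ≤ v ^ 2q → ⊥) →
      (F : Vec (Fin M) (suc k) → Bool) → size (Vec (Fin M) (suc k)) ≤ R * # F → Sequence.Determined y 1≤M F → ⊥
    round L N a e′ k R tw {M} y 1≤M nz 1≤N 1≤R r≤tw big small rt struct next F dense det =
      linked (link R F dense det)
      where
      open ≤-Reasoning
      open Sequence y 1≤M using (link; fibre)
      r = 2 * R
      1≤r : 1 ≤ r
      1≤r = *-pos {2} (s≤s z≤n) 1≤R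
      r^v : r ^ q * v ≤ M ^ q
      r^v = ≤-trans (*-monoˡ-≤ v (^-monoˡ-≤ q (≤-trans r≤tw
        (≤-trans (≤-reflexive (sym (*-identityʳ tw))) (*-monoʳ-≤ tw 1≤N))))) big
      linked : (∃[ i ] size (Vec (Fin M) k) ≤ r * # (fibre F i) ×
                 M * # (image (σ y) (fibre F i)) ≤ r * # (image (σ y) F)) → ⊥
      linked (i , dense' , few) = struct (fibre F i) dense' found
        where
        found : ∀ F' → M ≤ tw * # F' →
          (∀ L → # (span y F' L) ^ suc e′ ≤ v ^ (4 * L) * # (image (σ y) (fibre F i)) ^ suc e′) → ⊥
        found F' bigF bound = sub-case (pick F' ≤-refl)
          where
          big' : N ^ q * v ≤ # F' ^ q
          big' = *-cancelˡ (tw ^ q) (^-pos q (≤-trans 1≤r r≤tw)) (begin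
            tw ^ q * (N ^ q * v)          ≡⟨ trans (sym (*-assoc (tw ^ q) (N ^ q) v)) (cong (_* v) (sym (*-^ q tw N))) ⟩
            (tw * N) ^ q * v              ≤⟨ big ⟩
            M ^ q                         ≤⟨ ^-monoˡ-≤ q bigF ⟩
            (tw * # F') ^ q               ≡⟨ *-^ q tw (# F') ⟩
            tw ^ q * # F' ^ q             ∎)
          h = spread y (suc k)
          sub-case : (Σ (Fin (# F') → Fin M) λ ι → (∀ s t → ι s ≡ ι t → s ≡ t) × (∀ t → ι t ∈ F')) → ⊥
          sub-case (ι , inj , mem) = next (y ∘ ι) (sub y ι inj nz) big' (begin
            x ^ 2q * (v * v ^ a)    ≡⟨ sym (*-assoc (x ^ 2q) v (v ^ a)) ⟩
            x ^ 2q * v * v ^ a      ≤⟨ *-monoˡ-≤ (v ^ a) x^2q ⟩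
            h ^ 2q * v ^ a          ≤⟨ small ⟩
            v ^ 2q                  ∎)
            where
            x = spread (y ∘ ι) L
            x^2q : x ^ 2q * v ≤ h ^ 2q
            x^2q = drop {x} {# (image (σ y) (fibre F i))} {M} {r} {h} 1≤r
              (≤-trans (^-monoˡ-≤ 2q (spread-sub y ι F' mem L)) (rt (bound L)))
              (≤-trans few (*-monoʳ-≤ r (sums≤spread y F))) r^v

    bnd≤M : ∀ R tw N {M} → 2 * R ≤ tw → 1 ≤ N → (tw * N) ^ q * v ≤ M ^ q → R ≤ M
    bnd≤M R tw N {M} r≤tw 1≤N big = ^q-cancel (begin
      R ^ q               ≤⟨ ^-monoˡ-≤ q (≤-trans (m≤n*m R 2) r≤tw) ⟩
      tw ^ q              ≤⟨ ^-monoˡ-≤ q (≤-trans (≤-reflexive (sym (*-identityʳ tw))) (*-monoʳ-≤ tw 1≤N)) ⟩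
      (tw * N) ^ q        ≡⟨ sym (*-identityʳ ((tw * N) ^ q)) ⟩
      (tw * N) ^ q * 1    ≤⟨ *-monoʳ-≤ ((tw * N) ^ q) 1≤v ⟩
      (tw * N) ^ q * v    ≤⟨ big ⟩
      M ^ q               ∎)
      where open ≤-Reasoning

    advance : ∀ L N a {M} (y : Fin M → V) (1≤M : 1 ≤ M) → NoZ y → 1 ≤ N →
      (tower (suc (8 * q * L)) (2 * bnd (len (suc (8 * q * L)))) * N) ^ q * v ≤ M ^ q →
      spread y (suc (len (suc (8 * q * L)))) ^ 2q * v ^ a ≤ v ^ 2q →
      (∀ {M'} (y' : Fin M' → V) → NoZ y' → N ^ q * v ≤ M' ^ q → spread y' L ^ 2q * v ^ suc a ≤ v ^ 2q → ⊥) → ⊥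
    advance L N a {M} y 1≤M nz 1≤N big small next = determined k y 1≤M (bnd≤M R tw N r≤tw 1≤N big) nz
      (round L N a (8 * q * L) k R tw y 1≤M nz 1≤N (bnd-pos k) r≤tw big small (λ {x} {B} → root L {x} {B})
        (λ F dense → Sequence.structured y 1≤M (8 * q * L) r F 1≤r dense) next)
      where
      k = len (suc (8 * q * L))
      R = bnd k
      r = 2 * R
      tw = tower (suc (8 * q * L)) r
      1≤r : 1 ≤ r
      1≤r = *-pos {2} (s≤s z≤n) (bnd-pos k)
      r≤tw : r ≤ tw
      r≤tw = ≤-trans (m≤n*m r 4) (4R≤tower (suc (8 * q * L)) 1≤r)

    -- The potential: in round a the number of sums of level g terms is at most v^(1 − a/2q).
    iterate : ∀ g a {M} (y : Fin M → V) → NoZ y → a + g ≡ suc 2q → need g ^ q * v ≤ M ^ q →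
      spread y (level g) ^ 2q * v ^ a ≤ v ^ 2q → ⊥
    iterate zero    a y nz eq big small = stop a y (nonempty 0 big) (trans (sym (+-identityʳ a)) eq) small
    iterate (suc g) a y nz eq big small = advance (level g) (need g) a y (nonempty (suc g) big) nz (need-pos g) big small
      (λ y' nz' big' small' → iterate g (suc a) y' nz' (trans (sym (+-suc a g)) eq) big' small')

    sequence-bound : ∀ {M} (y : Fin M → V) → NoZ y → need (suc 2q) ^ q * v ≤ M ^ q → ⊥
    sequence-bound y nz big = iterate (suc 2q) 0 y nz refl big
      (≤-trans (≤-reflexive (*-identityʳ _)) (^-monoˡ-≤ 2q (#-≤size (span y everything (level (suc 2q))))))

-- Random samples and the distinct values of a choice of indices

module _ {{E : Enum 𝕏}} where

  ∑-insert : ∀ {k} (t : Fin (suc k)) (g : Vec 𝕏 (suc k) → ℕ) →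
    ∑ g ≡ ∑ (λ i → ∑ (λ w → g (Vec.insertAt w t i)))
  ∑-insert zero g = ∑-∷ g
  ∑-insert {suc k} (suc t) g = begin
    ∑ g                                                            ≡⟨ ∑-∷ g ⟩
    ∑ (λ x → ∑ (λ v → g (x ∷ v)))                                  ≡⟨ ∑-cong (λ x → ∑-insert t (λ v → g (x ∷ v))) ⟩
    ∑ (λ x → ∑ (λ i → ∑ (λ w → g (x ∷ Vec.insertAt w t i))))         ≡⟨ ∑-swap (λ x i → ∑ (λ w → g (x ∷ Vec.insertAt w t i))) ⟩
    ∑ (λ i → ∑ (λ x → ∑ (λ w → g (x ∷ Vec.insertAt w t i))))         ≡⟨ ∑-cong (λ i → sym (∑-∷ (λ w → g (Vec.insertAt w (suc t) i)))) ⟩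
    ∑ (λ i → ∑ (λ w → g (Vec.insertAt w (suc t) i)))                 ∎
    where open ≡-Reasoning

  restrict : ∀ {l K} → Vec 𝕏 l → (Fin K → Fin l) → Vec 𝕏 K
  restrict u α = Vec.tabulate (λ t → Vec.lookup u (α t))

  -- Different entries of a uniform random l-tuple are independent and uniform; `∑-insert` splits
  -- off the positions of α one at a time.
  ∑-restrict : ∀ {l} K (α : Fin K → Fin l) → (∀ s t → α s ≡ α t → s ≡ t) → (g : Vec 𝕏 K → ℕ) →
    size 𝕏 ^ K * ∑ (λ (u : Vec 𝕏 l) → g (restrict u α)) ≡ size 𝕏 ^ l * ∑ g
  ∑-restrict {l} zero α inj g = begin
    1 * ∑ (λ (u : Vec 𝕏 l) → g [])       ≡⟨ *-identityˡ _ ⟩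
    ∑ (λ (u : Vec 𝕏 l) → g [])           ≡⟨ ∑-const {Vec 𝕏 l} (g []) ⟩
    g [] * size (Vec 𝕏 l)                ≡⟨ *-comm (g []) _ ⟩
    size (Vec 𝕏 l) * g []                ≡⟨ cong₂ _*_ (size-Vec l) (sym (∑-[] g)) ⟩
    size 𝕏 ^ l * ∑ g                     ∎
    where open ≡-Reasoning
  ∑-restrict {zero} (suc K) α inj g = ⊥-elim (Fin.¬Fin0 (α zero))
  ∑-restrict {suc l} (suc K) α inj g = begin
    (n * n ^ K) * ∑ (λ (u : Vec 𝕏 (suc l)) → g (restrict u α))
      ≡⟨ cong ((n * n ^ K) *_) (trans (∑-insert (α zero) (λ u → g (restrict u α))) (∑-cong (λ i → ∑-cong (λ u → cong g (eq i u))))) ⟩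
    (n * n ^ K) * ∑ (λ i → ∑ (λ (u : Vec 𝕏 l) → g (i ∷ restrict u β)))
      ≡⟨ *-assoc n (n ^ K) _ ⟩
    n * (n ^ K * ∑ (λ i → ∑ (λ (u : Vec 𝕏 l) → g (i ∷ restrict u β))))
      ≡⟨ cong (n *_) (sym (∑-*ˡ (n ^ K) (λ i → ∑ (λ (u : Vec 𝕏 l) → g (i ∷ restrict u β))))) ⟩
    n * ∑ (λ i → n ^ K * ∑ (λ (u : Vec 𝕏 l) → g (i ∷ restrict u β)))
      ≡⟨ cong (n *_) (∑-cong (λ i → ∑-restrict K β β-inj (λ w → g (i ∷ w)))) ⟩
    n * ∑ (λ i → n ^ l * ∑ (λ w → g (i ∷ w)))
      ≡⟨ cong (n *_) (trans (∑-*ˡ (n ^ l) (λ i → ∑ (λ w → g (i ∷ w)))) (cong (n ^ l *_) (sym (∑-∷ g)))) ⟩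
    n * (n ^ l * ∑ g)
      ≡⟨ sym (*-assoc n (n ^ l) (∑ g)) ⟩
    n ^ suc l * ∑ g ∎
    where
    open ≡-Reasoning
    n = size 𝕏
    ne : ∀ t → α zero ≢ α (suc t)
    ne t e with inj zero (suc t) e
    ... | ()
    β : Fin K → Fin l
    β t = Fin.punchOut (ne t)
    β-inj : ∀ s t → β s ≡ β t → s ≡ t
    β-inj s t e = Fin.suc-injective (inj (suc s) (suc t) (Fin.punchOut-injective (ne s) (ne t) e))
    eq : ∀ i (u : Vec 𝕏 l) → restrict (Vec.insertAt u (α zero) i) α ≡ i ∷ restrict u β
    eq i u = cong₂ _∷_ (Vec.insertAt-lookup u (α zero) i)
      (Vec.tabulate-cong (λ t → trans (cong (Vec.lookup (Vec.insertAt u (α zero) i)) (sym (Fin.punchIn-punchOut (ne t))))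
        (Vec.insertAt-punchIn u (α zero) i (β t))))

Injective : ∀ {k l} → (Fin k → Fin l) → Set
Injective α = ∀ s t → α s ≡ α t → s ≡ t

injective? : ∀ {k l} (α : Fin k → Fin l) → Dec (Injective α)
injective? α = map′ (λ h s t e → impl (h s t) e) (λ h s t → back (h s t))
                 (all? (λ s → all? (λ t → ¬? (α s ≟ α t) ⊎-dec (s ≟ t))))
  where
  impl : ∀ {A B : Set} → ¬ A ⊎ B → A → B
  impl (inj₁ n) a = ⊥-elim (n a)
  impl (inj₂ b) a = b
  back : ∀ {s t} → (α s ≡ α t → s ≡ t) → ¬ (α s ≡ α t) ⊎ (s ≡ t)
  back {s} {t} h with α s ≟ α t
  ... | yes e = inj₂ (h e)
  ... | no n  = inj₁ n

-- The union bound over the at most l^K injective α: for a random u each restriction is a uniform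
-- K-tuple and lies in P with probability `# P` / m^K.
avoid : ∀ {m l K} (P : Vec (Fin m) K → Bool) → 1 ≤ m → l ^ K * # P < m ^ K →
  ∃[ u ] (∀ (α : Fin K → Fin l) → Injective α → restrict u α ∉ P)
avoid {m} {l} {K} P 1≤m sparse with ∑-< {f = hits} {λ _ → 1} lt
  where
  inj-at : Vec (Fin l) K → Bool
  inj-at α = does (injective? (Vec.lookup α))
  f : Vec (Fin m) l → Vec (Fin l) K → ℕ
  f u α = 𝟙 (inj-at α ∧ P (restrict u (Vec.lookup α)))
  hits : Vec (Fin m) l → ℕ
  hits u = ∑ (f u)
  lt : ∑ hits < size (Vec (Fin m) l)
  lt = *-cancelˡ-< (m ^ K) _ _ (begin-strict
    m ^ K * ∑ hits                             ≡⟨ cong (m ^ K *_) (∑-swap f) ⟩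
    m ^ K * ∑ (λ α → ∑ (λ u → f u α))          ≡⟨ sym (∑-*ˡ (m ^ K) (λ α → ∑ (λ u → f u α))) ⟩
    ∑ (λ α → m ^ K * ∑ (λ u → f u α))          ≤⟨ ∑-mono pt ⟩
    ∑ {Vec (Fin l) K} (λ _ → m ^ l * # P)      ≡⟨ trans (∑-const {Vec (Fin l) K} (m ^ l * # P)) (cong (m ^ l * # P *_) (trans (size-Vec K) (cong (_^ K) (size-Fin l)))) ⟩
    m ^ l * # P * l ^ K                        ≡⟨ e (m ^ l) (# P) (l ^ K) ⟩
    m ^ l * (l ^ K * # P)                      <⟨ *-monoʳ-< (m ^ l) {{>-nonZero (^-pos l 1≤m)}} sparse ⟩
    m ^ l * m ^ K                              ≡⟨ trans (*-comm (m ^ l) (m ^ K)) (cong (m ^ K *_) (sym (trans (size-Vec l) (cong (_^ l) (size-Fin m))))) ⟩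
    m ^ K * size (Vec (Fin m) l)               ∎)
    where
    open ≤-Reasoning
    e : ∀ a b c → a * b * c ≡ a * (c * b)
    e = solve-∀
    pt : ∀ α → m ^ K * ∑ (λ u → f u α) ≤ m ^ l * # P
    pt α with T? (inj-at α)
    ... | yes i = ≤-trans (*-monoʳ-≤ (m ^ K) (∑-mono (λ u → 𝟙-mono (∧-r {inj-at α}))))
          (≤-reflexive (subst₂ (λ a b → a ^ K * ∑ (λ u → 𝟙 (P (restrict u (Vec.lookup α)))) ≡ a ^ l * b) (size-Fin m) (sym (#-def P))
            (∑-restrict K (Vec.lookup α) (out (injective? (Vec.lookup α)) i) (𝟙 ∘ P))))
    ... | no n = ≤-trans (≤-reflexive (trans (cong (m ^ K *_) (trans (∑-cong (λ u → 𝟙-no (λ h → n (∧-l {inj-at α} h)))) ∑-0)) (*-zeroʳ (m ^ K)))) z≤n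
... | u , 0hits = u , good
  where
  good : ∀ (α : Fin K → Fin l) → Injective α → restrict u α ∉ P
  good α inj h = n≮0 (subst (0 <_) z (≤-trans (≤-reflexive (sym (𝟙-yes mem))) (∑-≥ F α')))
    where
    α' = Vec.tabulate α
    F : Vec (Fin l) K → ℕ
    F α = 𝟙 (does (injective? (Vec.lookup α)) ∧ P (restrict u (Vec.lookup α)))
    z : ∑ F ≡ 0
    z = n≤0⇒n≡0 (s≤s⁻¹ 0hits)
    mem : T (does (injective? (Vec.lookup α')) ∧ P (restrict u (Vec.lookup α')))
    mem = ∧-in (into (injective? (Vec.lookup α')) (λ s t e → inj s t (trans (sym (Vec.lookup∘tabulate α s)) (trans e (Vec.lookup∘tabulate α t)))))
      (subst (_∈ P) (Vec.tabulate-cong (λ t → cong (Vec.lookup u) (sym (Vec.lookup∘tabulate α t)))) h)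

-- The new value takes the second place, so that the head remains the value at colour j₁.
push : ∀ {k} {A : Set} → (Fin (suc k) → A) → A → Fin (suc (suc k)) → A
push α x zero          = α zero
push α x (suc zero)    = x
push α x (suc (suc t)) = α (suc t)

push-inj : ∀ {k l} (α : Fin (suc k) → Fin l) x → Injective α → (∀ t → α t ≢ x) → Injective (push α x)
push-inj α x inj ne zero          zero          e = refl
push-inj α x inj ne zero          (suc zero)    e = ⊥-elim (ne zero e)
push-inj α x inj ne zero          (suc (suc t)) e with inj zero (suc t) e
... | ()
push-inj α x inj ne (suc zero)    zero          e = ⊥-elim (ne zero (sym e))
push-inj α x inj ne (suc zero)    (suc zero)    e = refl
push-inj α x inj ne (suc zero)    (suc (suc t)) e = ⊥-elim (ne (suc t) (sym e))
push-inj α x inj ne (suc (suc s)) zero          e with inj (suc s) zero e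
... | ()
push-inj α x inj ne (suc (suc s)) (suc zero)    e = ⊥-elim (ne (suc s) e)
push-inj α x inj ne (suc (suc s)) (suc (suc t)) e with inj (suc s) (suc t) e
... | refl = refl

keep : ∀ {k} → Fin (suc k) → Fin (suc (suc k))
keep zero    = zero
keep (suc t) = suc (suc t)

push-keep : ∀ {k} {A : Set} (α : Fin (suc k) → A) x t → push α x (keep t) ≡ α t
push-keep α x zero    = refl
push-keep α x (suc t) = refl

-- K different indices adapted to a: either a takes all its values among them, or they are
-- themselves values of a, the first one at j₁. These are the two forms in which a generic sample
-- can be contradicted.
Values : ∀ {P l} → (Fin P → Fin l) → Fin P → ∀ k → Set
Values {P} {l} a j₁ k = Σ (Fin (suc k) → Fin l) λ α → Injective α ×
  ((Σ (Fin P → Fin (suc k)) λ φ → ∀ j → a j ≡ α (φ j)) ⊎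
   (Σ (Fin (suc k) → Fin P) λ c → c zero ≡ j₁ × (∀ t → α t ≡ a (c t))))

fresh : ∀ {k l} (α : Fin k → Fin l) → suc k ≤ l → ∃[ x ] ∀ t → α t ≢ x
fresh {k} {l} α le with any? (λ x → ¬? (any? (λ t → α t ≟ x)))
... | yes (x , n) = x , λ t e → n (t , e)
... | no ¬r = clash (Fin.pigeonhole le (λ x → proj₁ (pre x)))
  where
  pre : ∀ x → ∃[ t ] α t ≡ x
  pre x = decidable-stable (any? (λ t → α t ≟ x)) (λ n → ¬r (x , n))
  clash : (∃[ i ] ∃[ i' ] i Fin.< i' × proj₁ (pre i) ≡ proj₁ (pre i')) → ∃[ x ] ∀ t → α t ≢ x
  clash (i , i' , i<i' , e) = ⊥-elim (Fin.<⇒≢ i<i' (trans (sym (proj₂ (pre i))) (trans (cong α e) (proj₂ (pre i')))))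

values : ∀ {P l} (a : Fin P → Fin l) j₁ k → suc k ≤ l → Values a j₁ k
values a j₁ zero    le = (λ _ → a j₁) , (λ { zero zero _ → refl }) , inj₂ ((λ _ → j₁) , refl , λ _ → refl)
values {P} {l} a j₁ (suc k) le = go (values a j₁ k (<⇒≤ le))
  where
  extend : ∀ (α : Fin (suc k) → Fin l) → Injective α → (φ : Fin P → Fin (suc k)) → (∀ j → a j ≡ α (φ j)) →
    Values a j₁ (suc k)
  extend α inj φ fac with fresh α le
  ... | x , nx = push α x , push-inj α x inj nx , inj₁ (keep ∘ φ , λ j → trans (fac j) (sym (push-keep α x (φ j))))
  go : Values a j₁ k → Values a j₁ (suc k)
  go (α , inj , inj₁ (φ , fac)) = extend α inj φ fac
  go (α , inj , inj₂ (c , c0 , ac)) with any? (λ j → ¬? (any? (λ t → α t ≟ a j)))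
  ... | yes (j , new) = push α (a j) , push-inj α (a j) inj (λ t e → new (t , e)) ,
      inj₂ (push c j , c0 , λ { zero → ac zero ; (suc zero) → refl ; (suc (suc t)) → ac (suc t) })
  ... | no ¬new = extend α inj (λ j → proj₁ (hit j)) (λ j → sym (proj₂ (hit j)))
    where
    hit : ∀ j → ∃[ t ] α t ≡ a j
    hit j = decidable-stable (any? (λ t → α t ≟ a j)) (λ n → ¬new (j , n))

map-injective : ∀ {k l} {α : Fin k → Fin l} → Injective α → ∀ {n} (w w' : Vec (Fin k) n) → Vec.map α w ≡ Vec.map α w' → w ≡ w'
map-injective inj []      []        e = refl
map-injective inj (i ∷ w) (i' ∷ w') e = cong₂ _∷_ (inj i i' (Vec.∷-injectiveˡ e)) (map-injective inj w w' (Vec.∷-injectiveʳ e))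

eqb : ∀ {a b} → (T a → T b) → (T b → T a) → a ≡ b
eqb {true}  {true}  f g = refl
eqb {true}  {false} f g = ⊥-elim (f tt)
eqb {false} {true}  f g = ⊥-elim (g tt)
eqb {false} {false} f g = refl

#-any : {{E : Enum 𝕏}} {{E' : Enum 𝕐}} (R : 𝕐 → 𝕏 → Bool) →
  # (λ x → does (any? (λ y → ∈? (R y) x))) ≤ ∑ (λ y → # (R y))
#-any R = begin
  # (λ x → does (any? (λ y → ∈? (R y) x)))     ≡⟨ #-def _ ⟩
  ∑ (λ x → χ (any? (λ y → ∈? (R y) x)))        ≤⟨ ∑-mono pt ⟩
  ∑ (λ x → ∑ (λ y → 𝟙 (R y x)))                ≡⟨ ∑-swap (λ x y → 𝟙 (R y x)) ⟩
  ∑ (λ y → ∑ (λ x → 𝟙 (R y x)))                ≡⟨ ∑-cong (λ y → sym (#-def (R y))) ⟩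
  ∑ (λ y → # (R y))                            ∎
  where
  open ≤-Reasoning
  pt : ∀ x → χ (any? (λ y → ∈? (R y) x)) ≤ ∑ (λ y → 𝟙 (R y x))
  pt x with any? (λ y → ∈? (R y) x)
  ... | yes (y , h) = ≤-trans (≤-reflexive (sym (𝟙-yes h))) (∑-≥ (λ y → 𝟙 (R y x)) y)
  ... | no _ = z≤n

-- Sums of families in a group

module GroupSums (V : Set) {{enumV : Enum V}} (_⊹_ : V → V → V) (𝟘 : V) (⊖_ : V → V)
                 (isAG : IsAbelianGroup _≡_ _⊹_ 𝟘 ⊖_) where

  open Additive V _⊹_ 𝟘 ⊖_ isAG
  open IsAbelianGroup isAG using (assoc; comm; identityˡ; identityʳ; inverseˡ; inverseʳ)

  gsum : ∀ {n} → (Fin n → V) → V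
  gsum {zero}  f = 𝟘
  gsum {suc n} f = f zero ⊹ gsum (f ∘ suc)

  gsum-cong : ∀ {n} {f g : Fin n → V} → (∀ i → f i ≡ g i) → gsum f ≡ gsum g
  gsum-cong {zero}  e = refl
  gsum-cong {suc n} e = cong₂ _⊹_ (e zero) (gsum-cong (e ∘ suc))

  gsum-⊹ : ∀ {n} (f g : Fin n → V) → gsum (λ i → f i ⊹ g i) ≡ gsum f ⊹ gsum g
  gsum-⊹ {zero}  f g = sym (identityˡ 𝟘)
  gsum-⊹ {suc n} f g = trans (cong ((f zero ⊹ g zero) ⊹_) (gsum-⊹ (f ∘ suc) (g ∘ suc)))
    (⊹-interchange (f zero) (g zero) _ _)

  gsum-𝟘 : ∀ n → gsum {n} (λ _ → 𝟘) ≡ 𝟘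
  gsum-𝟘 zero    = refl
  gsum-𝟘 (suc n) = trans (identityˡ _) (gsum-𝟘 n)

  gsum-swap : ∀ {m n} (f : Fin m → Fin n → V) → gsum (λ i → gsum (f i)) ≡ gsum (λ j → gsum (λ i → f i j))
  gsum-swap {zero}  {n} f = sym (gsum-𝟘 n)
  gsum-swap {suc m} f = trans (cong (gsum (f zero) ⊹_) (gsum-swap (f ∘ suc)))
    (sym (gsum-⊹ (f zero) (λ j → gsum (λ i → f (suc i) j))))

  mask : Bool → V → V
  mask true  v = v
  mask false v = 𝟘

  mask-no : ∀ {b} v → ¬ T b → mask b v ≡ 𝟘
  mask-no {true}  v n = ⊥-elim (n tt)
  mask-no {false} v n = refl

  mask-∧ : ∀ a b v → mask (a ∧ b) v ⊹ mask (a ∧ not b) v ≡ mask a v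
  mask-∧ true  true  v = identityʳ v
  mask-∧ true  false v = identityˡ v
  mask-∧ false b     v = identityˡ 𝟘

  mask-not : ∀ b v → mask b v ⊹ mask (not b) v ≡ v
  mask-not true  v = identityʳ v
  mask-not false v = identityˡ v

  gsum-δ : ∀ {n} (s : Fin n) (f : Fin n → V) → gsum (λ i → mask (does (s ≟ i)) (f i)) ≡ f s
  gsum-δ {suc n} zero f = trans (cong (f zero ⊹_) (trans (gsum-cong {n} (λ i → refl)) (gsum-𝟘 n))) (identityʳ (f zero))
  gsum-δ {suc n} (suc s) f = trans (identityˡ _) (trans (gsum-cong eq) (gsum-δ s (f ∘ suc)))
    where
    eq : ∀ i → mask (does (suc s ≟ suc i)) (f (suc i)) ≡ mask (does (s ≟ i)) (f (suc i))
    eq i with s Fin.≟ i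
    ... | yes _ = refl
    ... | no _  = refl

  partition : ∀ {P r} (cl : Fin P → Fin r) (f : Fin P → V) →
    gsum f ≡ gsum (λ s → gsum (λ j → mask (does (cl j ≟ s)) (f j)))
  partition cl f = trans (gsum-cong (λ j → sym (gsum-δ (cl j) (λ _ → f j)))) (gsum-swap (λ j s → mask (does (cl j ≟ s)) (f j)))

  -- Adding to each family the part of the other one along c makes the two families equal term by
  -- term, and the added parts have equal sums.
  gsum-exchange : ∀ {P K} (c : Fin K → Fin P) → Injective c → (f f' : Fin P → V) →
    (∀ j → (∀ t → c t ≢ j) → f j ≡ f' j) → gsum (f ∘ c) ≡ gsum (f' ∘ c) → gsum f ≡ gsum f'
  gsum-exchange {P} {K} c inj f f' off on = ⊹-cancelʳ (gsum (f' ∘ c)) (begin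
    gsum f ⊹ gsum (f' ∘ c)                  ≡⟨ cong (gsum f ⊹_) (push-out f') ⟩
    gsum f ⊹ gsum (m f')                    ≡⟨ sym (gsum-⊹ f (m f')) ⟩
    gsum (λ j → f j ⊹ m f' j)               ≡⟨ gsum-cong pt ⟩
    gsum (λ j → f' j ⊹ m f j)               ≡⟨ gsum-⊹ f' (m f) ⟩
    gsum f' ⊹ gsum (m f)                    ≡⟨ cong (gsum f' ⊹_) (trans (sym (push-out f)) on) ⟩
    gsum f' ⊹ gsum (f' ∘ c)                 ∎)
    where
    open ≡-Reasoning
    m : (Fin P → V) → Fin P → V
    m f j = gsum (λ t → mask (does (c t ≟ j)) (f j))
    push-out : ∀ f → gsum (f ∘ c) ≡ gsum (m f)
    push-out f = trans (gsum-cong (λ t → sym (gsum-δ (c t) f))) (gsum-swap (λ t j → mask (does (c t ≟ j)) (f j)))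
    m-on : ∀ f t → m f (c t) ≡ f (c t)
    m-on f t = trans (gsum-cong (λ s → eq s)) (gsum-δ t (λ _ → f (c t)))
      where
      eq : ∀ s → mask (does (c s ≟ c t)) (f (c t)) ≡ mask (does (t ≟ s)) (f (c t))
      eq s with c s Fin.≟ c t | t Fin.≟ s
      ... | yes _ | yes _ = refl
      ... | no _  | no _  = refl
      ... | yes e | no n  = ⊥-elim (n (sym (inj s t e)))
      ... | no n  | yes e = ⊥-elim (n (cong c (sym e)))
    pt : ∀ j → f j ⊹ m f' j ≡ f' j ⊹ m f j
    pt j with any? (λ t → c t ≟ j)
    ... | yes (t , refl) = trans (cong (f (c t) ⊹_) (m-on f' t)) (trans (comm _ _) (cong (f' (c t) ⊹_) (sym (m-on f t))))
    ... | no n = cong₂ _⊹_ (off j (λ t e → n (t , e))) (trans (zr f') (sym (zr f)))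
      where
      zr : ∀ f → m f j ≡ 𝟘
      zr f = trans (gsum-cong (λ t → mask-no (f j) (λ h → n (t , out (c t ≟ j) h)))) (gsum-𝟘 K)

  -- Recombining zero-sum colour sequences

  module Recombine {P m : ℕ} (x : Fin P → Fin m → V) (zero-sum : ∀ i → gsum (λ j → x j i) ≡ 𝟘)
    (j₁ j₂ : Fin P) (j₁≢j₂ : j₁ ≢ j₂)
    (locked : ∀ (a : Fin P → Fin m) → gsum (λ j → x j (a j)) ≡ 𝟘 → a j₁ ≡ a j₂) where

    τ : ∀ {K} → (Fin K → Fin P) → Vec (Fin m) K → V
    τ c w = gsum (λ t → x (c t) (Vec.lookup w t))

    movable? : ∀ {k} (c : Fin (suc k) → Fin P) w → Dec (∃[ w' ] τ c w' ≡ τ c w × Vec.head w' ≢ Vec.head w)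
    movable? c w = any? (λ w' → (τ c w' ≟ τ c w) ×-dec ¬? (Vec.head w' ≟ Vec.head w))

    -- The tuples along c whose sum forces the first index. Placed in the original sequence they
    -- form a set on which the sum determines the first term.
    Bad : ∀ {k} → (Fin (suc k) → Fin P) → Vec (Fin m) (suc k) → Bool
    Bad c w = does (¬? (movable? c w))

    head-lookup : ∀ {k} {A : Set} (w : Vec A (suc k)) → Vec.head w ≡ Vec.lookup w zero
    head-lookup (_ ∷ _) = refl

    -- A tuple w' with the same sum and another head could replace the entries of a along c. This
    -- would move colour j₁ but leave j₂, which is not met by c, against `locked`.
    exchange : ∀ {k} (c : Fin (suc k) → Fin P) → Injective c → c zero ≡ j₁ → (∀ t → c t ≢ j₂) →
      (a : Fin P → Fin m) → gsum (λ j → x j (a j)) ≡ 𝟘 → Vec.tabulate (a ∘ c) ∈ Bad c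
    exchange {k} c inj c0 c≢j₂ a az = into (¬? (movable? c w)) contra
      where
      w = Vec.tabulate (a ∘ c)
      contra : ¬ (∃[ w' ] τ c w' ≡ τ c w × Vec.head w' ≢ Vec.head w)
      contra (w' , eq , ne) = ne (trans (head-lookup w') (trans (sym a'-j₁) (trans (locked a' a'-zero) a'-j₂)))
        where
        a' : Fin P → Fin m
        a' j with any? (λ t → c t ≟ j)
        ... | yes (t , _) = Vec.lookup w' t
        ... | no _        = a j
        a'-c : ∀ t → a' (c t) ≡ Vec.lookup w' t
        a'-c t with any? (λ s → c s ≟ c t)
        ... | yes (s , e) = cong (Vec.lookup w') (inj s t e)
        ... | no n        = ⊥-elim (n (t , refl))
        a'-off : ∀ j → (∀ t → c t ≢ j) → a' j ≡ a j
        a'-off j n with any? (λ t → c t ≟ j)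
        ... | yes (t , e) = ⊥-elim (n t e)
        ... | no _        = refl
        a'-zero : gsum (λ j → x j (a' j)) ≡ 𝟘
        a'-zero = trans (gsum-exchange c inj (λ j → x j (a' j)) (λ j → x j (a j))
          (λ j n → cong (x j) (a'-off j n))
          (trans (gsum-cong (λ t → cong (x (c t)) (a'-c t))) (trans eq
            (gsum-cong (λ t → cong (x (c t)) (Vec.lookup∘tabulate (a ∘ c) t)))))) az
        a'-j₁ : a' j₁ ≡ Vec.lookup w' zero
        a'-j₁ = trans (cong a' (sym c0)) (a'-c zero)
        a'-j₂ : a' j₂ ≡ a (c zero)
        a'-j₂ = trans (a'-off j₂ c≢j₂) (trans (sym (locked a az)) (cong a (sym c0)))

    fsum : (Fin P → Bool) → (Fin P → Fin m) → V
    fsum S a = gsum (λ j → mask (S j) (x j (a j)))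

    csum : (Fin P → Bool) → Fin m → V
    csum S i = fsum S (λ _ → i)

    fsum-cong : ∀ (A : Fin P → Bool) {a b : Fin P → Fin m} → (∀ j → j ∈ A → a j ≡ b j) → fsum A a ≡ fsum A b
    fsum-cong A {a} {b} h = gsum-cong pt
      where
      pt : ∀ j → mask (A j) (x j (a j)) ≡ mask (A j) (x j (b j))
      pt j with T? (A j)
      ... | yes q = cong (λ i → mask (A j) (x j i)) (h j q)
      ... | no n = trans (mask-no _ n) (sym (mask-no _ n))

    fsum-split : ∀ (S U : Fin P → Bool) (a : Fin P → Fin m) → fsum (λ j → S j ∧ U j) a ⊹ fsum (λ j → S j ∧ not (U j)) a ≡ fsum S a
    fsum-split S U a = trans (sym (gsum-⊹ (λ j → mask (S j ∧ U j) (x j (a j))) (λ j → mask (S j ∧ not (U j)) (x j (a j)))))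
      (gsum-cong (λ j → mask-∧ (S j) (U j) (x j (a j))))

    fsum-compl : ∀ (S : Fin P → Bool) (a : Fin P → Fin m) → fsum S a ⊹ fsum (not ∘ S) a ≡ gsum (λ j → x j (a j))
    fsum-compl S a = trans (sym (gsum-⊹ (λ j → mask (S j) (x j (a j))) (λ j → mask (not (S j)) (x j (a j)))))
      (gsum-cong (λ j → mask-not (S j) (x j (a j))))

    csum-ext : ∀ {A B : Fin P → Bool} → (∀ j → A j ≡ B j) → ∀ i → csum A i ≡ csum B i
    csum-ext h i = gsum-cong (λ j → cong (λ b → mask b (x j i)) (h j))

    -- As class sums do not depend on the index, the classes may be given independent indices from ι.
    record State (r m' : ℕ) : Set where
      field
        ι     : Fin m' → Fin m
        ι-inj : Injective ι
        cl    : Fin P → Fin (suc r)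
        onto  : ∀ s → ∃[ j ] cl j ≡ s
        cl-j₁ : cl j₁ ≡ zero
        const : ∀ s i i' → csum (λ j → does (cl j ≟ s)) (ι i) ≡ csum (λ j → does (cl j ≟ s)) (ι i')

      class : Fin (suc r) → Fin P → Bool
      class s j = does (cl j ≟ s)

    initial : State 0 m
    initial = record
      { ι = id ; ι-inj = λ _ _ e → e ; cl = λ _ → zero ; onto = λ { zero → j₁ , refl } ; cl-j₁ = refl
      ; const = λ { zero i i' → trans (zero-sum i) (sym (zero-sum i')) } }

    -- U becomes the class number one and the remainder of its old class keeps a constant sum by
    -- subtraction. The old classes are renumbered around it, and the class of j₁ keeps the number
    -- zero as U misses j₁.
    refine : ∀ {r m' m''} (st : State r m') (s₀ : Fin (suc r)) (U : Fin P → Bool) →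
      (∀ j → j ∈ U → State.cl st j ≡ s₀) → ∃[ j ] j ∈ U → (∃[ j ] State.cl st j ≡ s₀ × j ∉ U) → j₁ ∉ U →
      (κ : Fin m'' → Fin m') → Injective κ →
      (∀ i i' → csum U (State.ι st (κ i)) ≡ csum U (State.ι st (κ i'))) → State (suc r) m''
    refine {r} {m'} {m''} st s₀ U U⊂ (jU , jU∈) (jV , clV , jV∉) j₁∉ κ κ-inj U-const = record
      { ι = ι ∘ κ ; ι-inj = λ s t e → κ-inj s t (ι-inj _ _ e) ; cl = cl' ; onto = onto' ; cl-j₁ = cl'-j₁ ; const = const' }
      where
      open State st
      one : Fin (suc (suc r))
      one = suc zero
      cl' : Fin P → Fin (suc (suc r))
      cl' j = if U j then one else Fin.punchIn one (cl j)
      cl'-U : ∀ j → j ∈ U → cl' j ≡ one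
      cl'-U j h with U j
      ... | true = refl
      cl'-n : ∀ j → j ∉ U → cl' j ≡ Fin.punchIn one (cl j)
      cl'-n j n with U j
      ... | true  = ⊥-elim (n tt)
      ... | false = refl
      cl'-j₁ : cl' j₁ ≡ zero
      cl'-j₁ = trans (cl'-n j₁ j₁∉) (cong (Fin.punchIn one) cl-j₁)
      onto-in : ∀ s → ∃[ j ] cl' j ≡ Fin.punchIn one s
      onto-in s with s ≟ s₀
      ... | yes refl = jV , trans (cl'-n jV jV∉) (cong (Fin.punchIn one) clV)
      ... | no ne with onto s
      ...   | j , e = j , trans (cl'-n j (λ h → ne (trans (sym e) (U⊂ j h)))) (cong (Fin.punchIn one) e)
      onto' : ∀ s → ∃[ j ] cl' j ≡ s
      onto' s with one Fin.≟ s
      ... | yes refl = jU , cl'-U jU jU∈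
      ... | no ne = subst (λ s → ∃[ j ] cl' j ≡ s) (Fin.punchIn-punchOut ne) (onto-in (Fin.punchOut ne))
      C : Fin (suc (suc r)) → Fin P → Bool
      C s j = does (cl' j ≟ s)
      C-one : ∀ j → C one j ≡ U j
      C-one j = eqb to (λ h → into (cl' j ≟ one) (cl'-U j h))
        where
        to : T (C one j) → T (U j)
        to h with T? (U j)
        ... | yes u = u
        ... | no n = ⊥-elim (Fin.punchInᵢ≢i one (cl j) (trans (sym (cl'-n j n)) (out (cl' j ≟ one) h)))
      C-in : ∀ s j → C (Fin.punchIn one s) j ≡ class s j ∧ not (U j)
      C-in s j = eqb to from
        where
        to : T (C (Fin.punchIn one s) j) → T (class s j ∧ not (U j))
        to h with T? (U j)
        ... | yes u = ⊥-elim (Fin.punchInᵢ≢i one s (trans (sym (out (cl' j ≟ _) h)) (cl'-U j u)))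
        ... | no n = ∧-in (into (cl j ≟ s) (Fin.punchIn-injective one _ _ (trans (sym (cl'-n j n)) (out (cl' j ≟ _) h)))) (not-in n)
        from : T (class s j ∧ not (U j)) → T (C (Fin.punchIn one s) j)
        from h = into (cl' j ≟ _) (trans (cl'-n j (not-out (∧-r {class s j} h))) (cong (Fin.punchIn one) (out (cl j ≟ s) (∧-l h))))
      meet-const : ∀ s i i' → csum (λ j → class s j ∧ U j) (ι (κ i)) ≡ csum (λ j → class s j ∧ U j) (ι (κ i'))
      meet-const s i i' with s ≟ s₀
      ... | yes refl = trans (csum-ext meet (ι (κ i))) (trans (U-const i i') (sym (csum-ext meet (ι (κ i')))))
        where
        meet : ∀ j → class s j ∧ U j ≡ U j
        meet j = eqb (∧-r {class s j}) (λ h → ∧-in (into (cl j ≟ s) (U⊂ j h)) h)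
      ... | no ne = trans (empty _) (sym (empty _))
        where
        empty : ∀ i → csum (λ j → class s j ∧ U j) i ≡ 𝟘
        empty i = trans (gsum-cong (λ j → mask-no (x j i) (λ h → ne (trans (sym (out (cl j ≟ s) (∧-l h))) (U⊂ j (∧-r {class s j} h))))))
          (gsum-𝟘 P)
      rest-const : ∀ s i i' → csum (λ j → class s j ∧ not (U j)) (ι (κ i)) ≡ csum (λ j → class s j ∧ not (U j)) (ι (κ i'))
      rest-const s i i' = ⊹-cancelʳ (csum (λ j → class s j ∧ U j) (ι (κ i)))
        (trans (comm _ _) (trans (fsum-split (class s) U _) (trans (const s (κ i) (κ i'))
          (trans (sym (fsum-split (class s) U _)) (trans (comm _ _)
            (cong (csum (λ j → class s j ∧ not (U j)) (ι (κ i')) ⊹_) (meet-const s i' i)))))))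
      const' : ∀ s i i' → csum (C s) (ι (κ i)) ≡ csum (C s) (ι (κ i'))
      const' s i i' with one Fin.≟ s
      ... | yes refl = trans (csum-ext C-one _) (trans (U-const i i') (sym (csum-ext C-one _)))
      ... | no ne = subst (λ s → csum (C s) (ι (κ i)) ≡ csum (C s) (ι (κ i'))) (Fin.punchIn-punchOut ne)
          (trans (csum-ext (C-in s') _) (trans (rest-const s' i i') (sym (csum-ext (C-in s') _))))
        where s' = Fin.punchOut ne

    -- Splitting the colours or sampling the indices

    module Splitting (k l : ℕ) (k<P : suc k ≤ P) (k<l : suc k ≤ l)
      (slice : ∀ (X : Fin P → Fin l → V) (S : Fin P → Bool) (u : V) ja jb → ja ∈ S → jb ∈ S → ja ≢ jb →
        P ≤ # S * suc k →
        (∀ (a : Fin P → Fin l) i → (∀ j → j ∈ S → a j ≡ i) → gsum (λ j → mask (S j) (X j (a j))) ≡ u) →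
        (∀ (a : Fin P → Fin l) → gsum (λ j → mask (S j) (X j (a j))) ≡ u →
          ∀ j j' → j ∈ S → j' ∈ S → a j ≡ a j') → ⊥) where

      K = suc k

      -- The number of kinds of forbidden tuples: P^K choices of colours c, K^P maps φ and k places
      -- for a repetition of the head.
      patterns : ℕ
      patterns = P ^ K + (K ^ P + k)

      -- Each kind of forbidden tuples will have density at most 1/Ψ. There are `patterns` kinds and
      -- at most l^K injective restrictions of a sample, so one more than `patterns` makes the union
      -- bound strict.
      Ψ : ℕ
      Ψ = suc patterns * l ^ K

      1≤P : 1 ≤ P
      1≤P = ≤-trans (s≤s z≤n) k<P

      1≤l^K : 1 ≤ l ^ K
      1≤l^K = ^-pos K (≤-trans (s≤s z≤n) k<l)

      2≤Ψ : 2 ≤ Ψ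
      2≤Ψ = *-mono-≤ {2} {suc patterns} {1} (s≤s (≤-trans (^-pos K 1≤P) (m≤m+n (P ^ K) _))) 1≤l^K

      1≤Ψ : 1 ≤ Ψ
      1≤Ψ = ≤-trans (s≤s z≤n) 2≤Ψ

      -- Up to k refinements may reduce the m indices by a factor Ψ^k, which raises the density of a
      -- set of K-tuples by up to (Ψ^k)^K. The remaining Ψ is the one required by the union bound.
      Sparse : Set
      Sparse = ∀ (c : Vec (Fin P) K) → Vec.lookup c zero ≡ j₁ →
        (Ψ ^ k) ^ K * Ψ * # (Bad (Vec.lookup c)) < m ^ K

      module Step (sparse : Sparse) {r m' : ℕ} (st : State r m') (r<k : r < k)
        (large : m ≤ Ψ ^ r * m') (Ψ≤m' : Ψ ≤ m') where

        open State st

        size-tuples : ∀ n → size (Vec (Fin m') n) ≡ m' ^ n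
        size-tuples n = trans (size-Vec n) (cong (_^ n) (size-Fin m'))

        opaque
          big-class : ∃[ s ] P ≤ # (class s) * suc r
          big-class = ∑-≤∃ (≤-trans (s≤s z≤n) (≤-reflexive (sym (size-Fin (suc r))))) (begin
            ∑ {Fin (suc r)} (λ _ → P)             ≡⟨ trans (∑-const {Fin (suc r)} P) (cong (P *_) (size-Fin (suc r))) ⟩
            P * suc r                             ≡⟨ cong (_* suc r) (sym (trans (fibres cl) (size-Fin P))) ⟩
            ∑ (λ s → # (class s)) * suc r         ≡⟨ sym (∑-*ʳ (λ s → # (class s)) (suc r)) ⟩
            ∑ (λ s → # (class s) * suc r)         ∎)
            where open ≤-Reasoning

        s₀ : Fin (suc r)
        s₀ = proj₁ big-class

        S : Fin P → Bool
        S = class s₀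

        P≤S : P ≤ # S * suc k
        P≤S = ≤-trans (proj₂ big-class) (*-monoʳ-≤ (# S) (s≤s (<⇒≤ r<k)))

        2≤S : 2 ≤ # S
        2≤S with 2 ≤? # S
        ... | yes h = h
        ... | no n = ⊥-elim (<⇒≱ k<P (≤-trans (proj₂ big-class) (≤-trans (*-monoˡ-≤ (suc r) (s≤s⁻¹ (≰⇒> n)))
                       (≤-trans (≤-reflexive (*-identityˡ (suc r))) r<k))))

        Concentrated : Set
        Concentrated = Σ (Fin P → Bool) λ U → Σ V λ u → (∀ j → j ∈ U → j ∈ S) × (∃[ j ] j ∈ U) ×
          (∃[ j ] j ∈ S × j ∉ U) × m' ≤ Ψ * # (λ i → does (csum U (ι i) ≟ u))

        -- The sum over S is constant, so on the selected indices the sums over U and over the rest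
        -- of S both are. Whichever part misses j₁ is split off.
        refined : Concentrated → (∀ {m''} → State (suc r) m'' → m' ≤ Ψ * m'' → ⊥) → ⊥
        refined (U , u , U⊂S , neU , neV , dense) next with pick (λ i → does (csum U (ι i) ≟ u)) ≤-refl
        ... | κ , κ-inj , mem with T? (U j₁)
        ...   | no n = next (refine st s₀ U (λ j h → out (cl j ≟ s₀) (U⊂S j h)) neU
                  (let (j , jS , jU) = neV in j , out (cl j ≟ s₀) jS , jU) n κ κ-inj
                  (λ i i' → trans (U≡ i) (sym (U≡ i')))) dense
          where
          U≡ : ∀ i → csum U (ι (κ i)) ≡ u
          U≡ i = out (csum U (ι (κ i)) ≟ u) (mem i)
        ...   | yes h = next (refine st s₀ U' (λ j q → out (cl j ≟ s₀) (∧-l q))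
                  (let (j , jS , jU) = neV in j , ∧-in jS (not-in jU))
                  (let (j , jU) = neU in j , out (cl j ≟ s₀) (U⊂S j jU) , λ q → not-out (∧-r {S j} q) jU)
                  (λ q → not-out (∧-r {S j₁} q) h) κ κ-inj U'-const) dense
          where
          U' : Fin P → Bool
          U' j = S j ∧ not (U j)
          U≡ : ∀ i → csum (λ j → S j ∧ U j) (ι (κ i)) ≡ u
          U≡ i = trans (csum-ext (λ j → eqb (∧-r {S j}) (λ q → ∧-in (U⊂S j q) q)) _) (out (csum U (ι (κ i)) ≟ u) (mem i))
          U'-const : ∀ i i' → csum U' (ι (κ i)) ≡ csum U' (ι (κ i'))
          U'-const i i' = ⊹-cancelʳ u (trans (comm _ u) (trans (cong (_⊹ csum U' (ι (κ i))) (sym (U≡ i)))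
            (trans (fsum-split S U _) (trans (const s₀ (κ i) (κ i')) (trans (sym (fsum-split S U _))
              (trans (cong (_⊹ csum U' (ι (κ i'))) (U≡ i')) (comm u _)))))))

        module Spread (spread : ¬ Concentrated) where

          thin : ∀ (U : Fin P → Bool) u → (∀ j → j ∈ U → j ∈ S) → (∃[ j ] j ∈ U) → (∃[ j ] j ∈ S × j ∉ U) →
            Ψ * # (λ i → does (csum U (ι i) ≟ u)) ≤ m'
          thin U u h₁ h₂ h₃ = <⇒≤ (≰⇒> (λ le → spread (U , u , h₁ , h₂ , h₃ , le)))

          i₀ : Fin m'
          i₀ = Fin.fromℕ< (≤-trans 1≤Ψ Ψ≤m')

          vS : V
          vS = csum S (ι i₀)

          -- Forbidden tuples of indices: those that cannot be exchanged (forb₁), those already recombining to a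
          -- solution (forb₂) and those repeating their head (forb₃).
          forb₁ : Vec (Fin P) K → Vec (Fin m') K → Bool
          forb₁ c w = does (Vec.lookup c zero ≟ j₁) ∧ Bad (Vec.lookup c) (Vec.map ι w)

          Mixed : Vec (Fin K) P → Set
          Mixed φ = ∃[ j ] ∃[ j' ] j ∈ S × j' ∈ S × Vec.lookup φ j ≢ Vec.lookup φ j'

          mixed? : ∀ φ → Dec (Mixed φ)
          mixed? φ = any? (λ j → any? (λ j' → ∈? S j ×-dec (∈? S j' ×-dec ¬? (Vec.lookup φ j ≟ Vec.lookup φ j'))))

          pulled : Vec (Fin K) P → Vec (Fin m') K → V
          pulled φ w = fsum S (λ j → ι (Vec.lookup w (Vec.lookup φ j)))

          forb₂ : Vec (Fin K) P → Vec (Fin m') K → Bool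
          forb₂ φ w = does (mixed? φ) ∧ does (pulled φ w ≟ vS)

          forb₃ : Fin k → Vec (Fin m') K → Bool
          forb₃ t w = does (Vec.lookup w zero ≟ Vec.lookup w (suc t))

          -- The restriction to the indices ι costs at most the factor (Ψ^k)^K provided for in
          -- `Sparse`, because m ≤ Ψ^r m' with r < k.
          few₁ : ∀ c → Ψ * # (forb₁ c) ≤ m' ^ K
          few₁ c with Vec.lookup c zero ≟ j₁
          ... | no n = ≤-trans (≤-reflexive (trans (cong (Ψ *_) (trans (#-def {Vec (Fin m') K} (λ _ → false)) ∑-0)) (*-zeroʳ Ψ))) z≤n
          ... | yes c0 = *-cancelˡ ((Ψ ^ k) ^ K) (^-pos K (^-pos k 1≤Ψ)) (begin
            (Ψ ^ k) ^ K * (Ψ * # (λ w → Bad (Vec.lookup c) (Vec.map ι w)))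
              ≤⟨ *-monoʳ-≤ ((Ψ ^ k) ^ K) (*-monoʳ-≤ Ψ (#-inj {F = λ w → Bad (Vec.lookup c) (Vec.map ι w)} {Bad (Vec.lookup c)} (Vec.map ι) (map-injective ι-inj) (λ _ h → h))) ⟩
            (Ψ ^ k) ^ K * (Ψ * # (Bad (Vec.lookup c)))   ≡⟨ sym (*-assoc ((Ψ ^ k) ^ K) Ψ _) ⟩
            (Ψ ^ k) ^ K * Ψ * # (Bad (Vec.lookup c))     ≤⟨ <⇒≤ (sparse c c0) ⟩
            m ^ K                                        ≤⟨ ^-monoˡ-≤ K large ⟩
            (Ψ ^ r * m') ^ K                             ≡⟨ *-^ K (Ψ ^ r) m' ⟩
            (Ψ ^ r) ^ K * m' ^ K                         ≤⟨ *-monoˡ-≤ (m' ^ K) (^-monoˡ-≤ K (^-monoʳ-≤ Ψ {{>-nonZero 1≤Ψ}} (<⇒≤ r<k))) ⟩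
            (Ψ ^ k) ^ K * m' ^ K                         ∎)
            where
            open ≤-Reasoning

          -- When all entries of w except that at t = φ j are fixed, only the colours of S sent to t
          -- vary. As φ is mixed, they form a nonempty proper part U of S, and by `thin` the sum
          -- over U takes the required value for at most a share 1/Ψ of the indices.
          few₂ : ∀ φ → Ψ * # (forb₂ φ) ≤ m' ^ K
          few₂ φ with mixed? φ
          ... | no n = ≤-trans (≤-reflexive (trans (cong (Ψ *_) (trans (#-def {Vec (Fin m') K} (λ _ → false)) ∑-0)) (*-zeroʳ Ψ))) z≤n
          ... | yes (j , j' , jS , j'S , ne) = begin
            Ψ * # E                                        ≡⟨ cong (Ψ *_) (trans (#-def E) (trans (∑-insert t (𝟙 ∘ E)) (∑-swap (λ i w → 𝟙 (E (Vec.insertAt w t i)))))) ⟩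
            Ψ * ∑ (λ w → ∑ (λ i → 𝟙 (E (Vec.insertAt w t i))))  ≡⟨ sym (∑-*ˡ Ψ (λ w → ∑ (λ i → 𝟙 (E (Vec.insertAt w t i))))) ⟩
            ∑ (λ w → Ψ * ∑ (λ i → 𝟙 (E (Vec.insertAt w t i))))  ≤⟨ ∑-mono (λ w → ≤-trans (≤-reflexive (cong (Ψ *_) (sym (#-def (λ i → E (Vec.insertAt w t i)))))) (line w)) ⟩
            ∑ {Vec (Fin m') k} (λ _ → m')                  ≡⟨ trans (∑-const {Vec (Fin m') k} m') (cong (m' *_) (size-tuples k)) ⟩
            m' ^ K                                         ∎
            where
            open ≤-Reasoning
            t = Vec.lookup φ j
            E : Vec (Fin m') K → Bool
            E w = does (pulled φ w ≟ vS)
            At U : Fin P → Bool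
            At i = does (Vec.lookup φ i ≟ t)
            U i = S i ∧ At i
            same : ∀ w i → fsum U (λ j → ι (Vec.lookup (Vec.insertAt w t i) (Vec.lookup φ j))) ≡ csum U (ι i)
            same w i = fsum-cong U (λ j h → cong ι
              (trans (cong (Vec.lookup (Vec.insertAt w t i)) (out (Vec.lookup φ j ≟ t) (∧-r {S j} h))) (Vec.insertAt-lookup w t i)))
            other : ∀ w i i' → fsum (λ j → S j ∧ not (At j)) (λ j → ι (Vec.lookup (Vec.insertAt w t i) (Vec.lookup φ j))) ≡
                               fsum (λ j → S j ∧ not (At j)) (λ j → ι (Vec.lookup (Vec.insertAt w t i') (Vec.lookup φ j)))
            other w i i' = fsum-cong (λ j → S j ∧ not (At j)) (λ j h → cong ι (trans (at i j h) (sym (at i' j h))))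
              where
              t≢ : ∀ j → T (S j ∧ not (At j)) → t ≢ Vec.lookup φ j
              t≢ j h e = not-out (∧-r {S j} h) (into (Vec.lookup φ j ≟ t) (sym e))
              at : ∀ i j h → Vec.lookup (Vec.insertAt w t i) (Vec.lookup φ j) ≡ Vec.lookup w (Fin.punchOut (t≢ j h))
              at i j h = trans (cong (Vec.lookup (Vec.insertAt w t i)) (sym (Fin.punchIn-punchOut (t≢ j h)))) (Vec.insertAt-punchIn w t i _)
            fibre-eq : ∀ w i i' → Vec.insertAt w t i ∈ E → Vec.insertAt w t i' ∈ E → csum U (ι i) ≡ csum U (ι i')
            fibre-eq w i i' h h' = ⊹-cancelʳ (rest i) (trans (split i) (trans (trans (out (_ ≟ vS) h) (sym (out (_ ≟ vS) h')))
              (trans (sym (split i')) (cong (csum U (ι i') ⊹_) (other w i' i)))))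
              where
              rest : Fin m' → V
              rest i = fsum (λ j → S j ∧ not (At j)) (λ j → ι (Vec.lookup (Vec.insertAt w t i) (Vec.lookup φ j)))
              split : ∀ i → csum U (ι i) ⊹ rest i ≡ pulled φ (Vec.insertAt w t i)
              split i = trans (cong (_⊹ rest i) (sym (same w i))) (fsum-split S At _)
            line : ∀ w → Ψ * # (λ i → E (Vec.insertAt w t i)) ≤ m'
            line w with any? (λ i → T? (E (Vec.insertAt w t i)))
            ... | no n = ≤-trans (≤-reflexive (trans (cong (Ψ *_) (trans (#-def _) (trans (∑-cong (λ i → 𝟙-no (λ h → n (i , h)))) ∑-0))) (*-zeroʳ Ψ))) z≤n
            ... | yes (i* , h*) = ≤-trans (*-monoʳ-≤ Ψ (#-mono {F = λ i → E (Vec.insertAt w t i)} {λ i → does (csum U (ι i) ≟ csum U (ι i*))}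
                    (λ i h → into (csum U (ι i) ≟ csum U (ι i*)) (fibre-eq w i i* h h*))))
                    (thin U (csum U (ι i*)) (λ j → ∧-l) (j , ∧-in jS (into (Vec.lookup φ j ≟ t) refl))
                      (j' , j'S , λ q → ne (sym (out (Vec.lookup φ j' ≟ t) (∧-r {S j'} q)))))

          few₃ : ∀ t → Ψ * # (forb₃ t) ≤ m' ^ K
          few₃ t = begin
            Ψ * # (forb₃ t)                                          ≡⟨ cong (Ψ *_) (trans (#-def (forb₃ t)) (trans (∑-∷ (𝟙 ∘ forb₃ t)) (∑-swap (λ i w → χ (i ≟ Vec.lookup w t))))) ⟩
            Ψ * ∑ (λ (w : Vec (Fin m') k) → ∑ (λ i → χ (i ≟ Vec.lookup w t)))  ≡⟨ cong (Ψ *_) (trans (∑-cong (λ (w : Vec (Fin m') k) → ∑-once (Vec.lookup w t))) (size-tuples k)) ⟩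
            Ψ * m' ^ k                                               ≤⟨ *-monoˡ-≤ (m' ^ k) Ψ≤m' ⟩
            m' ^ K                                                   ∎
            where open ≤-Reasoning

          F₁ F₂ F₃ forb : Vec (Fin m') K → Bool
          F₁ w = does (any? (λ c → ∈? (forb₁ c) w))
          F₂ w = does (any? (λ φ → ∈? (forb₂ φ) w))
          F₃ w = does (any? (λ t → ∈? (forb₃ t) w))
          forb w = F₁ w ∨ (F₂ w ∨ F₃ w)

          few-of : ∀ {A : Set} {{E : Enum A}} (F : A → Vec (Fin m') K → Bool) → (∀ a → Ψ * # (F a) ≤ m' ^ K) →
            Ψ * # (λ w → does (any? (λ a → ∈? (F a) w))) ≤ size A * m' ^ K
          few-of {A} F few = begin
            Ψ * # (λ w → does (any? (λ a → ∈? (F a) w)))   ≤⟨ *-monoʳ-≤ Ψ (#-any F) ⟩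
            Ψ * ∑ (λ a → # (F a))                          ≡⟨ sym (∑-*ˡ Ψ (λ a → # (F a))) ⟩
            ∑ (λ a → Ψ * # (F a))                          ≤⟨ ∑-mono few ⟩
            ∑ {A} (λ _ → m' ^ K)                           ≡⟨ trans (∑-const {A} (m' ^ K)) (*-comm (m' ^ K) _) ⟩
            size A * m' ^ K                                ∎
            where open ≤-Reasoning

          few : Ψ * # forb ≤ patterns * m' ^ K
          few = begin
            Ψ * # forb                                     ≤⟨ *-monoʳ-≤ Ψ (≤-trans (#-∪ F₁ (λ w → F₂ w ∨ F₃ w)) (+-monoʳ-≤ (# F₁) (#-∪ F₂ F₃))) ⟩
            Ψ * (# F₁ + (# F₂ + # F₃))                     ≡⟨ trans (*-distribˡ-+ Ψ (# F₁) _) (cong (Ψ * # F₁ +_) (*-distribˡ-+ Ψ (# F₂) (# F₃))) ⟩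
            Ψ * # F₁ + (Ψ * # F₂ + Ψ * # F₃)               ≤⟨ +-mono-≤ (few-of forb₁ few₁) (+-mono-≤ (few-of forb₂ few₂) (few-of forb₃ few₃)) ⟩
            size (Vec (Fin P) K) * M + (size (Vec (Fin K) P) * M + size (Fin k) * M)
              ≡⟨ cong₂ _+_ (cong (_* M) (trans (size-Vec K) (cong (_^ K) (size-Fin P))))
                   (cong₂ _+_ (cong (_* M) (trans (size-Vec P) (cong (_^ P) (size-Fin K)))) (cong (_* M) (size-Fin k))) ⟩
            P ^ K * M + (K ^ P * M + k * M)                ≡⟨ sym (trans (*-distribʳ-+ M (P ^ K) _) (cong (P ^ K * M +_) (*-distribʳ-+ M (K ^ P) k))) ⟩
            patterns * M                                   ∎
            where
            open ≤-Reasoning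
            M = m' ^ K

          sparse-forb : l ^ K * # forb < m' ^ K
          sparse-forb = *-cancelˡ-< (suc patterns) (l ^ K * # forb) (m' ^ K) (begin-strict
            suc patterns * (l ^ K * # forb)     ≡⟨ sym (*-assoc (suc patterns) (l ^ K) (# forb)) ⟩
            Ψ * # forb                          ≤⟨ few ⟩
            patterns * m' ^ K                   <⟨ *-monoˡ-< (m' ^ K) {{>-nonZero (^-pos K (≤-trans 1≤Ψ Ψ≤m'))}} (n<1+n patterns) ⟩
            suc patterns * m' ^ K               ∎)
            where open ≤-Reasoning

          1≤m' : 1 ≤ m'
          1≤m' = ≤-trans 1≤Ψ Ψ≤m'

          opaque
            generic : ∃[ u ] (∀ (α : Fin K → Fin l) → Injective α → restrict u α ∉ forb)
            generic = avoid forb 1≤m' sparse-forb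

          u : Vec (Fin m') l
          u = proj₁ generic

          avoids : ∀ (α : Fin K → Fin l) → Injective α → restrict u α ∉ forb
          avoids = proj₂ generic

          index : Fin l → Fin m
          index = ι ∘ Vec.lookup u

          z₀ : Fin l
          z₀ = Fin.fromℕ< (≤-trans (s≤s z≤n) k<l)

          fill : (Fin P → Fin l) → Fin P → Fin l
          fill a j with S j
          ... | true  = a j
          ... | false = z₀

          fill-S : ∀ a j → j ∈ S → fill a j ≡ a j
          fill-S a j h with S j
          ... | true = refl

          fill-n : ∀ a j → j ∉ S → fill a j ≡ z₀
          fill-n a j n with S j
          ... | true  = ⊥-elim (n tt)
          ... | false = refl

          -- The sum over S is the same for all constant indices, so vS may be taken at z₀. Then all
          -- colours share the index of z₀ and the total is zero.
          total : ∀ a → fsum S (index ∘ a) ≡ vS → gsum (λ j → x j (index (fill a j))) ≡ 𝟘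
          total a e = begin
            gsum (λ j → x j (index (fill a j)))
              ≡⟨ sym (fsum-compl S (index ∘ fill a)) ⟩
            fsum S (index ∘ fill a) ⊹ fsum (not ∘ S) (index ∘ fill a)
              ≡⟨ cong₂ _⊹_ (trans (fsum-cong S (λ j h → cong index (fill-S a j h))) e)
                           (fsum-cong (not ∘ S) (λ j h → cong index (fill-n a j (not-out h)))) ⟩
            vS ⊹ csum (not ∘ S) (index z₀)
              ≡⟨ cong (_⊹ csum (not ∘ S) (index z₀)) (const s₀ i₀ (Vec.lookup u z₀)) ⟩
            csum S (index z₀) ⊹ csum (not ∘ S) (index z₀)
              ≡⟨ trans (fsum-compl S (λ _ → index z₀)) (zero-sum (index z₀)) ⟩
            𝟘 ∎
            where open ≡-Reasoning

          -- If a were not constant on S, the sample would contain a forbidden tuple: when a takes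
          -- its values among K indices, a is a mixed solution in K variables; when a has K
          -- different values, these form a bad tuple or repeat their head.
          only : ∀ a → fsum S (index ∘ a) ≡ vS → ∀ j j' → j ∈ S → j' ∈ S → a j ≡ a j'
          only a e j j' jS j'S = decidable-stable (a j ≟ a j') (λ ne → clash ne (values (fill a) j₁ k k<l))
            where
            az = total a e
            lookup-restrict : ∀ α t → Vec.lookup (restrict u α) t ≡ Vec.lookup u (α t)
            lookup-restrict α t = Vec.lookup∘tabulate (λ t → Vec.lookup u (α t)) t
            clash : a j ≢ a j' → Values (fill a) j₁ k → ⊥
            clash ne (α , inj , inj₁ (φ , fac)) = avoids α inj (∨-in-r {F₁ w} (∨-in-l {F₂ w}
                (into (any? (λ φ → ∈? (forb₂ φ) w)) (φ' , ∧-in (into (mixed? φ') mix) (into (pulled φ' w ≟ vS) pe)))))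
              where
              w = restrict u α
              φ' = Vec.tabulate φ
              φ'≡ : ∀ j → Vec.lookup φ' j ≡ φ j
              φ'≡ = Vec.lookup∘tabulate φ
              mix : Mixed φ'
              mix = j , j' , jS , j'S , λ q → ne (trans (sym (fill-S a j jS)) (trans (fac j)
                (trans (cong α (trans (sym (φ'≡ j)) (trans q (φ'≡ j')))) (trans (sym (fac j')) (fill-S a j' j'S)))))
              pe : pulled φ' w ≡ vS
              pe = trans (fsum-cong S (λ j h → cong ι (trans (lookup-restrict α _) (cong (Vec.lookup u)
                (trans (cong α (φ'≡ j)) (trans (sym (fac j)) (fill-S a j h))))))) e
            clash ne (α , inj , inj₂ (c , c0 , αc)) with any? (λ t → c t ≟ j₂)
            ... | yes (zero , q) = j₁≢j₂ (trans (sym c0) q)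
            -- `locked` equates the indices of j₁ and j₂, although their positions in the sample
            -- differ. So the sample repeats an index, as excluded by `forb₃`.
            ... | yes (suc t , q) = avoids α inj (∨-in-r {F₁ w} (∨-in-r {F₂ w} (into (any? (λ t → ∈? (forb₃ t) w))
                (t , into (Vec.lookup w zero ≟ Vec.lookup w (suc t)) (ι-inj _ _ we)))))
              where
              w = restrict u α
              at : ∀ t → ι (Vec.lookup w t) ≡ index (fill a (c t))
              at t = cong ι (trans (lookup-restrict α t) (cong (Vec.lookup u) (αc t)))
              we : ι (Vec.lookup w zero) ≡ ι (Vec.lookup w (suc t))
              we = trans (at zero) (trans (cong (index ∘ fill a) c0) (trans (locked (index ∘ fill a) az)
                     (trans (cong (index ∘ fill a) (sym q)) (sym (at (suc t))))))
            ... | no n = avoids α inj (∨-in-l {F₁ w} (into (any? (λ c → ∈? (forb₁ c) w))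
                (c' , ∧-in (into (Vec.lookup c' zero ≟ j₁) (trans (c'≡ zero) c0)) bad)))
              where
              w = restrict u α
              c' = Vec.tabulate c
              c'≡ : ∀ t → Vec.lookup c' t ≡ c t
              c'≡ = Vec.lookup∘tabulate c
              c-inj : ∀ s t → Vec.lookup c' s ≡ Vec.lookup c' t → s ≡ t
              c-inj s t q = inj s t (trans (αc s) (trans (cong (fill a) (trans (sym (c'≡ s)) (trans q (c'≡ t)))) (sym (αc t))))
              bad : Vec.map ι w ∈ Bad (Vec.lookup c')
              bad = subst (_∈ Bad (Vec.lookup c')) weq (exchange (Vec.lookup c') c-inj (trans (c'≡ zero) c0)
                      (λ t q → n (t , trans (sym (c'≡ t)) q)) (index ∘ fill a) az)
                where
                weq : Vec.tabulate (index ∘ fill a ∘ Vec.lookup c') ≡ Vec.map ι w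
                weq = trans (Vec.tabulate-cong (λ t → cong index (trans (cong (fill a) (c'≡ t)) (sym (αc t)))))
                        (Vec.tabulate-∘ ι (λ t → Vec.lookup u (α t)))

          impossible : ⊥
          impossible with pick S 2≤S
          ... | β , β-inj , β∈ = slice (λ j i → x j (index i)) S vS (β zero) (β (suc zero)) (β∈ zero) (β∈ (suc zero))
                (λ q → zero≢one (β-inj zero (suc zero) q)) P≤S
                (λ a i h → trans (fsum-cong S {index ∘ a} {λ _ → index i} (λ j jS → cong index (h j jS)))
                  (const s₀ (Vec.lookup u i) i₀))
                only
            where
            zero≢one : ¬ (_≡_ {A = Fin 2} zero (suc zero))
            zero≢one ()

        split-step : (∀ {m''} → State (suc r) m'' → m' ≤ Ψ * m'' → ⊥) → ⊥
        split-step next = lem Concentrated λ where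
          (yes c) → refined c next
          (no n)  → Spread.impossible n

      -- With K classes the indices of the classes are chosen freely and every choice is zero-sum.
      -- By `exchange` all m'^K tuples along one colour of each class are bad, which contradicts
      -- `Sparse`.
      final : Sparse → ∀ {m'} → State k m' → m ≤ Ψ ^ k * m' → Ψ ≤ m' → ⊥
      final sparse {m'} st large Ψ≤m' = finish (∑-< {Vec (Fin m') K} {f = λ w → 𝟙 (B (Vec.map ι w))} {λ _ → 1} lt)
        where
        open State st
        c : Fin K → Fin P
        c zero    = j₁
        c (suc t) = proj₁ (onto (suc t))
        cl-c : ∀ t → cl (c t) ≡ t
        cl-c zero    = cl-j₁
        cl-c (suc t) = proj₂ (onto (suc t))
        B : Vec (Fin m) K → Bool
        B = Bad (Vec.lookup (Vec.tabulate c))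
        c≡ : ∀ t → Vec.lookup (Vec.tabulate c) t ≡ c t
        c≡ = Vec.lookup∘tabulate c
        lt : ∑ {Vec (Fin m') K} (λ w → 𝟙 (B (Vec.map ι w))) < ∑ {Vec (Fin m') K} (λ _ → 1)
        lt = *-cancelˡ-< ((Ψ ^ k) ^ K) _ _ (begin-strict
          (Ψ ^ k) ^ K * ∑ {Vec (Fin m') K} (λ w → 𝟙 (B (Vec.map ι w)))
            ≤⟨ *-monoʳ-≤ ((Ψ ^ k) ^ K) (≤-trans (∑-inj (Vec.map ι) (map-injective ι-inj) (𝟙 ∘ B)) (≤-reflexive (sym (#-def B)))) ⟩
          (Ψ ^ k) ^ K * # B             ≤⟨ *-monoˡ-≤ (# B) (≤-trans (≤-reflexive (sym (*-identityʳ ((Ψ ^ k) ^ K)))) (*-monoʳ-≤ ((Ψ ^ k) ^ K) 1≤Ψ)) ⟩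
          (Ψ ^ k) ^ K * Ψ * # B         <⟨ sparse (Vec.tabulate c) refl ⟩
          m ^ K                         ≤⟨ ^-monoˡ-≤ K large ⟩
          (Ψ ^ k * m') ^ K              ≡⟨ *-^ K (Ψ ^ k) m' ⟩
          (Ψ ^ k) ^ K * m' ^ K          ≡⟨ cong ((Ψ ^ k) ^ K *_) (sym (trans (size-Vec K) (cong (_^ K) (size-Fin m')))) ⟩
          (Ψ ^ k) ^ K * size (Vec (Fin m') K) ∎)
          where open ≤-Reasoning
        i₀ i₁ : Fin m'
        i₀ = Fin.fromℕ< (≤-trans 1≤Ψ Ψ≤m')
        i₁ = Fin.fromℕ< (≤-trans 2≤Ψ Ψ≤m')
        i₁≢i₀ : i₁ ≢ i₀
        i₁≢i₀ e with trans (sym (Fin.toℕ-fromℕ< (≤-trans 2≤Ψ Ψ≤m'))) (trans (cong toℕ e) (Fin.toℕ-fromℕ< (≤-trans 1≤Ψ Ψ≤m')))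
        ... | ()
        free : ∀ (w : Fin K → Fin m') → gsum (λ j → x j (ι (w (cl j)))) ≡ 𝟘
        free w = begin
          gsum (λ j → x j (ι (w (cl j))))                         ≡⟨ partition cl (λ j → x j (ι (w (cl j)))) ⟩
          gsum (λ s → fsum (class s) (λ j → ι (w (cl j))))        ≡⟨ gsum-cong (λ s → fsum-cong (class s) (λ j h → cong (ι ∘ w) (out (cl j ≟ s) h))) ⟩
          gsum (λ s → csum (class s) (ι (w s)))                   ≡⟨ gsum-cong (λ s → const s (w s) i₀) ⟩
          gsum (λ s → csum (class s) (ι i₀))                      ≡⟨ sym (partition cl (λ j → x j (ι i₀))) ⟩
          gsum (λ j → x j (ι i₀))                                 ≡⟨ zero-sum (ι i₀) ⟩
          𝟘 ∎
          where
          open ≡-Reasoning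
        -- If j₂ were in another class, moving class zero alone from i₀ to i₁ would separate j₁ from
        -- j₂.
        cl-j₂ : cl j₂ ≡ zero
        cl-j₂ with cl j₂ in e
        ... | zero  = refl
        ... | suc s = ⊥-elim (i₁≢i₀ (trans (cong w (sym cl-j₁)) (trans (ι-inj _ _ (locked (λ j → ι (w (cl j))) (free w))) (cong w e))))
          where
          w : Fin K → Fin m'
          w zero    = i₁
          w (suc _) = i₀
        finish : (∃[ w ] 𝟙 (B (Vec.map ι w)) < 1) → ⊥
        finish (w , w<1) = <⇒≱ w<1 (≤-reflexive (sym (𝟙-yes bad)))
          where
          a : Fin P → Fin m
          a j = ι (Vec.lookup w (cl j))
          c≢j₂ : ∀ t → c t ≢ j₂
          c≢j₂ zero    e = j₁≢j₂ e
          c≢j₂ (suc t) e with trans (sym (cl-c (suc t))) (trans (cong cl e) cl-j₂)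
          ... | ()
          bad : Vec.map ι w ∈ B
          bad = subst (_∈ B) (trans (Vec.tabulate-cong (λ t → cong (ι ∘ Vec.lookup w) (trans (cong cl (c≡ t)) (cl-c t))))
                  (trans (Vec.tabulate-∘ ι (Vec.lookup w)) (cong (Vec.map ι) (Vec.tabulate∘lookup w))))
            (exchange (Vec.lookup (Vec.tabulate c))
              (λ s t e → trans (sym (cl-c s)) (trans (cong cl (trans (sym (c≡ s)) (trans e (c≡ t)))) (cl-c t)))
              refl (λ t e → c≢j₂ t (trans (sym (c≡ t)) e)) a (free (Vec.lookup w)))

      -- Each refinement adds a class and costs a factor Ψ, so K classes are reached after k of
      -- them. Starting from Ψ^(k + 1) indices, at least Ψ remain at each stage.
      unlocked : Ψ ^ suc k ≤ m → Sparse → ⊥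
      unlocked large sparse = go k 0 initial (+-identityʳ k) (≤-reflexive (sym (+-identityʳ m)))
        where
        Ψ≤ : ∀ r {m'} → r ≤ k → m ≤ Ψ ^ r * m' → Ψ ≤ m'
        Ψ≤ r {m'} r≤k h = *-cancelˡ (Ψ ^ k) (^-pos k 1≤Ψ) (begin
          Ψ ^ k * Ψ       ≡⟨ *-comm (Ψ ^ k) Ψ ⟩
          Ψ ^ suc k       ≤⟨ large ⟩
          m               ≤⟨ h ⟩
          Ψ ^ r * m'      ≤⟨ *-monoˡ-≤ m' (^-monoʳ-≤ Ψ {{>-nonZero 1≤Ψ}} r≤k) ⟩
          Ψ ^ k * m'      ∎)
          where open ≤-Reasoning
        go : ∀ d r {m'} → State r m' → d + r ≡ k → m ≤ Ψ ^ r * m' → ⊥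
        go zero    r st refl h = final sparse st h (Ψ≤ r ≤-refl h)
        go (suc d) r {m'} st eq h = Step.split-step sparse st r<k h (Ψ≤ r (<⇒≤ r<k) h) next
          where
          r<k : r < k
          r<k = ≤-trans (s≤s (m≤n+m r d)) (≤-reflexive eq)
          next : ∀ {m''} → State (suc r) m'' → m' ≤ Ψ * m'' → ⊥
          next {m''} st' h' = go d (suc r) st' (trans (+-suc d r) eq) (begin
            m                     ≤⟨ h ⟩
            Ψ ^ r * m'            ≤⟨ *-monoʳ-≤ (Ψ ^ r) h' ⟩
            Ψ ^ r * (Ψ * m'')     ≡⟨ trans (sym (*-assoc (Ψ ^ r) Ψ m'')) (cong (_* m'') (*-comm (Ψ ^ r) Ψ)) ⟩
            Ψ ^ suc r * m''       ∎)
            where open ≤-Reasoning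

-- Removing coincidences from families of zero-sum tuples

instance
  enumBool : Enum Bool
  enumBool = record { elems = false ∷ true ∷ [] ; _≟_ = Bool._≟_ ; once = λ { true → refl ; false → refl } }

∑-strict : {{E : Enum 𝕏}} {f g : 𝕏 → ℕ} (a : 𝕏) → (∀ x → f x ≤ g x) → f a < g a → ∑ f < ∑ g
∑-strict {f = f} {g} a le lt = begin-strict
  ∑ f                               <⟨ n<1+n (∑ f) ⟩
  suc (∑ f)                         ≡⟨ trans (+-comm 1 (∑ f)) (cong (∑ f +_) (sym (∑-once a))) ⟩
  ∑ f + ∑ (λ x → χ (x ≟ a))         ≡⟨ sym (∑-+ f (λ x → χ (x ≟ a))) ⟩
  ∑ (λ x → f x + χ (x ≟ a))         ≤⟨ ∑-mono pt ⟩
  ∑ g                               ∎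
  where
  open ≤-Reasoning
  pt : ∀ x → f x + χ (x ≟ a) ≤ g x
  pt x with x ≟ a
  ... | yes refl = ≤-trans (≤-reflexive (+-comm (f x) 1)) lt
  ... | no _     = ≤-trans (≤-reflexive (+-identityʳ (f x))) (le x)

-- The quantity Ψ of the recombination argument, as a function of the number p of colours and the
-- sample size l.
spectrum : ℕ → ℕ → ℕ → ℕ
spectrum p k l = suc (p ^ suc k + (suc k ^ p + k)) * l ^ suc k

-- `types` bounds the number of equality patterns of p-tuples. With `shrink` old tuples for each new
-- one, p of them may be blocked by it and more than `types` remain, so one pattern recurs often
-- enough. In `loss`, the exponent p² bounds the number of coincidences to be removed, and 2 pays
-- for rounding.
types shrink loss : ℕ → ℕ
types p  = size (Vec (Vec Bool p) p)
shrink p = types p + p + 1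
loss p   = 2 * shrink p ^ (p * p)

-- The factors before the last one turn the failure of `Sparse` for a family into a density for the
-- whole sequence. The last one ensures that families keep Ψ^K tuples.
descent-bound : ℕ → ℕ → ℕ → ℕ
descent-bound k p l = loss p ^ suc k * ((spectrum p k l ^ k) ^ suc k * spectrum p k l) * spectrum p k l ^ suc k

module Families (V : Set) {{enumV : Enum V}} (_⊹_ : V → V → V) (𝟘 : V) (⊖_ : V → V)
                (isAG : IsAbelianGroup _≡_ _⊹_ 𝟘 ⊖_) where

  open Additive V _⊹_ 𝟘 ⊖_ isAG
  open Structure V _⊹_ 𝟘 ⊖_ isAG using (module Sequence)
  open GroupSums V _⊹_ 𝟘 ⊖_ isAG

  σ-tabulate : ∀ {M n} (y : Fin M → V) (f : Fin n → Fin M) → σ y (Vec.tabulate f) ≡ gsum (y ∘ f)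
  σ-tabulate {n = zero}  y f = refl
  σ-tabulate {n = suc n} y f = cong (y (f zero) ⊹_) (σ-tabulate y (f ∘ suc))

  ZeroSumFree : ℕ → ∀ {M} → (Fin M → V) → Set
  ZeroSumFree p {M} y = ¬ (Σ (Fin p → Fin M) λ g → Injective g × gsum (y ∘ g) ≡ 𝟘)

  module Descent (p k l : ℕ) (torsion : ∀ v → gsum {p} (λ _ → v) ≡ 𝟘) (k<p : suc k ≤ p) (k<l : suc k ≤ l)
    (slice : ∀ (X : Fin p → Fin l → V) (S : Fin p → Bool) (u : V) ja jb → ja ∈ S → jb ∈ S → ja ≢ jb →
      p ≤ # S * suc k →
      (∀ (a : Fin p → Fin l) i → (∀ j → j ∈ S → a j ≡ i) → gsum (λ j → mask (S j) (X j (a j))) ≡ u) →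
      (∀ (a : Fin p → Fin l) → gsum (λ j → mask (S j) (X j (a j))) ≡ u →
        ∀ j j' → j ∈ S → j' ∈ S → a j ≡ a j') → ⊥) where

    K = suc k

    Ψ : ℕ
    Ψ = spectrum p k l

    1≤p : 1 ≤ p
    1≤p = ≤-trans (s≤s z≤n) k<p

    1≤Ψ : 1 ≤ Ψ
    1≤Ψ = *-pos {suc (p ^ K + (K ^ p + k))} (s≤s z≤n) (^-pos K (≤-trans (s≤s z≤n) k<l))

    Λ : ℕ
    Λ = shrink p

    1≤Λ : 1 ≤ Λ
    1≤Λ = m≤n+m 1 (types p + p)

    κ₀ : ℕ
    κ₀ = loss p

    1≤κ₀ : 1 ≤ κ₀
    1≤κ₀ = *-pos {2} (s≤s z≤n) (^-pos (p * p) 1≤Λ)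

    bound : ℕ
    bound = descent-bound k p l

    -- Ordered pairs are counted and the diagonal is included, so the value is at most p² and never
    -- 0.
    coll : ∀ {M} → (Fin p → Fin M) → ℕ
    coll g = ∑ (λ j → # (λ j' → does (g j ≟ g j')))

    pattern-of : ∀ {M} → (Fin p → Fin M) → Vec (Vec Bool p) p
    pattern-of g = Vec.tabulate (λ j → Vec.tabulate (λ j' → does (g j ≟ g j')))

    pattern-eq : ∀ {M} (g g' : Fin p → Fin M) → pattern-of g ≡ pattern-of g' → ∀ j j' → g j ≡ g j' → g' j ≡ g' j'
    pattern-eq g g' e j j' q = out (g' j ≟ g' j') (subst T (trans (sym (at g)) (trans (cong (λ v → Vec.lookup (Vec.lookup v j) j') e) (at g'))) (into (g j ≟ g j') q))
      where
      at : ∀ g → Vec.lookup (Vec.lookup (pattern-of g) j) j' ≡ does (g j ≟ g j')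
      at g = trans (cong (λ v → Vec.lookup v j') (Vec.lookup∘tabulate (λ j → Vec.tabulate (λ j' → does (g j ≟ g j'))) j))
        (Vec.lookup∘tabulate (λ j' → does (g j ≟ g j')) j')

    module _ {M : ℕ} (y : Fin M → V) (1≤M : 1 ≤ M) (free : ZeroSumFree p y)
      (none : (F : Vec (Fin M) K → Bool) → size (Vec (Fin M) K) ≤ bound * # F → Sequence.Determined y 1≤M F → ⊥) where

      Disjoint : ∀ {N} → (Fin N → Fin p → Fin M) → Set
      Disjoint f = ∀ i i' j j' → f i j ≡ f i' j' → i ≡ i'

      record Family (e N : ℕ) : Set where
        field
          mem  : Fin N → Fin p → Fin M
          disj : Disjoint mem
          zero-sum : ∀ i → gsum (y ∘ mem i) ≡ 𝟘
          few  : ∀ i → coll (mem i) ≤ e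

      module Uniform {m : ℕ} (h : Fin m → Fin p → Fin M) (disj : Disjoint h)
        (zero-sum : ∀ i → gsum (y ∘ h i) ≡ 𝟘)
        (uniform : ∀ i i' j j' → h i j ≡ h i j' → h i' j ≡ h i' j')
        (M≤ : M ≤ κ₀ * m) (large : Ψ ^ K ≤ m) where

        i₀ : Fin m
        i₀ = Fin.fromℕ< (≤-trans (^-pos K 1≤Ψ) large)

        mixed : (Fin p → Fin m) → Fin p → Fin M
        mixed a j = h (a j) j

        -- By disjointness, a coincidence in a mixed tuple has both entries from the same old tuple,
        -- and by uniformity it is then present in all of them. The coincidence of j₁ and j₂ is
        -- lost.
        mixed-coll : ∀ a j₁ j₂ → h i₀ j₁ ≡ h i₀ j₂ → a j₁ ≢ a j₂ → coll (mixed a) < coll (h i₀)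
        mixed-coll a j₁ j₂ e ne = ∑-strict j₁
          (λ j → #-mono {F = λ j' → does (mixed a j ≟ mixed a j')} {λ j' → does (h i₀ j ≟ h i₀ j')} (sub j))
          (subst₂ _<_ (sym (#-def _)) (sym (#-def _)) (∑-strict j₂ (λ j' → 𝟙-mono (sub j₁ j'))
            (subst₂ _<_ (sym (𝟙-no (λ q → ne (disj _ _ _ _ (out (mixed a j₁ ≟ mixed a j₂) q)))))
                        (sym (𝟙-yes (into (h i₀ j₁ ≟ h i₀ j₂) e))) ≤-refl)))
          where
          sub : ∀ j j' → T (does (mixed a j ≟ mixed a j')) → T (does (h i₀ j ≟ h i₀ j'))
          sub j j' q = into (h i₀ j ≟ h i₀ j') (uniform (a j) i₀ j j' (trans e' (cong (λ i → h i j') (sym (disj _ _ _ _ e')))))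
            where
            e' : h (a j) j ≡ h (a j') j'
            e' = out (mixed a j ≟ mixed a j') q

        module Locked (j₁ j₂ : Fin p) (j₁≢j₂ : j₁ ≢ j₂)
          (locked : ∀ (a : Fin p → Fin m) → gsum (λ j → y (h (a j) j)) ≡ 𝟘 → a j₁ ≡ a j₂) where

          open Recombine (λ j i → y (h i j)) zero-sum j₁ j₂ j₁≢j₂ locked

          place : (Fin K → Fin p) → Vec (Fin m) K → Vec (Fin M) K
          place c w = Vec.tabulate (λ t → h (Vec.lookup w t) (c t))

          place-inj : ∀ c w w' → place c w ≡ place c w' → w ≡ w'
          place-inj c w w' e = trans (sym (Vec.tabulate∘lookup w)) (trans (Vec.tabulate-cong pt) (Vec.tabulate∘lookup w'))
            where
            pt : ∀ t → Vec.lookup w t ≡ Vec.lookup w' t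
            pt t = disj _ _ (c t) (c t) (trans (sym (Vec.lookup∘tabulate (λ t → h (Vec.lookup w t) (c t)) t))
              (trans (cong (λ v → Vec.lookup v t) e) (Vec.lookup∘tabulate (λ t → h (Vec.lookup w' t) (c t)) t)))

          placed : (Fin K → Fin p) → Vec (Fin M) K → Bool
          placed c W = does (any? (λ w → ∈? (Bad c) w ×-dec (place c w ≟ W)))

          placed-determined : ∀ c → Sequence.Determined y 1≤M (placed c)
          placed-determined c W W' hW hW' e with out (any? (λ w → ∈? (Bad c) w ×-dec (place c w ≟ W))) hW
                                               | out (any? (λ w → ∈? (Bad c) w ×-dec (place c w ≟ W'))) hW'
          ... | w , bw , refl | w' , _ , refl = cong (λ i → h i (c zero)) (trans (sym (head-lookup w)) (trans heads (head-lookup w')))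
            where
            τ≡ : τ c w' ≡ τ c w
            τ≡ = trans (sym (σ-tabulate y (λ t → h (Vec.lookup w' t) (c t)))) (trans (sym e) (σ-tabulate y (λ t → h (Vec.lookup w t) (c t))))
            heads : Vec.head w ≡ Vec.head w'
            heads = decidable-stable (Vec.head w ≟ Vec.head w')
              (λ n → out (¬? (movable? c w)) bw (w' , τ≡ , λ q → n (sym q)))

          -- Otherwise the bad tuples, placed in the sequence, would be a dense set on which the sum
          -- determines the first term, which `none` excludes.
          sparse : ∀ (c : Fin K → Fin p) → (Ψ ^ k) ^ K * Ψ * # (Bad c) < m ^ K
          sparse c = decidable-stable (_ <? _) (λ n → none (placed c) (dense (≮⇒≥ n)) (placed-determined c))
            where
            open ≤-Reasoning
            dense : m ^ K ≤ (Ψ ^ k) ^ K * Ψ * # (Bad c) → size (Vec (Fin M) K) ≤ bound * # (placed c)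
            dense d = begin
              size (Vec (Fin M) K)                        ≡⟨ trans (size-Vec K) (cong (_^ K) (size-Fin M)) ⟩
              M ^ K                                       ≤⟨ ^-monoˡ-≤ K M≤ ⟩
              (κ₀ * m) ^ K                                 ≡⟨ *-^ K κ₀ m ⟩
              κ₀ ^ K * m ^ K                               ≤⟨ *-monoʳ-≤ (κ₀ ^ K) d ⟩
              κ₀ ^ K * ((Ψ ^ k) ^ K * Ψ * # (Bad c))       ≡⟨ sym (*-assoc (κ₀ ^ K) ((Ψ ^ k) ^ K * Ψ) (# (Bad c))) ⟩
              κ₀ ^ K * ((Ψ ^ k) ^ K * Ψ) * # (Bad c)       ≤⟨ *-mono-≤ (≤-trans (≤-reflexive (sym (*-identityʳ (κ₀ ^ K * ((Ψ ^ k) ^ K * Ψ))))) (*-monoʳ-≤ (κ₀ ^ K * ((Ψ ^ k) ^ K * Ψ)) (^-pos K 1≤Ψ)))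
                  (#-inj {F = Bad c} {placed c} (place c) (place-inj c) (λ w hw → into (any? (λ w' → ∈? (Bad c) w' ×-dec (place c w' ≟ place c w))) (w , hw , refl))) ⟩
              bound * # (placed c)                        ∎

          absurd : ⊥
          absurd = Splitting.unlocked k l k<p k<l slice large (λ c _ → sparse (Vec.lookup c))

        -- Without a coincidence the tuple at i₀ would be a zero sum of p different terms. With one,
        -- `Locked` shows that some zero-sum recombination separates the coincident pair.
        improve : ((a : Fin p → Fin m) → gsum (y ∘ mixed a) ≡ 𝟘 → coll (mixed a) < coll (h i₀) → ⊥) → ⊥
        improve next with any? (λ j₁ → any? (λ j₂ → ¬? (j₁ ≟ j₂) ×-dec (h i₀ j₁ ≟ h i₀ j₂)))
        ... | no n = free (h i₀ , (λ s t e → decidable-stable (s ≟ t) (λ ne → n (s , t , ne , e))) , zero-sum i₀)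
        ... | yes (j₁ , j₂ , ne , e) = lem (Σ (Fin p → Fin m) λ a → gsum (y ∘ mixed a) ≡ 𝟘 × a j₁ ≢ a j₂) λ where
          (yes (a , az , q)) → next a az (mixed-coll a j₁ j₂ e q)
          (no nx) → Locked.absurd j₁ j₂ ne (λ a az → decidable-stable (a j₁ ≟ a j₂) (λ q → nx (a , az , q)))

      module Grow {e N N' : ℕ} (fam : Family (suc e) N) (Λ≤ : Λ * N' ≤ N) (1≤N' : 1 ≤ N')
        (M≤ : M ≤ κ₀ * N') (large : Ψ ^ K ≤ N') where

        open Family fam

        hit : ∀ {n} → (Fin n → Fin p → Fin M) → Fin n → Fin p → Fin N → Bool
        hit g s j' i = does (any? (λ j → mem i j ≟ g s j'))

        used : ∀ {n} → (Fin n → Fin p → Fin M) → Fin N → Bool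
        used g i = does (any? (λ s → ∈? (λ i → does (any? (λ j' → ∈? (hit g s j') i))) i))

        used-few : ∀ {n} (g : Fin n → Fin p → Fin M) → # (used g) ≤ n * p
        used-few {n} g = begin
          # (used g)                                                   ≤⟨ #-any (λ s i → does (any? (λ j' → ∈? (hit g s j') i))) ⟩
          ∑ (λ s → # (λ i → does (any? (λ j' → ∈? (hit g s j') i))))   ≤⟨ ∑-mono (λ s → ≤-trans (#-any (hit g s)) (≤-trans (∑-mono (one s)) (≤-reflexive (size-Fin p)))) ⟩
          ∑ {Fin n} (λ s → p)                                          ≡⟨ trans (∑-const {Fin n} p) (trans (cong (p *_) (size-Fin n)) (*-comm p n)) ⟩
          n * p                                                        ∎
          where
          open ≤-Reasoning
          one : ∀ s j' → # (hit g s j') ≤ 1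
          one s j' = #-unique (λ i i' hi hi' →
            let (j , e) = out (any? (λ j → mem i j ≟ g s j')) hi
                (j″ , e') = out (any? (λ j → mem i' j ≟ g s j')) hi'
            in disj i i' j j″ (trans e (sym e')))

        room : ∀ {n} (g : Fin n → Fin p → Fin M) → n ≤ N' → N' * types p < # (λ i → not (used g i))
        room {n} g n≤ = +-cancelʳ-< (N' * p) (N' * types p) (# (λ i → not (used g i))) (begin-strict
          N' * types p + N' * p                      <⟨ m<m+n (N' * types p + N' * p) 1≤N' ⟩
          N' * types p + N' * p + N'                 ≡⟨ e₁ N' (types p) p ⟩
          Λ * N'                                   ≤⟨ Λ≤ ⟩
          N                                        ≡⟨ sym (trans (#-def {Fin N} everything) (size-Fin N)) ⟩
          # {Fin N} everything                     ≡⟨ #-split everything (used g) ⟩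
          # (used g) + # (λ i → not (used g i))    ≤⟨ +-monoˡ-≤ _ (≤-trans (used-few g) (*-monoˡ-≤ p n≤)) ⟩
          N' * p + # (λ i → not (used g i))        ≡⟨ +-comm (N' * p) _ ⟩
          # (λ i → not (used g i)) + N' * p        ∎)
          where
          open ≤-Reasoning
          open Structure V _⊹_ 𝟘 ⊖_ isAG using (everything)
          e₁ : ∀ n t p → n * t + n * p + n ≡ (t + p + 1) * n
          e₁ = solve-∀

        extend : ∀ {n} → Family e n → n ≤ N' → (Family e (suc n) → ⊥) → ⊥
        extend {n} old n≤ next with pick (λ i → not (used (Family.mem old) i)) ≤-refl
        ... | ι , ι-inj , fresh-ι with pigeon (pattern-of ∘ mem ∘ ι) N' (room (Family.mem old) n≤)
        ...   | ty , κ , κ-inj , same = Uniform.improve h h-disj (λ i → zero-sum (ι (κ i)))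
                  (λ i i' → pattern-eq (h i) (h i') (trans (same i) (sym (same i'))))
                  (≤-trans M≤ (*-monoʳ-≤ κ₀ (n≤1+n N'))) (≤-trans large (n≤1+n N')) found
          where
          open Family old renaming (mem to mem'; disj to disj'; zero-sum to zero-sum'; few to few') using ()
          h : Fin (suc N') → Fin p → Fin M
          h i = mem (ι (κ i))
          h-disj : Disjoint h
          h-disj i i' j j' q = κ-inj i i' (ι-inj _ _ (disj _ _ j j' q))
          found : (a : Fin p → Fin (suc N')) → gsum (y ∘ (λ j → h (a j) j)) ≡ 𝟘 →
            coll (λ j → h (a j) j) < coll (h _) → ⊥
          found a az lt = next (record { mem = mem″ ; disj = disj″ ; zero-sum = zero-sum″ ; few = few″ })
            where
            mem″ : Fin (suc n) → Fin p → Fin M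
            mem″ zero    j = h (a j) j
            mem″ (suc s) j = mem' s j
            apart : ∀ j s j' → h (a j) j ≢ mem' s j'
            apart j s j' q = not-out (fresh-ι (κ (a j))) (into (any? _) (s , into (any? _) (j' , into (any? _) (j , q))))
            disj″ : Disjoint mem″
            disj″ zero    zero     j j' q = refl
            disj″ zero    (suc s)  j j' q = ⊥-elim (apart j s j' q)
            disj″ (suc s) zero     j j' q = ⊥-elim (apart j' s j (sym q))
            disj″ (suc s) (suc s') j j' q = cong suc (disj' s s' j j' q)
            zero-sum″ : ∀ s → gsum (y ∘ mem″ s) ≡ 𝟘
            zero-sum″ zero    = az
            zero-sum″ (suc s) = zero-sum' s
            few″ : ∀ s → coll (mem″ s) ≤ e
            few″ zero    = s≤s⁻¹ (≤-trans lt (few _))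
            few″ (suc s) = few' s

        grow : ∀ n → n ≤ N' → (Family e n → ⊥) → ⊥
        grow zero    le next = next (record { mem = λ () ; disj = λ () ; zero-sum = λ () ; few = λ () })
        grow (suc n) le next = grow n (<⇒≤ le) (λ old → extend old (<⇒≤ le) next)

      -- Each lowering of e costs a factor Λ in the number of tuples, and at e = 0 the diagonal
      -- pairs alone exceed the allowed number of coincidences.
      no-family : ∀ e u → Ψ ^ K ≤ u → M ≤ κ₀ * u → Family e (u * Λ ^ e) → ⊥
      no-family zero u large M≤ fam = <⇒≱ (≤-trans inner (∑-≥ (λ j → # (λ j' → does (g j ≟ g j'))) j₀)) (Family.few fam i₀)
        where
        1≤u : 1 ≤ u
        1≤u = ≤-trans (^-pos K 1≤Ψ) large
        i₀ : Fin (u * 1)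
        i₀ = Fin.fromℕ< (≤-trans 1≤u (≤-reflexive (sym (*-identityʳ u))))
        g = Family.mem fam i₀
        j₀ : Fin p
        j₀ = Fin.fromℕ< 1≤p
        inner : 1 ≤ # (λ j' → does (g j₀ ≟ g j'))
        inner = #-pos {F = λ j' → does (g j₀ ≟ g j')} {j₀} (into (g j₀ ≟ g j₀) refl)
      no-family (suc e) u large M≤ fam = Grow.grow fam (≤-reflexive (e₁ Λ u (Λ ^ e))) (*-pos 1≤u (^-pos e 1≤Λ))
          (≤-trans M≤ (*-monoʳ-≤ κ₀ u≤)) (≤-trans large u≤) (u * Λ ^ e) ≤-refl (no-family e u large M≤)
        where
        1≤u : 1 ≤ u
        1≤u = ≤-trans (^-pos K 1≤Ψ) large
        u≤ : u ≤ u * Λ ^ e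
        u≤ = ≤-trans (≤-reflexive (sym (*-identityʳ u))) (*-monoʳ-≤ u (^-pos e 1≤Λ))
        e₁ : ∀ l u w → l * (u * w) ≡ u * (l * w)
        e₁ = solve-∀

      contradiction-from-size : bound ≤ M → ⊥
      contradiction-from-size big = no-family (p * p) u Ψ≤u M≤κ₀u (record
          { mem = λ i _ → Fin.inject≤ i u*≤M
          ; disj = λ i i' _ _ e → Fin.inject≤-injective u*≤M u*≤M i i' e
          ; zero-sum = λ i → torsion (y (Fin.inject≤ i u*≤M))
          ; few = λ i → ≤-trans (∑-mono (λ j → ≤-trans (#-≤size _) (≤-reflexive (size-Fin p))))
                    (≤-reflexive (trans (∑-const {Fin p} p) (cong (p *_) (size-Fin p)))) })
        where
        open ≤-Reasoning
        B = Λ ^ (p * p)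
        1≤B : 1 ≤ B
        1≤B = ^-pos (p * p) 1≤Λ
        instance
          nzB : NonZero B
          nzB = >-nonZero 1≤B
        -- As u is at least 1, rounding down loses at most a factor 2, the one in `loss`.
        u = M / B
        ΨB≤M : Ψ ^ K * B ≤ M
        ΨB≤M = begin
          Ψ ^ K * B                                   ≡⟨ *-comm (Ψ ^ K) B ⟩
          B * Ψ ^ K                                   ≤⟨ *-monoˡ-≤ (Ψ ^ K) (begin
            B                                           ≤⟨ m≤n*m B 2 ⟩
            κ₀                                           ≡⟨ sym (*-identityʳ κ₀) ⟩
            κ₀ * 1                                       ≤⟨ *-monoʳ-≤ κ₀ (^-pos k 1≤κ₀) ⟩
            κ₀ ^ K                                       ≡⟨ sym (*-identityʳ (κ₀ ^ K)) ⟩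
            κ₀ ^ K * 1                                   ≤⟨ *-monoʳ-≤ (κ₀ ^ K) (*-pos (^-pos K (^-pos k 1≤Ψ)) 1≤Ψ) ⟩
            κ₀ ^ K * ((Ψ ^ k) ^ K * Ψ)                   ∎) ⟩
          bound                                       ≤⟨ big ⟩
          M                                           ∎
        Ψ≤u : Ψ ^ K ≤ u
        Ψ≤u = ≤-trans (≤-reflexive (sym (m*n/n≡m (Ψ ^ K) B))) (/-mono-≤ ΨB≤M (≤-refl {B}))
        1≤u : 1 ≤ u
        1≤u = ≤-trans (^-pos K 1≤Ψ) Ψ≤u
        u*≤M : u * B ≤ M
        u*≤M = m/n*n≤m M B
        M≤κ₀u : M ≤ κ₀ * u
        M≤κ₀u = begin
          M                ≡⟨ m≡m%n+[m/n]*n M B ⟩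
          M % B + u * B   ≤⟨ +-monoˡ-≤ (u * B) (<⇒≤ (m%n<n M B)) ⟩
          suc u * B        ≤⟨ *-monoˡ-≤ B (≤-trans (+-monoˡ-≤ u 1≤u) (≤-reflexive (cong (u +_) (sym (+-identityʳ u))))) ⟩
          2 * u * B        ≡⟨ e₁ u B ⟩
          κ₀ * u            ∎
          where
          e₁ : ∀ u b → 2 * u * b ≡ 2 * b * u
          e₁ = solve-∀

    determined : ∀ {M} (y : Fin M → V) (1≤M : 1 ≤ M) → bound ≤ M → ZeroSumFree p y →
      ((F : Vec (Fin M) (suc k) → Bool) → size (Vec (Fin M) (suc k)) ≤ bound * # F →
       Sequence.Determined y 1≤M F → ⊥) → ⊥
    determined y 1≤M big free none = contradiction-from-size y 1≤M free none big

-- Vectors of residues modulo p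

nsum : ∀ {m} → (Fin m → ℕ) → ℕ
nsum {zero}  f = 0
nsum {suc m} f = f zero + nsum (f ∘ suc)

nsum-cong : ∀ {m} {f g : Fin m → ℕ} → (∀ i → f i ≡ g i) → nsum f ≡ nsum g
nsum-cong {zero}  e = refl
nsum-cong {suc m} e = cong₂ _+_ (e zero) (nsum-cong (e ∘ suc))

sumZ-pos : ∀ {m} (f : Fin m → ℕ) → sumZ (pos ∘ f) ≡ pos (nsum f)
sumZ-pos {zero}  f = sumZ-zero
sumZ-pos {suc m} f = trans (sumZ-suc (pos ∘ f)) (trans (cong (pos (f zero) +ᶻ_) (sumZ-pos (f ∘ suc))) refl)

module Residues (p : ℕ) {{_ : NonZero p}} where

  0%p≡0 : 0 % p ≡ 0
  0%p≡0 = m*n%n≡0 0 p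

  md : ℕ → Fin p
  md m = Fin.fromℕ< (m%n<n m p)

  toℕ-md : ∀ m → toℕ (md m) ≡ m % p
  toℕ-md m = Fin.toℕ-fromℕ< (m%n<n m p)

  md-toℕ : ∀ a → md (toℕ a) ≡ a
  md-toℕ a = Fin.toℕ-injective (trans (toℕ-md (toℕ a)) (m<n⇒m%n≡m (Fin.toℕ<n a)))

  md-≡ : ∀ {a b} → a % p ≡ b % p → md a ≡ md b
  md-≡ {a} {b} e = Fin.toℕ-injective (trans (toℕ-md a) (trans e (sym (toℕ-md b))))

  add : Fin p → Fin p → Fin p
  add a b = md (toℕ a + toℕ b)

  neg : Fin p → Fin p
  neg a = md (p ∸ toℕ a)

  add-mdˡ : ∀ m b → add (md m) b ≡ md (m + toℕ b)
  add-mdˡ m b = md-≡ (begin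
    (toℕ (md m) + toℕ b) % p              ≡⟨ cong (λ z → (z + toℕ b) % p) (toℕ-md m) ⟩
    (m % p + toℕ b) % p                   ≡⟨ %-distribˡ-+ (m % p) (toℕ b) p ⟩
    (m % p % p + toℕ b % p) % p           ≡⟨ cong (λ z → (z + toℕ b % p) % p) (m%n%n≡m%n m p) ⟩
    (m % p + toℕ b % p) % p               ≡⟨ sym (%-distribˡ-+ m (toℕ b) p) ⟩
    (m + toℕ b) % p                       ∎)
    where open ≡-Reasoning

  add-comm : ∀ a b → add a b ≡ add b a
  add-comm a b = cong md (+-comm (toℕ a) (toℕ b))

  add-mdʳ : ∀ a m → add a (md m) ≡ md (toℕ a + m)
  add-mdʳ a m = trans (add-comm a (md m)) (trans (add-mdˡ m a) (cong md (+-comm m (toℕ a))))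

  add-assoc : ∀ a b c → add (add a b) c ≡ add a (add b c)
  add-assoc a b c = trans (add-mdˡ (toℕ a + toℕ b) c) (trans (cong md (+-assoc (toℕ a) (toℕ b) (toℕ c)))
    (sym (add-mdʳ a (toℕ b + toℕ c))))

  add-0ˡ : ∀ a → add (md 0) a ≡ a
  add-0ˡ a = trans (add-mdˡ 0 a) (md-toℕ a)

  add-0ʳ : ∀ a → add a (md 0) ≡ a
  add-0ʳ a = trans (add-comm a (md 0)) (add-0ˡ a)

  add-negʳ : ∀ a → add a (neg a) ≡ md 0
  add-negʳ a = trans (add-mdʳ a (p ∸ toℕ a)) (md-≡ (trans (cong (_% p) (m+[n∸m]≡n (<⇒≤ (Fin.toℕ<n a)))) (trans (n%n≡0 p) (sym 0%p≡0))))

  add-negˡ : ∀ a → add (neg a) a ≡ md 0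
  add-negˡ a = trans (add-comm (neg a) a) (add-negʳ a)

  module _ (n : ℕ) where

    Vector : Set
    Vector = Vec (Fin p) n

    addV : Vector → Vector → Vector
    addV = Vec.zipWith add

    zeroV : Vector
    zeroV = Vec.replicate n (md 0)

    negV : Vector → Vector
    negV = Vec.map neg

    vectors-abelian : IsAbelianGroup _≡_ addV zeroV negV
    vectors-abelian = record
      { isGroup = record
        { isMonoid = record
          { isSemigroup = record
            { isMagma = record { isEquivalence = isEquivalence ; ∙-cong = cong₂ addV }
            ; assoc = Vec.zipWith-assoc add-assoc }
          ; identity = Vec.zipWith-identityˡ add-0ˡ , Vec.zipWith-identityʳ add-0ʳ }
        ; inverse = Vec.zipWith-inverseˡ add-negˡ , Vec.zipWith-inverseʳ add-negʳ
        ; ⁻¹-cong = cong negV }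
      ; comm = Vec.zipWith-comm add-comm }

    open GroupSums Vector addV zeroV negV vectors-abelian public

    lookup-gsum : ∀ {m} (w : Fin m → Vector) c → toℕ (Vec.lookup (gsum w) c) ≡ nsum (λ j → toℕ (Vec.lookup (w j) c)) % p
    lookup-gsum {zero}  w c = trans (cong toℕ (Vec.lookup-replicate c (md 0))) (toℕ-md 0)
    lookup-gsum {suc m} w c = begin
      toℕ (Vec.lookup (addV (w zero) (gsum (w ∘ suc))) c)     ≡⟨ cong toℕ (Vec.lookup-zipWith add c (w zero) (gsum (w ∘ suc))) ⟩
      toℕ (add a (Vec.lookup (gsum (w ∘ suc)) c))             ≡⟨ cong (λ z → toℕ (add a z)) (trans (sym (md-toℕ _)) (trans (cong md (lookup-gsum (w ∘ suc) c)) (md-≡ (m%n%n≡m%n s p)))) ⟩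
      toℕ (add a (md s))                                      ≡⟨ trans (cong toℕ (add-mdʳ a s)) (toℕ-md (toℕ a + s)) ⟩
      (toℕ a + s) % p                                         ∎
      where
      open ≡-Reasoning
      a = Vec.lookup (w zero) c
      s = nsum (λ j → toℕ (Vec.lookup (w (suc j)) c))

    size-Vector : size Vector ≡ p ^ n
    size-Vector = trans (size-Vec n) (cong (_^ n) (size-Fin p))

    vector-ext : ∀ {u w : Vector} → (∀ c → toℕ (Vec.lookup u c) ≡ toℕ (Vec.lookup w c)) → u ≡ w
    vector-ext {u} {w} h = trans (sym (Vec.tabulate∘lookup u))
      (trans (Vec.tabulate-cong (λ c → Fin.toℕ-injective (h c))) (Vec.tabulate∘lookup w))

    torsion : ∀ v → gsum {p} (λ _ → v) ≡ zeroV
    torsion v = vector-ext (λ c → begin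
      toℕ (Vec.lookup (gsum {p} (λ _ → v)) c)        ≡⟨ lookup-gsum {p} (λ _ → v) c ⟩
      nsum {p} (λ _ → toℕ (Vec.lookup v c)) % p      ≡⟨ cong (_% p) (const p (toℕ (Vec.lookup v c))) ⟩
      (p * toℕ (Vec.lookup v c)) % p                 ≡⟨ trans (cong (_% p) (*-comm p _)) (m*n%n≡0 (toℕ (Vec.lookup v c)) p) ⟩
      0                                              ≡⟨ sym (trans (cong toℕ (Vec.lookup-replicate c (md 0))) (trans (toℕ-md 0) 0%p≡0)) ⟩
      toℕ (Vec.lookup zeroV c)                       ∎)
      where
      open ≡-Reasoning
      const : ∀ k a → nsum {k} (λ _ → a) ≡ k * a
      const zero    a = refl
      const (suc k) a = cong (a +_) (const k a)

module PrimeVectors (p : ℕ) (pp : Prime p) (n : ℕ) where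

  open ModuloSlice p pp using (P∣; P∣?; 1<p; p≢0; module Slice)
  open Residues p {{p≢0}}

  private V = Vector n

  divides-difference : ∀ N b → b < p → P∣ (pos N -ᶻ pos b) → N % p ≡ b
  divides-difference N b b<p d = ≤-antisym (side (N % p) b (m%n<n N p) dr) (side b (N % p) b<p (subst P∣ (r₂ (pos (N % p)) (pos b)) (∣ᶻ.∣m⇒∣-m dr)))
    where
    r₁ : ∀ N b r q → N ≡ r +ᶻ q → r -ᶻ b ≡ (N -ᶻ b) -ᶻ q
    r₁ N b r q refl = e r q b
      where
      e : ∀ r q b → r -ᶻ b ≡ ((r +ᶻ q) -ᶻ b) -ᶻ q
      e = solveᶻ-∀
    r₂ : ∀ r b → -ᶻ (r -ᶻ b) ≡ b -ᶻ r
    r₂ = solveᶻ-∀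
    split : pos N ≡ pos (N % p) +ᶻ pos (N / p) *ᶻ pos p
    split = trans (cong pos (m≡m%n+[m/n]*n N p)) (trans (ℤ.pos-+ (N % p) _) (cong (pos (N % p) +ᶻ_) (ℤ.pos-* (N / p) p)))
    dr : P∣ (pos (N % p) -ᶻ pos b)
    dr = subst P∣ (sym (r₁ (pos N) (pos b) (pos (N % p)) (pos (N / p) *ᶻ pos p) split))
           (∣ᶻ.∣m∣n⇒∣m-n d (∣ᶻ.divides (pos (N / p)) refl))
    side : ∀ a b → a < p → P∣ (pos a -ᶻ pos b) → a ≤ b
    side a b a<p d with a ≤? b
    ... | yes h = h
    ... | no n = ⊥-elim (<⇒≱ (≤-<-trans (m∸n≤m a b) a<p)
          (∣ᴺ.∣⇒≤ {{>-nonZero (m<n⇒0<n∸m (≰⇒> n))}} (∣ᶻ.∣⇒∣ᵤ (subst P∣ (trans (ℤ.m-n≡m⊖n a b) (ℤ.⊖-≥ (<⇒≤ (≰⇒> n)))) d))))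

  -- The colours outside S are masked to zero before the residues are lifted to integers, so that
  -- the linear forms, which run over all colours, compute the sum over S.
  slice : ∀ k l → p * 2 ^ (n + suc k * n) < l →
    ∀ (X : Fin p → Fin l → V) (S : Fin p → Bool) (u : V) ja jb → ja ∈ S → jb ∈ S → ja ≢ jb → p ≤ # S * suc k →
    (∀ (a : Fin p → Fin l) i → (∀ j → j ∈ S → a j ≡ i) → gsum n (λ j → mask n (S j) (X j (a j))) ≡ u) →
    (∀ (a : Fin p → Fin l) → gsum n (λ j → mask n (S j) (X j (a j))) ≡ u → ∀ j j' → j ∈ S → j' ∈ S → a j ≡ a j') → ⊥
  slice k l big X S u ja jb sa sb ne p≤S diag only =
    slice-rank big ja jb sa sb ne
      (λ a i h → to-sol a (diag (Vec.lookup a) i h))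
      (λ a sol → only (Vec.lookup a) (from-sol a sol))
    where
    X' : Fin p → Fin l → Vec ℤ n
    X' j i = Vec.map (pos ∘ toℕ) (mask n (S j) (X j i))
    v : Fin n → ℤ
    v c = pos (toℕ (Vec.lookup u c))
    open Slice X' v S (suc k) p≤S (Fin.fromℕ< (≤-trans (s≤s z≤n) big)) using (slice-rank; Sol; Lin)
    total : (Fin p → Fin l) → Fin n → ℕ
    total a c = nsum (λ j → toℕ (Vec.lookup (mask n (S j) (X j (a j))) c))
    Lin≡ : ∀ a c → Lin a c ≡ pos (total (Vec.lookup a) c)
    Lin≡ a c = trans (sumZ-cong (λ j → Vec.lookup-map c (pos ∘ toℕ) (mask n (S j) (X j (Vec.lookup a j)))))
      (sumZ-pos (λ j → toℕ (Vec.lookup (mask n (S j) (X j (Vec.lookup a j))) c)))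
    to-sol : ∀ a → gsum n (λ j → mask n (S j) (X j (Vec.lookup a j))) ≡ u → Sol a
    to-sol a e c = subst P∣ (cong (_-ᶻ v c) (sym (Lin≡ a c))) (∣ᶻ.divides (pos (N / p)) eq)
      where
      N = total (Vec.lookup a) c
      r : ∀ b q → (b +ᶻ q) -ᶻ b ≡ q
      r = solveᶻ-∀
      eq : pos N -ᶻ v c ≡ pos (N / p) *ᶻ pos p
      eq = trans (cong₂ _-ᶻ_ (trans (cong pos (m≡m%n+[m/n]*n N p)) (trans (ℤ.pos-+ (N % p) _) (cong (pos (N % p) +ᶻ_) (ℤ.pos-* (N / p) p))))
                   (cong pos (trans (cong (λ u → toℕ (Vec.lookup u c)) (sym e)) (lookup-gsum n (λ j → mask n (S j) (X j (Vec.lookup a j))) c))))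
             (r (pos (N % p)) (pos (N / p) *ᶻ pos p))
    from-sol : ∀ a → Sol a → gsum n (λ j → mask n (S j) (X j (Vec.lookup a j))) ≡ u
    from-sol a sol = vector-ext n (λ c → trans (lookup-gsum n (λ j → mask n (S j) (X j (Vec.lookup a j))) c)
      (divides-difference (total (Vec.lookup a) c) (toℕ (Vec.lookup u c)) (Fin.toℕ<n (Vec.lookup u c))
        (subst P∣ (cong (_-ᶻ v c) (Lin≡ a c)) (sol c))))

-- How the constants depend on the prime and on the dimension

-- c becomes C_ε and d becomes D_{ε,m}: only d may depend on p.
Tame : (ℕ → ℕ → ℕ) → Set
Tame f = ∃[ c ] (∀ p → ∃[ d ] (∀ n → f p n ≤ d * c ^ n))

tame-p : (g : ℕ → ℕ) → Tame (λ p n → g p)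
tame-p g = 1 , λ p → g p , λ n → ≤-reflexive (trans (sym (*-identityʳ (g p))) (cong (g p *_) (sym (^-zeroˡ n))))

tame-exp : ∀ c → Tame (λ p n → c ^ n)
tame-exp c = c , λ p → 1 , λ n → ≤-reflexive (sym (*-identityˡ (c ^ n)))

tame-+ : ∀ {f g} → Tame f → Tame g → Tame (λ p n → f p n + g p n)
tame-+ (c , F) (c' , G) = c + c' , λ p → let (d , hf) = F p ; (d' , hg) = G p in d + d' , λ n →
  ≤-trans (+-mono-≤ (≤-trans (hf n) (*-monoʳ-≤ d (^-monoˡ-≤ n (m≤m+n c c'))))
                    (≤-trans (hg n) (*-monoʳ-≤ d' (^-monoˡ-≤ n (m≤n+m c' c)))))
          (≤-reflexive (sym (*-distribʳ-+ ((c + c') ^ n) d d')))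

tame-* : ∀ {f g} → Tame f → Tame g → Tame (λ p n → f p n * g p n)
tame-* (c , F) (c' , G) = c * c' , λ p → let (d , hf) = F p ; (d' , hg) = G p in d * d' , λ n →
  ≤-trans (*-mono-≤ (hf n) (hg n)) (≤-reflexive (trans (e d (c ^ n) d' (c' ^ n)) (cong (d * d' *_) (sym (*-^ n c c')))))
  where
  e : ∀ a b c d → a * b * (c * d) ≡ a * c * (b * d)
  e = solve-∀

tame-^ : ∀ {f} k → Tame f → Tame (λ p n → f p n ^ k)
tame-^ zero    F = tame-p (λ _ → 1)
tame-^ (suc k) F = tame-* F (tame-^ k F)

tame-const : ∀ k → Tame (λ _ _ → k)
tame-const k = tame-p (λ _ → k)

opaque
  unfolding cube

  tame-cube : ∀ {f} → Tame f → Tame (λ p n → cube (f p n))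
  tame-cube F = tame-* (tame-const 64) (tame-* F (tame-* F F))

tame-tower : ∀ i {f} → Tame f → Tame (λ p n → tower i (f p n))
tame-tower zero    F = tame-* (tame-const 4) F
tame-tower (suc i) F = tame-tower i (tame-cube F)

tame-need : ∀ q {bnd : ℕ → ℕ → ℕ → ℕ} → (∀ k → Tame (bnd k)) → ∀ g → Tame (λ p n → needOf q (λ k → bnd k p n) g)
tame-need q B zero    = tame-const 1
tame-need q B (suc g) = tame-* (tame-tower (expoOf q g) (tame-* (tame-const 2) (B (len (expoOf q g))))) (tame-need q B g)

-- Larger than p 2^(n + Kn) with K = k + 1, as `slice-rank` demands for a set with a share 1/K of
-- the colours, and at least K, to allow K different indices.
samples : ℕ → ℕ → ℕ → ℕ
samples k p n = suc (p * (2 ^ suc (suc k)) ^ n) + suc k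

-- The second summand serves the primes below K, where p equal terms are found by the pigeonhole
-- principle among p^n vectors; replacing p by K there keeps the base free of p.
threshold : ℕ → ℕ → ℕ → ℕ
threshold k p n = descent-bound k p (samples k p n) + suc (p * suc k ^ n)

tame-threshold : ∀ k → Tame (threshold k)
tame-threshold k = tame-+ (tame-* (tame-* (tame-^ (suc k) (tame-p loss)) (tame-* (tame-^ (suc k) (tame-^ k sp)) sp)) (tame-^ (suc k) sp))
    (tame-+ (tame-const 1) (tame-* (tame-p id) (tame-exp (suc k))))
  where
  sm : Tame (samples k)
  sm = tame-+ (tame-+ (tame-const 1) (tame-* (tame-p id) (tame-exp (2 ^ suc (suc k))))) (tame-const (suc k))
  sp : Tame (λ p n → spectrum p k (samples k p n))
  sp = tame-* (tame-p (λ p → suc (p ^ suc k + (suc k ^ p + k)))) (tame-^ (suc k) sm)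

-- Zero sums for a prime modulus

module PrimeCase (p : ℕ) (pp : Prime p) (n : ℕ) (1≤n : 1 ≤ n) where

  instance
    nzp : NonZero p
    nzp = prime⇒nonZero pp

  open Residues p
  open PrimeVectors p pp n using (slice)

  2≤p : 2 ≤ p
  2≤p = nonTrivial⇒n>1 p {{prime⇒nonTrivial pp}}

  open Families (Vector n) (addV n) (zeroV n) (negV n) (vectors-abelian n) using (ZeroSumFree; module Descent)
  open Structure (Vector n) (addV n) (zeroV n) (negV n) (vectors-abelian n) using (module Sequence; module Iterate)

  2≤v : 2 ≤ size (Vector n)
  2≤v = ≤-trans 2≤p (≤-trans (≤-trans (≤-reflexive (sym (^-identityʳ p))) (^-monoʳ-≤ p 1≤n)) (≤-reflexive (sym (size-Vector n))))

  repeated : ∀ {M} (y : Fin M → Vector n) → p * p ^ n < M → ¬ ZeroSumFree p y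
  repeated {M} y big free with pigeon y p (subst (λ v → p * v < M) (sym (size-Vector n)) big)
  ... | v , ι , inj , same = free (ι ∘ Fin.inject₁ , (λ s t e → Fin.inject₁-injective (inj _ _ e)) ,
        trans (gsum-cong n {p} (λ t → same (Fin.inject₁ t))) (torsion n v))

  determined : ∀ k {M} (y : Fin M → Vector n) (1≤M : 1 ≤ M) → threshold k p n ≤ M → ZeroSumFree p y →
    ((F : Vec (Fin M) (suc k) → Bool) → size (Vec (Fin M) (suc k)) ≤ threshold k p n * # F →
     Sequence.Determined y 1≤M F → ⊥) → ⊥
  determined k {M} y 1≤M big free none with suc k ≤? p
  ... | no p≤k = repeated y (≤-trans (s≤s (*-monoʳ-≤ p (^-monoˡ-≤ n (<⇒≤ (≰⇒> p≤k))))) (≤-trans (m≤n+m _ (descent-bound k p (samples k p n))) big)) free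
  ... | yes k<p = Descent.determined p k l (torsion n) k<p (m≤n+m (suc k) (suc (p * (2 ^ suc (suc k)) ^ n)))
        (slice k l l-big) y 1≤M (≤-trans (m≤m+n (descent-bound k p l) _) big) free
        (λ F dense → none F (≤-trans dense (*-monoˡ-≤ (# F) (m≤m+n (descent-bound k p l) _))))
    where
    l = samples k p n
    l-big : p * 2 ^ (n + suc k * n) < l
    l-big = ≤-trans (s≤s (≤-reflexive (cong (p *_) (sym (^-*-assoc 2 (suc (suc k)) n))))) (m≤m+n (suc (p * (2 ^ suc (suc k)) ^ n)) (suc k))

  free-sub : ∀ {M M'} (y : Fin M → Vector n) (ι : Fin M' → Fin M) → (∀ s t → ι s ≡ ι t → s ≡ t) →
    ZeroSumFree p y → ZeroSumFree p (y ∘ ι)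
  free-sub y ι inj free (g , g-inj , e) = free (ι ∘ g , (λ s t q → g-inj s t (inj _ _ q)) , e)

  -- The choices of p terms form a finite type and can be searched, so the contradiction in
  -- `sequence-bound` suffices for a witness.
  zero-sum-exists : ∀ q → 1 ≤ q → ∀ {M} (y : Fin M → Vector n) →
    needOf q (λ k → threshold k p n) (suc (2 * q)) ^ q * p ^ n ≤ M ^ q →
    Σ (Fin p → Fin M) λ g → Injective g × gsum n (y ∘ g) ≡ zeroV n
  zero-sum-exists q 1≤q {M} y big with any? {𝕏 = Vec (Fin M) p} (λ g → injective? (Vec.lookup g) ×-dec (gsum n (y ∘ Vec.lookup g) ≟ zeroV n))
  ... | yes (g , inj , e) = Vec.lookup g , inj , e
  ... | no n' = ⊥-elim (Iterate.sequence-bound q 1≤q 2≤v (ZeroSumFree p) free-sub (λ k → threshold k p n)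
        (λ k → ≤-trans (s≤s z≤n) (m≤n+m (suc (p * suc k ^ n)) (descent-bound k p (samples k p n)))) determined y free
        (≤-trans (≤-reflexive (cong (needOf q (λ k → threshold k p n) (suc (2 * q)) ^ q *_) (size-Vector n))) big))
    where
    free : ZeroSumFree p y
    free (g , inj , e) = n' (Vec.tabulate g ,
      (λ s t q → inj s t (trans (sym (Vec.lookup∘tabulate g s)) (trans q (Vec.lookup∘tabulate g t)))) ,
      trans (gsum-cong n (λ t → cong y (Vec.lookup∘tabulate g t))) e)

-- Zero sums modulo a product

∑-nsum : ∀ {m} (f : Fin m → ℕ) → ∑ f ≡ nsum f
∑-nsum {zero}  f = trans (∑-cong {f = f} {λ _ → 0} (λ ())) ∑-0
∑-nsum {suc m} f = trans (∑-suc f) (cong (f zero +_) (∑-nsum (f ∘ suc)))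

nsum-% : ∀ p {{_ : NonZero p}} {m} (f : Fin m → ℕ) → nsum f % p ≡ nsum (λ i → f i % p) % p
nsum-% p {zero}  f = refl
nsum-% p {suc m} f = begin
  (f zero + nsum (f ∘ suc)) % p                          ≡⟨ %-distribˡ-+ (f zero) (nsum (f ∘ suc)) p ⟩
  (f zero % p + nsum (f ∘ suc) % p) % p                  ≡⟨ cong₂ (λ a b → (a + b) % p) (sym (m%n%n≡m%n (f zero) p)) (nsum-% p (f ∘ suc)) ⟩
  (f zero % p % p + nsum (λ i → f (suc i) % p) % p) % p  ≡⟨ sym (%-distribˡ-+ (f zero % p) (nsum (λ i → f (suc i) % p)) p) ⟩
  (f zero % p + nsum (λ i → f (suc i) % p)) % p          ∎
  where open ≡-Reasoning

module _ {I A : Set} {{EI : Enum I}} {{EA : Enum A}} (B : I → Bool) (F : I → A → Bool) where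

  ⋃ : A → Bool
  ⋃ i = does (any? (λ t → ∈? (λ t → B t ∧ F t i) t))

  ∑-⋃ : (∀ t t' i → t ∈ B → t' ∈ B → i ∈ F t → i ∈ F t' → t ≡ t') → (h : A → ℕ) →
    ∑ (λ i → 𝟙 (⋃ i) * h i) ≡ ∑ (λ t → 𝟙 (B t) * ∑ (λ i → 𝟙 (F t i) * h i))
  ∑-⋃ disj h = begin
    ∑ (λ i → 𝟙 (⋃ i) * h i)                                   ≡⟨ ∑-cong (λ i → trans (cong (_* h i) (pt i)) (sym (∑-*ʳ (λ t → 𝟙 (B t ∧ F t i)) (h i)))) ⟩
    ∑ (λ i → ∑ (λ t → 𝟙 (B t ∧ F t i) * h i))                 ≡⟨ ∑-swap (λ i t → 𝟙 (B t ∧ F t i) * h i) ⟩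
    ∑ (λ t → ∑ (λ i → 𝟙 (B t ∧ F t i) * h i))                 ≡⟨ ∑-cong (λ t → trans (∑-cong (λ i → trans (cong (_* h i) (𝟙-∧ (B t) (F t i))) (*-assoc (𝟙 (B t)) _ (h i)))) (∑-*ˡ (𝟙 (B t)) (λ i → 𝟙 (F t i) * h i))) ⟩
    ∑ (λ t → 𝟙 (B t) * ∑ (λ i → 𝟙 (F t i) * h i))             ∎
    where
    open ≡-Reasoning
    pt : ∀ i → 𝟙 (⋃ i) ≡ ∑ (λ t → 𝟙 (B t ∧ F t i))
    pt i with any? (λ t → ∈? (λ t → B t ∧ F t i) t)
    ... | yes (t , m) = ≤-antisym (≤-trans (≤-reflexive (sym (𝟙-yes m))) (∑-≥ (λ t → 𝟙 (B t ∧ F t i)) t))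
          (≤-trans (≤-reflexive (sym (#-def (λ t → B t ∧ F t i)))) (#-unique (λ t t' q q' →
            disj t t' i (∧-l q) (∧-l q') (∧-r {B t} q) (∧-r {B t'} q'))))
    ... | no n = sym (trans (∑-cong (λ t → 𝟙-no (λ q → n (t , q)))) ∑-0)

  #-⋃ : (∀ t t' i → t ∈ B → t' ∈ B → i ∈ F t → i ∈ F t' → t ≡ t') → # ⋃ ≡ ∑ (λ t → 𝟙 (B t) * # (F t))
  #-⋃ disj = trans (trans (#-def ⋃) (∑-cong (λ i → sym (*-identityʳ _)))) (trans (∑-⋃ disj (λ _ → 1))
    (∑-cong (λ t → cong (𝟙 (B t) *_) (trans (∑-cong (λ i → *-identityʳ _)) (sym (#-def (F t)))))))

point : {{E : Enum 𝕏}} → 𝕏 → 𝕏 → Bool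
point a i = does (i ≟ a)

#-point : {{E : Enum 𝕏}} (a : 𝕏) → # (point a) ≡ 1
#-point a = trans (#-def (point a)) (∑-once a)

-- Over ℕ rather than residues, so that for composite m zero sums modulo a factor can be divided by it.
Good : ℕ → ℕ → ℕ → Set
Good m n s = (x : Fin s → Fin n → ℕ) →
  Σ (Fin s → Bool) λ S → # S ≡ m × (∀ c → m ∣ᴺ.∣ ∑ (λ i → 𝟙 (S i) * x i c))

module _ {t s : ℕ} (ι : Fin t → Fin s) (ι-inj : Injective ι) (S : Fin t → Bool) where

  pushed : Fin s → Bool
  pushed = ⋃ S (λ u → point (ι u))

  private
    disj : ∀ u u' i → u ∈ S → u' ∈ S → i ∈ point (ι u) → i ∈ point (ι u') → u ≡ u'
    disj u u' i _ _ q q' = ι-inj u u' (trans (sym (out (i ≟ ι u) q)) (out (i ≟ ι u') q'))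

  ∑-pushed : (h : Fin s → ℕ) → ∑ (λ i → 𝟙 (pushed i) * h i) ≡ ∑ (λ u → 𝟙 (S u) * h (ι u))
  ∑-pushed h = trans (∑-⋃ S (λ u → point (ι u)) disj h) (∑-cong (λ u → cong (𝟙 (S u) *_) (∑-δ (ι u) h)))

  #-pushed : # pushed ≡ # S
  #-pushed = trans (#-⋃ S (λ u → point (ι u)) disj)
    (trans (∑-cong (λ u → trans (cong (𝟙 (S u) *_) (#-point (ι u))) (*-identityʳ _))) (sym (#-def S)))

good-in : ∀ {m n t s} → Good m n t → (ι : Fin t → Fin s) → Injective ι → (x : Fin s → Fin n → ℕ) →
  Σ (Fin s → Bool) λ S → # S ≡ m × (∀ c → m ∣ᴺ.∣ ∑ (λ i → 𝟙 (S i) * x i c)) × (∀ i → i ∈ S → ∃[ u ] ι u ≡ i)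
good-in {m} good ι inj x with good (x ∘ ι)
... | S , size-S , div = pushed ι inj S , trans (#-pushed ι inj S) size-S ,
      (λ c → subst (m ∣ᴺ.∣_) (sym (∑-pushed ι inj S (λ i → x i c))) (div c)) ,
      λ i h → let (u , q) = out (any? (λ u → ∈? (λ u → S u ∧ point (ι u) i) u)) h in u , sym (out (i ≟ ι u) (∧-r {S u} q))

good-prime : ∀ p (pp : Prime p) n (1≤n : 1 ≤ n) q → 1 ≤ q → ∀ M →
  needOf q (λ k → threshold k p n) (suc (2 * q)) ^ q * p ^ n ≤ M ^ q → Good p n M
good-prime p pp n 1≤n q 1≤q M big x with PrimeCase.zero-sum-exists p pp n 1≤n q 1≤q {M} y big
  where
  open Residues p {{prime⇒nonZero pp}}
  y : Fin M → Vector n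
  y i = Vec.tabulate (λ c → md (x i c))
... | g , inj , e = pushed g inj (λ _ → true) , trans (#-pushed g inj (λ _ → true)) (trans (#-def {Fin p} (λ _ → true)) (size-Fin p)) ,
      λ c → subst (p ∣ᴺ.∣_) (sym (trans (∑-pushed g inj (λ _ → true) (λ i → x i c)) (trans (∑-cong (λ t → *-identityˡ _)) (∑-nsum (λ t → x (g t) c))))) (div c)
  where
  instance
    nzp′ : NonZero p
    nzp′ = prime⇒nonZero pp
  open Residues p {{nzp′}}
  open ≡-Reasoning
  y : Fin M → Vector n
  y i = Vec.tabulate (λ c → md (x i c))
  div : ∀ c → p ∣ᴺ.∣ nsum (λ t → x (g t) c)
  div c = ∣ᴺ.m%n≡0⇒n∣m _ p (begin
    nsum (λ t → x (g t) c) % p                              ≡⟨ nsum-% p (λ t → x (g t) c) ⟩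
    nsum (λ t → x (g t) c % p) % p                          ≡⟨ cong (_% p) (nsum-cong (λ t → sym (trans (cong toℕ (Vec.lookup∘tabulate (λ c → md (x (g t) c)) c)) (toℕ-md _)))) ⟩
    nsum (λ t → toℕ (Vec.lookup (y (g t)) c)) % p           ≡⟨ sym (lookup-gsum n (y ∘ g) c) ⟩
    toℕ (Vec.lookup (gsum n (y ∘ g)) c)                     ≡⟨ cong (λ v → toℕ (Vec.lookup v c)) e ⟩
    toℕ (Vec.lookup (zeroV n) c)                            ≡⟨ trans (cong toℕ (Vec.lookup-replicate c (md 0))) (trans (toℕ-md 0) 0%p≡0) ⟩
    0                                                       ∎)

good-product : ∀ {a b n sa sb s} → Good a n sa → Good b n sb → a * sb + sa ≤ s → Good (a * b) n s
good-product {a} {b} {n} {sa} {sb} {s} good-a good-b room x = result (blocks sb ≤-refl)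
  where
  record Blocks (t : ℕ) : Set where
    field
      block : Fin t → Fin s → Bool
      count : ∀ u → # (block u) ≡ a
      apart : ∀ u u' i → i ∈ block u → i ∈ block u' → u ≡ u'
      quot  : Fin t → Fin n → ℕ
      sums  : ∀ u c → ∑ (λ i → 𝟙 (block u i) * x i c) ≡ quot u c * a
  blocks : ∀ t → t ≤ sb → Blocks t
  blocks zero    _ = record { block = λ () ; count = λ () ; apart = λ () ; quot = λ () ; sums = λ () }
  blocks (suc t) t<sb = next (blocks t (<⇒≤ t<sb))
    where
    open ≤-Reasoning
    next : Blocks t → Blocks (suc t)
    next old = add (pick (not ∘ used) enough)
      where
      open Blocks old
      used : Fin s → Bool
      used i = does (any? (λ u → ∈? (block u) i))
      used-few : # used ≤ a * sb
      used-few = begin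
        # used                       ≤⟨ #-any block ⟩
        ∑ (λ u → # (block u))        ≡⟨ ∑-cong count ⟩
        ∑ {Fin t} (λ _ → a)          ≡⟨ trans (∑-const {Fin t} a) (cong (a *_) (size-Fin t)) ⟩
        a * t                        ≤⟨ *-monoʳ-≤ a (<⇒≤ t<sb) ⟩
        a * sb                       ∎
      enough : sa ≤ # (not ∘ used)
      enough = +-cancelˡ-≤ (a * sb) sa (# (not ∘ used)) (begin
        a * sb + sa                          ≤⟨ room ⟩
        s                                    ≡⟨ sym (trans (#-def {Fin s} (λ _ → true)) (size-Fin s)) ⟩
        # {Fin s} (λ _ → true)               ≡⟨ #-split (λ _ → true) used ⟩
        # used + # (not ∘ used)              ≤⟨ +-monoˡ-≤ _ used-few ⟩
        a * sb + # (not ∘ used)              ∎)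
      add : (Σ (Fin sa → Fin s) λ ι → (∀ u u' → ι u ≡ ι u' → u ≡ u') × (∀ u → ι u ∈ (not ∘ used))) → Blocks (suc t)
      add (ι , inj , fresh-ι) with good-in good-a ι inj x
      ... | S , size-S , div , inside-ι = record { block = block' ; count = count' ; apart = apart' ; quot = quot' ; sums = sums' }
        where
        block' : Fin (suc t) → Fin s → Bool
        block' zero    = S
        block' (suc u) = block u
        count' : ∀ u → # (block' u) ≡ a
        count' zero    = size-S
        count' (suc u) = count u
        new : ∀ u i → i ∈ S → i ∉ block u
        new u i h h' with inside-ι i h
        ... | v , refl = not-out (fresh-ι v) (into (any? (λ u → ∈? (block u) (ι v))) (u , h'))
        apart' : ∀ u u' i → i ∈ block' u → i ∈ block' u' → u ≡ u'
        apart' zero    zero     i _ _  = refl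
        apart' zero    (suc u') i h h' = ⊥-elim (new u' i h h')
        apart' (suc u) zero     i h h' = ⊥-elim (new u i h' h)
        apart' (suc u) (suc u') i h h' = cong suc (apart u u' i h h')
        quot' : Fin (suc t) → Fin n → ℕ
        quot' zero    c = ∣ᴺ._∣_.quotient (div c)
        quot' (suc u) c = quot u c
        sums' : ∀ u c → ∑ (λ i → 𝟙 (block' u i) * x i c) ≡ quot' u c * a
        sums' zero    c = ∣ᴺ._∣_.equality (div c)
        sums' (suc u) c = sums u c
  result : Blocks sb → Σ (Fin s → Bool) λ S → # S ≡ a * b × (∀ c → a * b ∣ᴺ.∣ ∑ (λ i → 𝟙 (S i) * x i c))
  result bl with good-b (Blocks.quot bl)
  ... | B , size-B , div = ⋃ B block , size-U , div-U
    where
    open Blocks bl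
    open ≡-Reasoning
    disj : ∀ u u' i → u ∈ B → u' ∈ B → i ∈ block u → i ∈ block u' → u ≡ u'
    disj u u' i _ _ = apart u u' i
    size-U : # (⋃ B block) ≡ a * b
    size-U = begin
      # (⋃ B block)                         ≡⟨ #-⋃ B block disj ⟩
      ∑ (λ u → 𝟙 (B u) * # (block u))       ≡⟨ ∑-cong (λ u → cong (𝟙 (B u) *_) (count u)) ⟩
      ∑ (λ u → 𝟙 (B u) * a)                 ≡⟨ trans (∑-*ʳ (𝟙 ∘ B) a) (cong (_* a) (sym (#-def B))) ⟩
      # B * a                               ≡⟨ trans (cong (_* a) size-B) (*-comm b a) ⟩
      a * b                                 ∎
    div-U : ∀ c → a * b ∣ᴺ.∣ ∑ (λ i → 𝟙 (⋃ B block i) * x i c)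
    div-U c = subst₂ ∣ᴺ._∣_ (*-comm b a) (sym eq) (∣ᴺ.*-monoˡ-∣ a (div c))
      where
      eq : ∑ (λ i → 𝟙 (⋃ B block i) * x i c) ≡ ∑ (λ u → 𝟙 (B u) * quot u c) * a
      eq = begin
        ∑ (λ i → 𝟙 (⋃ B block i) * x i c)                     ≡⟨ ∑-⋃ B block disj (λ i → x i c) ⟩
        ∑ (λ u → 𝟙 (B u) * ∑ (λ i → 𝟙 (block u i) * x i c))   ≡⟨ ∑-cong (λ u → trans (cong (𝟙 (B u) *_) (sums u c)) (sym (*-assoc (𝟙 (B u)) (quot u c) a))) ⟩
        ∑ (λ u → 𝟙 (B u) * quot u c * a)                      ≡⟨ ∑-*ʳ (λ u → 𝟙 (B u) * quot u c) a ⟩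
        ∑ (λ u → 𝟙 (B u) * quot u c) * a                      ∎

good-one : ∀ {n s} → 1 ≤ s → Good 1 n s
good-one {s = suc s} _ x = point zero , #-point zero , λ c → ∣ᴺ.1∣ _

-- The constants for a composite modulus

module Composite (q : ℕ) (1≤q : 1 ≤ q) where

  opaque
    prime-tame : Tame (λ p n → needOf q (λ k → threshold k p n) (suc (2 * q)))
    prime-tame = tame-need q tame-threshold (suc (2 * q))

  C : ℕ
  C = suc (proj₁ prime-tame)

  -- m₀ stands for the full modulus while m runs through products of its prime factors. As all
  -- factors are measured by the same m₀ and C, combining them only changes D, and C is not
  -- multiplied up along the factorisation.
  Suffices : ℕ → ℕ → Set
  Suffices m D = ∀ m₀ → m ≤ m₀ → ∀ n → 1 ≤ n → ∀ s → D ^ q * C ^ (q * n) * m₀ ^ n ≤ s ^ q → Good m n s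

  prime-suffices : ∀ p → Prime p → ∃[ D ] 1 ≤ D × Suffices p D
  prime-suffices p pp = suc d , s≤s z≤n , λ m₀ p≤m₀ n 1≤n s big → good-prime p pp n 1≤n q 1≤q s (begin
      N n ^ q * p ^ n                               ≤⟨ *-mono-≤ (^-monoˡ-≤ q (≤-trans (proj₂ bnd n) (*-mono-≤ (n≤1+n d) (^-monoˡ-≤ n (n≤1+n (proj₁ prime-tame)))))) (^-monoˡ-≤ n p≤m₀) ⟩
      (suc d * C ^ n) ^ q * m₀ ^ n                  ≡⟨ cong (_* m₀ ^ n) (trans (*-^ q (suc d) (C ^ n)) (cong (suc d ^ q *_) (trans (^-*-assoc C n q) (cong (C ^_) (*-comm n q))))) ⟩
      suc d ^ q * C ^ (q * n) * m₀ ^ n              ≤⟨ big ⟩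
      s ^ q                                         ∎)
    where
    open ≤-Reasoning
    N : ℕ → ℕ
    N n = needOf q (λ k → threshold k p n) (suc (2 * q))
    bnd = proj₂ prime-tame p
    d = proj₁ bnd

  1≤C^ : ∀ k → 1 ≤ C ^ k
  1≤C^ k = ^-pos k (s≤s z≤n)

  D≤s : ∀ {D X s} → 1 ≤ X → D ^ q * X ≤ s ^ q → D ≤ s
  D≤s {D} {X} 1≤X big = ^-root q 1≤q (≤-trans (≤-trans (≤-reflexive (sym (*-identityʳ (D ^ q)))) (*-monoʳ-≤ (D ^ q) 1≤X)) big)

  -- Dividing s by D leaves a quotient k for which (k + 1)^q covers the part that grows with n; the
  -- lengths (k + 1) Da and (k + 1) Db are then enough for the two factors. Since k ≥ 1, k + 1 is at
  -- most 2k, which accounts for the 2 in D.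
  product-suffices : ∀ a b Da Db → 1 ≤ a → 1 ≤ b → 1 ≤ Da → 1 ≤ Db → Suffices a Da → Suffices b Db →
    Suffices (a * b) (2 * (a * Db + Da))
  product-suffices a b Da Db 1≤a 1≤b 1≤Da 1≤Db suf-a suf-b m₀ ab≤m₀ n 1≤n s big =
    good-product (suf-a m₀ (≤-trans (m≤m*n a b {{>-nonZero 1≤b}}) ab≤m₀) n 1≤n (suc k * Da) (part Da))
      (suf-b m₀ (≤-trans (m≤n*m b a {{>-nonZero 1≤a}}) ab≤m₀) n 1≤n (suc k * Db) (part Db)) (begin
      a * (suc k * Db) + suc k * Da     ≡⟨ e₁ a (suc k) Db Da ⟩
      suc k * (a * Db + Da)             ≤⟨ *-monoˡ-≤ (a * Db + Da) (≤-trans (+-monoˡ-≤ k 1≤k) (≤-reflexive (cong (k +_) (sym (+-identityʳ k))))) ⟩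
      2 * k * (a * Db + Da)             ≡⟨ e₂ k (a * Db + Da) ⟩
      k * D                             ≤⟨ m/n*n≤m s D ⟩
      s                                 ∎)
    where
    open ≤-Reasoning
    D = 2 * (a * Db + Da)
    1≤D : 1 ≤ D
    1≤D = *-pos {2} (s≤s z≤n) (≤-trans 1≤Da (m≤n+m Da (a * Db)))
    instance
      nzD : NonZero D
      nzD = >-nonZero 1≤D
    X = C ^ (q * n) * m₀ ^ n
    1≤X : 1 ≤ X
    1≤X = *-pos (1≤C^ (q * n)) (^-pos n (≤-trans (*-pos 1≤a 1≤b) ab≤m₀))
    big' : D ^ q * X ≤ s ^ q
    big' = ≤-trans (≤-reflexive (sym (*-assoc (D ^ q) (C ^ (q * n)) (m₀ ^ n)))) big
    k = s / D
    1≤k : 1 ≤ k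
    1≤k = ≤-trans (≤-reflexive (sym (trans (cong (_/ D) (sym (*-identityˡ D))) (m*n/n≡m 1 D)))) (/-mono-≤ (D≤s {D} {X} 1≤X big') (≤-refl {D}))
    X≤ : X ≤ suc k ^ q
    X≤ = *-cancelˡ (D ^ q) (^-pos q 1≤D) (begin
      D ^ q * X             ≤⟨ big' ⟩
      s ^ q                 ≤⟨ ^-monoˡ-≤ q (≤-trans (≤-reflexive (m≡m%n+[m/n]*n s D)) (≤-trans (+-monoˡ-≤ (k * D) (<⇒≤ (m%n<n s D))) (≤-reflexive (*-comm (suc k) D)))) ⟩
      (D * suc k) ^ q       ≡⟨ *-^ q D (suc k) ⟩
      D ^ q * suc k ^ q     ∎)
    part : ∀ E → E ^ q * C ^ (q * n) * m₀ ^ n ≤ (suc k * E) ^ q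
    part E = begin
      E ^ q * C ^ (q * n) * m₀ ^ n   ≡⟨ *-assoc (E ^ q) (C ^ (q * n)) (m₀ ^ n) ⟩
      E ^ q * X                      ≤⟨ *-monoʳ-≤ (E ^ q) X≤ ⟩
      E ^ q * suc k ^ q              ≡⟨ trans (*-comm (E ^ q) (suc k ^ q)) (sym (*-^ q (suc k) E)) ⟩
      (suc k * E) ^ q                ∎
    e₁ : ∀ a k x y → a * (k * x) + k * y ≡ k * (a * x + y)
    e₁ = solve-∀
    e₂ : ∀ k z → 2 * k * z ≡ k * (2 * z)
    e₂ = solve-∀

  Bounded : ℕ → Set
  Bounded m = ∃[ D ] 1 ≤ D × Suffices m D

  bounded-one : Bounded 1
  bounded-one = 1 , ≤-refl , enough
    where
    enough : Suffices 1 1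
    enough m₀ 1≤m₀ n 1≤n s big = good-one (D≤s {1} {C ^ (q * n) * m₀ ^ n} (*-pos (1≤C^ (q * n)) (^-pos n 1≤m₀))
      (≤-trans (≤-reflexive (sym (*-assoc (1 ^ q) (C ^ (q * n)) (m₀ ^ n)))) big))

  bounded-product : ∀ a b → 1 ≤ a → 1 ≤ b → Bounded a → Bounded b → Bounded (a * b)
  bounded-product a b 1≤a 1≤b (Da , 1≤Da , suf-a) (Db , 1≤Db , suf-b) = 2 * (a * Db + Da) ,
    *-pos {2} (s≤s z≤n) (≤-trans 1≤Da (m≤n+m Da (a * Db))) , product-suffices a b Da Db 1≤a 1≤b 1≤Da 1≤Db suf-a suf-b

  list-suffices : ∀ ps → All Prime ps → Bounded (product ps)
  list-suffices []       _          = bounded-one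
  list-suffices (p ∷ ps) (pp ∷ pps) = bounded-product p (product ps) (>-nonZero⁻¹ p {{prime⇒nonZero pp}})
    (productOfPrimes≥1 pps) (prime-suffices p pp) (list-suffices ps pps)

  suffices : ∀ m → 1 ≤ m → Bounded m
  suffices m 1≤m = subst Bounded (sym (PrimeFactorisation.isFactorisation f))
      (list-suffices (PrimeFactorisation.factors f) (PrimeFactorisation.factorsPrime f))
    where f = factorise m {{>-nonZero 1≤m}}

-- Back to the Erdős-Ginzburg-Ziv constant

sumOver-tabulate : ∀ {s} (S : Fin s → Bool) (f : Fin s → ℕ) → sumOver (Vec.tabulate S) f ≡ ∑ (λ i → 𝟙 (S i) * f i)
sumOver-tabulate {zero}  S f = sym (∑-nsum (λ i → 𝟙 (S i) * f i))
sumOver-tabulate {suc s} S f = trans (head-case (S zero)) (sym (∑-suc (λ i → 𝟙 (S i) * f i)))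
  where
  rest = sumOver-tabulate (S ∘ suc) (f ∘ suc)
  head-case : ∀ b → sumOver (b ∷ Vec.tabulate (S ∘ suc)) f ≡ 𝟙 b * f zero + ∑ (λ i → 𝟙 (S (suc i)) * f (suc i))
  head-case true  = cong₂ _+_ (sym (*-identityˡ (f zero))) rest
  head-case false = rest

card-tabulate : ∀ {s} (S : Fin s → Bool) → ∣ Vec.tabulate S ∣ˢ ≡ # S
card-tabulate {zero}  S = sym (trans (#-def S) (∑-nsum (𝟙 ∘ S)))
card-tabulate {suc s} S = trans (head-case (S zero)) (sym (#-suc S))
  where
  head-case : ∀ b → ∣ b ∷ Vec.tabulate (S ∘ suc) ∣ˢ ≡ 𝟙 b + # (S ∘ suc)
  head-case true  = cong suc (card-tabulate (S ∘ suc))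
  head-case false = card-tabulate (S ∘ suc)

sumOver-cong : ∀ {s} (S : Subset s) {f g : Fin s → ℕ} → (∀ i → f i ≡ g i) → sumOver S f ≡ sumOver S g
sumOver-cong []            e = refl
sumOver-cong (inside  ∷ S) e = cong₂ _+_ (e zero) (sumOver-cong S (e ∘ suc))
sumOver-cong (outside ∷ S) e = sumOver-cong S (e ∘ suc)

good⇒EGZ : ∀ {m n s} → Good m n s → HasEGZProperty m n s
good⇒EGZ {m} good x with good (λ i c → toℕ (x i c))
... | S , size-S , div = Vec.tabulate S , trans (card-tabulate S) size-S ,
      λ c → subst (m ∣ᴺ.∣_) (sym (sumOver-tabulate S (λ i → toℕ (x i c)))) (div c)

-- Sequences, coded as vectors, and subsets are finite in number, so the property can be decided and
-- its least s is found by search.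
EGZ? : ∀ m n s → Dec (HasEGZProperty m n s)
EGZ? m n s = map′ to from (all? {𝕏 = Vec (Vec (Fin m) n) s} (λ X → any? {𝕏 = Subset s} (λ S →
    (∣ S ∣ˢ Data.Nat.≟ m) ×-dec all? (λ c → m ∣ᴺ.∣? sumOver S (λ i → toℕ (entry X i c))))))
  where
  entry : Vec (Vec (Fin m) n) s → Fin s → Fin n → Fin m
  entry X i c = Vec.lookup (Vec.lookup X i) c
  to : (∀ X → ∃[ S ] ∣ S ∣ˢ ≡ m × (∀ c → m ∣ᴺ.∣ sumOver S (λ i → toℕ (entry X i c)))) → HasEGZProperty m n s
  to h x with h (Vec.tabulate (λ i → Vec.tabulate (x i)))
  ... | S , size-S , div = S , size-S , λ c → subst (m ∣ᴺ.∣_) (sumOver-cong S (λ i → cong toℕ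
        (trans (cong (λ v → Vec.lookup v c) (Vec.lookup∘tabulate (λ i → Vec.tabulate (x i)) i)) (Vec.lookup∘tabulate (x i) c)))) (div c)
  from : HasEGZProperty m n s → ∀ X → ∃[ S ] ∣ S ∣ˢ ≡ m × (∀ c → m ∣ᴺ.∣ sumOver S (λ i → toℕ (entry X i c)))
  from h X = h (entry X)

minimum : (P : ℕ → Set) → (∀ n → Dec (P n)) → ∀ n → P n → ∃[ m ] P m × (∀ k → P k → m ≤ k)
minimum P P? n pn with P? 0
... | yes p0 = 0 , p0 , λ _ _ → z≤n
minimum P P? zero    pn | no ¬p0 = ⊥-elim (¬p0 pn)
minimum P P? (suc n) pn | no ¬p0 with minimum (P ∘ suc) (P? ∘ suc) n pn
... | m , pm , least-m = suc m , pm , λ { zero p0 → ⊥-elim (¬p0 p0) ; (suc k) pk → s≤s (least-m k pk) }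

theorem1p1 : (p q : ℕ) → p ≥ 1 → q ≥ 1 →
    ∃[ C ] ((m : ℕ) → m ≥ 2 →
    ∃[ D ] ((n : ℕ) → n ≥ 1 →
    ∃[ s ] (IsEGZConstant m n s × s ^ q ≤ D ^ q * C ^ (q * n) * m ^ (p * n))))
theorem1p1 p q 1≤p 1≤q = C , λ m 2≤m → 2 * D m 2≤m , λ n 1≤n → bounded m 2≤m n 1≤n
  where
  open Composite q 1≤q
  D : ∀ m → m ≥ 2 → ℕ
  D m 2≤m = proj₁ (suffices m (<⇒≤ 2≤m))
  bounded : ∀ m (2≤m : m ≥ 2) n → n ≥ 1 →
    ∃[ s ] (IsEGZConstant m n s × s ^ q ≤ (2 * D m 2≤m) ^ q * C ^ (q * n) * m ^ (p * n))
  bounded m 2≤m n 1≤n = conclude (minimum (HasEGZProperty m n) (EGZ? m n) Y (good⇒EGZ (suf m ≤-refl n 1≤n Y Y-big)))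
    where
    open ≤-Reasoning
    1≤m : 1 ≤ m
    1≤m = <⇒≤ 2≤m
    d = D m 2≤m
    1≤d : 1 ≤ d
    1≤d = proj₁ (proj₂ (suffices m (<⇒≤ 2≤m)))
    suf : Suffices m d
    suf = proj₂ (proj₂ (suffices m (<⇒≤ 2≤m)))
    -- Any s with Y ≤ s^q is long enough. Y itself is one of them because Y ≤ Y^q, and it serves as
    -- the end of the search for the least s.
    Y = d ^ q * C ^ (q * n) * m ^ n
    1≤Y : 1 ≤ Y
    1≤Y = *-pos (*-pos (^-pos q 1≤d) (1≤C^ (q * n))) (^-pos n 1≤m)
    Y-big : Y ≤ Y ^ q
    Y-big = ≤-trans (≤-reflexive (sym (^-identityʳ Y))) (^-monoʳ-≤ Y {{>-nonZero 1≤Y}} 1≤q)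
    target : ℕ
    target = (2 * d) ^ q * C ^ (q * n) * m ^ (p * n)
    2^Y≤target : 2 ^ q * Y ≤ target
    2^Y≤target = begin
      2 ^ q * (d ^ q * C ^ (q * n) * m ^ n)     ≡⟨ e (2 ^ q) (d ^ q) (C ^ (q * n)) (m ^ n) ⟩
      2 ^ q * d ^ q * C ^ (q * n) * m ^ n       ≡⟨ cong (λ z → z * C ^ (q * n) * m ^ n) (sym (*-^ q 2 d)) ⟩
      (2 * d) ^ q * C ^ (q * n) * m ^ n         ≤⟨ *-monoʳ-≤ ((2 * d) ^ q * C ^ (q * n)) (^-monoʳ-≤ m {{>-nonZero 1≤m}} (≤-trans (≤-reflexive (sym (*-identityˡ n))) (*-monoˡ-≤ n 1≤p))) ⟩
      target                                    ∎
      where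
      e : ∀ a b c d → a * (b * c * d) ≡ a * b * c * d
      e = solve-∀
    -- For s ≥ 2, minimality means that s - 1 lacks the property, so (s - 1)^q < Y, and s ≤ 2(s - 1)
    -- explains the factor 2 before d. The values 0 and 1 lie below any positive bound.
    small : ∀ s → (∀ k → HasEGZProperty m n k → s ≤ k) → s ^ q ≤ target
    small zero    _ = ≤-trans (^-monoˡ-≤ q (z≤n {1})) (≤-trans (≤-reflexive (^-zeroˡ q)) (≤-trans (*-pos (^-pos q (s≤s z≤n)) 1≤Y) 2^Y≤target))
    small (suc zero) _ = ≤-trans (≤-reflexive (^-zeroˡ q)) (≤-trans (*-pos (^-pos q (s≤s z≤n)) 1≤Y) 2^Y≤target)
    small (suc (suc t)) least-s = begin
      suc (suc t) ^ q         ≤⟨ ^-monoˡ-≤ q (s≤s (≤-trans (m≤n+m (suc t) t) (≤-reflexive (cong (t +_) (sym (+-identityʳ (suc t))))))) ⟩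
      (2 * suc t) ^ q         ≡⟨ *-^ q 2 (suc t) ⟩
      2 ^ q * suc t ^ q       ≤⟨ *-monoʳ-≤ (2 ^ q) (<⇒≤ (≰⇒> (λ le → <⇒≱ (n<1+n (suc t)) (least-s (suc t) (good⇒EGZ (suf m ≤-refl n 1≤n (suc t) le)))))) ⟩
      2 ^ q * Y               ≤⟨ 2^Y≤target ⟩
      target                  ∎
    conclude : (∃[ s ] HasEGZProperty m n s × (∀ k → HasEGZProperty m n k → s ≤ k)) →
      ∃[ s ] (IsEGZConstant m n s × s ^ q ≤ target)
    conclude (s , has , least-s) = s , (has , least-s) , small s least-s
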